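{- The assignment $\mathsf{M}\mapsto Y_{\mathsf{M}}(t)\in\mathbb{R}[t]$ (regarded as a map on matroid base polytopes, $\mathscr{P}(\mathsf{M})\mapsto Y_{\mathsf{M}}(t)$) is a valuative invariant.
   Context: For a matroid $\mathsf{M}$ on $E$ with rank function $\mathrm{rk}$, $\mathcal{L}(\mathsf{M})$ is its lattice of flats, $\mathsf{M}|_F$ the restriction, $\mathsf{M}/F$ the contraction; $\mathrm{rk}(\mathsf{M}/F)=\mathrm{rk}(\mathsf{M})-\mathrm{rk}(F)$. For loopless $\mathsf{M}$, $\mu_{\mathsf{M}}=\mu(\emptyset,E)$ in $\mathcal{L}(\mathsf{M})$ ($=1$ in rank $0$), $\chi_{\mathsf{M}}(t)=\sum_{F\in\mathcal{L}(\mathsf{M})}\mu_{\mathsf{M}|_F}t^{\mathrm{rk}(\mathsf{M}/F)}$. The inverse Kazhdan–Lusztig polynomial $Q_{\mathsf{M}}(t)$ of a loopless matroid is the unique assignment with $Q_{\mathsf{M}}=1$ in rank $0$, $\deg Q_{\mathsf{M}}<\mathrm{rk}(\mathsf{M})/2$ in positive rank, and $(-t)^{\mathrm{rk}(\mathsf{M})}Q_{\mathsf{M}}(t^{ -1})=\sum_{F\in\mathcal{L}(\mathsf{M})}(-1)^{\mathrm{rk}(F)}Q_{\mathsf{M}|_F}(t)t^{\mathrm{rk}(\mathsf{M}/F)}\chi_{\mathsf{M}/F}(t^{ -1})$. For loopless $\mathsf{M}$, $Y_{\mathsf{M}}(t)=(-1)^{\mathrm{rk}(\mathsf{M})}\sum_{F\in\mathcal{L}(\mathsf{M})}(-1)^{\mathrm{rk}(F)}Q_{\mathsf{M}|_F}(t)t^{\mathrm{rk}(\mathsf{M}/F)}\mu_{\mathsf{M}/F}$;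 if $\mathsf{M}$ has loops, $Y_{\mathsf{M}}:=Y_{\mathsf{M}'}$ with $\mathsf{M}'$ the deletion of all loops. Matroids have finite ground sets $E\subseteq\mathbb{Z}_{\ge1}$. The base polytope of $\mathsf{M}=(E,\mathscr{B})$ is $\mathscr{P}(\mathsf{M})=\mathrm{conv}\{e_B:B\in\mathscr{B}\}\subseteq\mathbb{R}^E$, $e_B=\sum_{i\in B}e_i$. A subdivision of $\mathscr{P}=\mathscr{P}(\mathsf{M})$ is a finite collection $\mathcal{S}=\{\mathscr{P}_1,\dots,\mathscr{P}_s\}$ of matroid base polytopes in $\mathbb{R}^E$ with $\mathscr{P}=\bigcup\mathscr{P}_i$, every face of each $\mathscr{P}_i$ lies in $\mathcal{S}$, and $\mathscr{P}_i\cap\mathscr{P}_j$ is a common (possibly empty) face for $i\neq j$; $\mathcal{S}^{\mathrm{int}}=\{\mathscr{P}_i\in\mathcal{S}:\mathscr{P}_i\not\subseteq\partial\mathscr{P}\}$. A map $f$ from the set of all matroid base polytopes to an abelian group is an invariant if $f(\mathscr{P}(\mathsf{M}))=f(\mathscr{P}(\mathsf{N}))$ whenever $\mathsf{M}\cong\mathsf{N}$, and a valuation if $f(\mathscr{P})=\sum_{\mathscr{P}_i\in\mathcal{S}^{\mathrm{int}}}(-1)^{\dim\mathscr{P}-\dim\mathscr{P}_i}f(\mathscr{P}_i)$ for every matroid base polytope $\mathscr{P}$ and every subdivision $\mathcal{S}$ of it; a valuative invariant is both.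
   Formalization: Base polytopes, their faces, dimensions, relative interiors and subdivisions are taken in rational space, with rational points and rational linear functionals, instead of in ℝ^E. -}

module Defs where

open import Data.Bool using (Bool; true; false; if_then_else_; not; _∧_; _∨_)
open import Data.Nat as ℕ using (ℕ; zero; suc; _∸_; _≡ᵇ_; _<ᵇ_; _≤ᵇ_)
open import Data.Integer as ℤ using (ℤ)
open import Data.Rational as ℚ using (ℚ; 0ℚ; 1ℚ)
open import Data.Fin using (Fin)
open import Data.Fin.Subset as Sub using (Subset; _∩_; _∪_; ∁; ⁅_⁆; _⊆_; ⊤)
open import Data.Vec as Vec using (Vec; []; _∷_; lookup; tabulate)
open import Data.List as List using (List; []; _∷_; _++_; allFin)
open import Data.Product using (Σ; ∃; _×_; _,_)
open import Data.Sum using (_⊎_)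
open import Relation.Nullary using (¬_)
open import Relation.Binary.PropositionalEquality using (_≡_; _≢_)

-- Polynomials in ℤ[t], represented by their coefficient sequences
-- (coefficient of t^k), compared coefficientwise.

Poly : Set
Poly = ℕ → ℤ

_≈ₚ_ : Poly → Poly → Set
p ≈ₚ q = ∀ k → p k ≡ q k

0ₚ : Poly
0ₚ _ = ℤ.0ℤ

constₚ : ℤ → Poly
constₚ c zero = c
constₚ c (suc _) = ℤ.0ℤ

1ₚ : Poly
1ₚ = constₚ ℤ.1ℤ

_⊕_ : Poly → Poly → Poly
(p ⊕ q) k = p k ℤ.+ q k

scale : ℤ → Poly → Poly
scale c p k = c ℤ.* p k

sumUpTo : ℕ → (ℕ → ℤ) → ℤ
sumUpTo zero f = f zero
sumUpTo (suc k) f = sumUpTo k f ℤ.+ f (suc k)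

_⊛_ : Poly → Poly → Poly
(p ⊛ q) k = sumUpTo k (λ i → p i ℤ.* q (k ∸ i))

shift : ℕ → Poly → Poly
shift m p k = if k <ᵇ m then ℤ.0ℤ else p (k ∸ m)

-- t^d · p(t^{-1})  (a polynomial whenever deg p ≤ d)
rev : ℕ → Poly → Poly
rev d p k = if k ≤ᵇ d then p (d ∸ k) else ℤ.0ℤ

sumₚ : List Poly → Poly
sumₚ = List.foldr _⊕_ 0ₚ

sumℤ : List ℤ → ℤ
sumℤ = List.foldr ℤ._+_ ℤ.0ℤ

sign : ℕ → ℤ
sign zero = ℤ.1ℤ
sign (suc k) = ℤ.- sign k

allSub : ∀ n → List (Subset n)
allSub zero = [] ∷ []
allSub (suc n) = List.map (true ∷_) (allSub n) ++ List.map (false ∷_) (allSub n)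

allᵇ : ∀ {n} → (Fin n → Bool) → Bool
allᵇ {n} f = List.foldr (λ i b → f i ∧ b) true (allFin n)

subᵇ : ∀ {n} → Subset n → Subset n → Bool
subᵇ X Y = allᵇ (λ i → not (lookup X i) ∨ lookup Y i)

eqᵇ : ∀ {n} → Subset n → Subset n → Bool
eqᵇ X Y = subᵇ X Y ∧ subᵇ Y X

filterᵇ : ∀ {A : Set} → (A → Bool) → List A → List A
filterᵇ f [] = []
filterᵇ f (x ∷ xs) = if f x then x ∷ filterᵇ f xs else filterᵇ f xs

-- Matroids: a ground set E ⊆ Fin n together with a rank function.
-- (Rank function is given on all subsets of Fin n; axiom rk-ground says
-- it only depends on X ∩ E.)

record RawMatroid (n : ℕ) : Set where
  constructor mkMatroid
  field
    ground : Subset n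
    rk     : Subset n → ℕ
open RawMatroid public

record IsMatroid {n : ℕ} (M : RawMatroid n) : Set where
  field
    rk-ground  : ∀ X → rk M X ≡ rk M (X ∩ ground M)
    rk-card    : ∀ X → rk M X ℕ.≤ Sub.∣ X ∣
    rk-mono    : ∀ X Y → X ⊆ Y → rk M X ℕ.≤ rk M Y
    rk-submod  : ∀ X Y → rk M (X ∪ Y) ℕ.+ rk M (X ∩ Y) ℕ.≤ rk M X ℕ.+ rk M Y

rank : ∀ {n} → RawMatroid n → ℕ
rank M = rk M (ground M)

Loopless : ∀ {n} → RawMatroid n → Set
Loopless {n} M = ∀ (i : Fin n) → lookup (ground M) i ≡ true → rk M ⁅ i ⁆ ≢ 0

isFlatᵇ : ∀ {n} → RawMatroid n → Subset n → Bool
isFlatᵇ M F = subᵇ F (ground M) ∧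
  allᵇ (λ i → not (lookup (ground M) i ∧ not (lookup F i))
              ∨ not (rk M (F ∪ ⁅ i ⁆) ≡ᵇ rk M F))

flats : ∀ {n} → RawMatroid n → List (Subset n)
flats {n} M = filterᵇ (isFlatᵇ M) (allSub n)

restrict : ∀ {n} → RawMatroid n → Subset n → RawMatroid n
restrict M F = mkMatroid F (λ X → rk M (X ∩ F))

contract : ∀ {n} → RawMatroid n → Subset n → RawMatroid n
contract M F = mkMatroid E' (λ X → rk M ((X ∩ E') ∪ F) ∸ rk M F)
  where E' = ground M ∩ ∁ F

deleteLoops : ∀ {n} → RawMatroid n → RawMatroid n
deleteLoops M = mkMatroid E' (λ X → rk M (X ∩ E'))
  where E' = tabulate (λ i → lookup (ground M) i ∧ not (rk M ⁅ i ⁆ ≡ᵇ 0))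

-- Möbius function μ(X,Y) of the lattice of flats, by the recursion
-- μ(X,X) = 1, μ(X,Y) = - Σ_{X ⊆ Z ⊊ Y, Z flat} μ(X,Z); the first argument
-- is fuel (n+1 always suffices, since each step strictly shrinks Y).
möb : ∀ {n} → RawMatroid n → ℕ → Subset n → Subset n → ℤ
möb M zero X Y = ℤ.0ℤ
möb M (suc k) X Y =
  if eqᵇ X Y then ℤ.1ℤ
  else ℤ.- sumℤ (List.map (möb M k X)
         (filterᵇ (λ Z → subᵇ X Z ∧ subᵇ Z Y ∧ not (eqᵇ Z Y)) (flats M)))

-- μ_M = μ(∅, E) (for loopless M, ∅ is the bottom flat)
μ : ∀ {n} → RawMatroid n → ℤ
μ {n} M = möb M (suc n) Sub.⊥ (ground M)

mono : ℕ → Poly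
mono d = shift d 1ₚ

χ : ∀ {n} → RawMatroid n → Poly
χ M = sumₚ (List.map (λ F → scale (μ (restrict M F)) (mono (rank (contract M F))))
                     (flats M))

-- Inverse Kazhdan–Lusztig polynomials: an assignment M ↦ Q_M is given
-- as a function; IsInvKL states the defining properties (for loopless M).

QAssign : Set
QAssign = ∀ {n} → RawMatroid n → Poly

IsInvKL : QAssign → Set
IsInvKL Q = ∀ {n} (M : RawMatroid n) → IsMatroid M → Loopless M →
    (rank M ≡ 0 → Q M ≈ₚ 1ₚ)
  × (0 ℕ.< rank M → ∀ k → rank M ℕ.≤ 2 ℕ.* k → Q M k ≡ ℤ.0ℤ)
  × (scale (sign (rank M)) (rev (rank M) (Q M))
       ≈ₚ sumₚ (List.map (λ F → scale (sign (rk M F))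
                    (Q (restrict M F) ⊛ rev (rank (contract M F)) (χ (contract M F))))
                 (flats M)))

Yₗ : QAssign → ∀ {n} → RawMatroid n → Poly
Yₗ Q M = scale (sign (rank M))
  (sumₚ (List.map (λ F → scale (sign (rk M F) ℤ.* μ (contract M F))
                      (shift (rank (contract M F)) (Q (restrict M F))))
                  (flats M)))

Y : QAssign → ∀ {n} → RawMatroid n → Poly
Y Q M = Yₗ Q (deleteLoops M)

Point : ℕ → Set
Point n = Fin n → ℚ

sumFin : ∀ k → (Fin k → ℚ) → ℚ
sumFin k f = List.foldr (λ i q → f i ℚ.+ q) 0ℚ (allFin k)

IsBasis : ∀ {n} → RawMatroid n → Subset n → Set
IsBasis M B = B ⊆ ground M × Sub.∣ B ∣ ≡ rk M B × rk M B ≡ rank M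

indicator : ∀ {n} → Subset n → Point n
indicator B i = if lookup B i then 1ℚ else 0ℚ

InP : ∀ {n} → RawMatroid n → Point n → Set
InP {n} M x = Σ ℕ λ k → Σ (Fin k → Subset n) λ bs → Σ (Fin k → ℚ) λ c →
    (∀ i → IsBasis M (bs i)) × (∀ i → 0ℚ ℚ.≤ c i) × sumFin k c ≡ 1ℚ
  × (∀ j → x j ≡ sumFin k (λ i → c i ℚ.* indicator (bs i) j))

InAff : ∀ {n} → RawMatroid n → Point n → Set
InAff {n} M y = Σ ℕ λ k → Σ (Fin k → Point n) λ p → Σ (Fin k → ℚ) λ c →
    (∀ i → InP M (p i)) × sumFin k c ≡ 1ℚ
  × (∀ j → y j ≡ sumFin k (λ i → c i ℚ.* p i j))

dot : ∀ {n} → Point n → Point n → ℚ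
dot {n} w x = sumFin n (λ j → w j ℚ.* x j)

Face : ∀ {n} → RawMatroid n → Point n → Point n → Set
Face M w x = InP M x × (∀ y → InP M y → dot w y ℚ.≤ dot w x)

_≐_ : ∀ {n} → (Point n → Set) → (Point n → Set) → Set
_≐_ {n} P R = ∀ (x : Point n) → (P x → R x) × (R x → P x)

AffIndep : ∀ {n} k → (Fin k → Point n) → Set
AffIndep {n} k v = ∀ (c : Fin k → ℚ) → sumFin k c ≡ 0ℚ →
  (∀ j → sumFin k (λ i → c i ℚ.* v i j) ≡ 0ℚ) → ∀ i → c i ≡ 0ℚ

HasDim : ∀ {n} → RawMatroid n → ℕ → Set
HasDim {n} M d =
    (Σ (Fin (suc d) → Point n) λ v → (∀ i → InP M (v i)) × AffIndep (suc d) v)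
  × (∀ (v : Fin (suc (suc d)) → Point n) → (∀ i → InP M (v i)) →
       ¬ AffIndep (suc (suc d)) v)

InRelInt : ∀ {n} → RawMatroid n → Point n → Set
InRelInt {n} M x = InP M x × Σ ℚ λ ε → (0ℚ ℚ.< ε) ×
  (∀ y → InAff M y → (∀ j → ℚ.∣ y j ℚ.- x j ∣ ℚ.< ε) → InP M y)

-- 𝒫(N) ⊄ ∂𝒫(M), where ∂ = relative boundary = 𝒫 ∖ relint 𝒫
NotInBoundary : ∀ {n} → RawMatroid n → RawMatroid n → Set
NotInBoundary M N = ∃ λ x → InP N x × InRelInt M x

record IsSubdivision {n : ℕ} (M : RawMatroid n) (s : ℕ) (Ms : Fin s → RawMatroid n) : Set where
  field
    pieces-matroid : ∀ i → IsMatroid (Ms i)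
    pieces-ground  : ∀ i → ground (Ms i) ≡ ⊤
    distinct       : ∀ i j → i ≢ j → ¬ (InP (Ms i) ≐ InP (Ms j))
    cover          : InP M ≐ (λ x → ∃ λ i → InP (Ms i) x)
    faces-in       : ∀ i (w : Point n) → ∃ λ j → Face (Ms i) w ≐ InP (Ms j)
    intersections  : ∀ i j → i ≢ j →
        (∀ x → ¬ (InP (Ms i) x × InP (Ms j) x))
      ⊎ ((∃ λ w → (λ x → InP (Ms i) x × InP (Ms j) x) ≐ Face (Ms i) w)
          × (∃ λ w → (λ x → InP (Ms i) x × InP (Ms j) x) ≐ Face (Ms j) w))

preimage : ∀ {n} → (Fin n → Fin n) → Subset n → Subset n
preimage σ X = tabulate (λ i → lookup X (σ i))

IsIso : ∀ {n} → RawMatroid n → RawMatroid n → (Fin n → Fin n) → Set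
IsIso {n} M N σ = (Σ (Fin n → Fin n) λ τ → (∀ i → σ (τ i) ≡ i) × (∀ i → τ (σ i) ≡ i))
  × (∀ X → rk N X ≡ rk M (preimage σ X))

{-# OPTIONS --safe #-}
-- The relative interior of P(M) is the disjoint union of the relative interiors of
-- the interior cells of a subdivision, and the Euler characteristic with compact
-- support is additive on relatively open polytopes, with value (-1)^dim. Comparing
-- it on the sections f = t and f = t - ε of this partition shows that the indicator
-- of "the maximum of f on P equals t" is a valuation for every linear functional f.
-- A functional f that weights the members of a chain of subsets by powers of n + 1
-- has as its maximum an encoding of their ranks, so every function of the ranks of
-- the members of a chain is valuative. By Whitney's formula for the Möbius function
-- the recursions defining Q and Y become sums over pairs of subsets F ⊆ K of E
-- whose terms depend on ranks only; iterating them expresses Y by functions of the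
-- ranks along chains. Loops do no harm, as interior cells have the same loops as M.
-- Since Y depends on ranks only, relabelling the ground set does not change it.
module Submission where

-- Flats vary from cell to cell, so the definitions of Q and Y do not sum over a common index set; M
-- and its cells become comparable only once every sum runs over all subsets with weights read off
-- from ranks. Unfolding must then keep the sets of each term in one chain: the greedy algorithm
-- yields a basis attaining the ranks of all members of a chain at once, whereas already the two
-- singletons of U(1,2) admit no such basis. No topology enters. A relatively open polytope is given
-- by strictly positive combinations of a list of generators, a hyperplane section is again given by
-- such a list, and the sign of the rank stands in for the Euler characteristic. Additivity and the
-- statement on maxima are proved together: the jump of the slices of f at t relates the items with
-- maximum t, and summing over t is additivity. A slice has one functional less to be separated by,
-- so the induction ends at a single point. Only maxima produce jumps: a nonconstant f on a
-- relatively open polytope has empty fibres over and below its minimum, but nonempty ones just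
-- below its maximum.

-- Linear functionals, cones and spans over the rationals.

module Lin where

  open import Defs using (Point)
  open import Data.Nat using (ℕ)
  open import Data.Fin using (Fin)
  open import Data.Rational
  open import Data.Rational.Properties
  open import Data.Rational.Solver
  open +-*-Solver
  open import Data.List using (List; []; _∷_; _++_)
  open import Data.List.Membership.Propositional using (_∈_)
  open import Data.List.Relation.Unary.Any using (here; there)
  open import Data.List.Relation.Unary.All as All using (All; []; _∷_)
  open import Data.Product using (Σ; ∃; _×_; _,_)
  open import Data.Unit using (⊤; tt)
  open import Relation.Binary.PropositionalEquality

  0<* : ∀ {a b} → 0ℚ < a → 0ℚ < b → 0ℚ < a * b
  0<* {a} {b} p q = positive⁻¹ (a * b) {{pos*pos⇒pos a {{positive p}} b {{positive q}}}}

  0≤* : ∀ {a b} → 0ℚ ≤ a → 0ℚ ≤ b → 0ℚ ≤ a * b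
  0≤* {a} {b} p q = nonNegative⁻¹ (a * b) {{nonNeg*nonNeg⇒nonNeg a {{nonNegative p}} b {{nonNegative q}}}}

  0<+ : ∀ {a b} → 0ℚ < a → 0ℚ < b → 0ℚ < a + b
  0<+ p q = +-mono-< p q

  0≤+ : ∀ {a b} → 0ℚ ≤ a → 0ℚ ≤ b → 0ℚ ≤ a + b
  0≤+ p q = +-mono-≤ p q

  0<+≤ : ∀ {a b} → 0ℚ < a → 0ℚ ≤ b → 0ℚ < a + b
  0<+≤ p q = +-mono-<-≤ p q

  neg-0< : ∀ {a} → a < 0ℚ → 0ℚ < - a
  neg-0< p = neg-antimono-< p

  neg-0≤ : ∀ {a} → a ≤ 0ℚ → 0ℚ ≤ - a
  neg-0≤ p = neg-antimono-≤ p

  neg-≤0 : ∀ {a} → 0ℚ ≤ a → - a ≤ 0ℚ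
  neg-≤0 p = neg-antimono-≤ p

  0<1 : 0ℚ < 1ℚ
  0<1 = positive⁻¹ 1ℚ

  0≤1 : 0ℚ ≤ 1ℚ
  0≤1 = <⇒≤ 0<1

  <⇒0< : ∀ {a b} → a < b → 0ℚ < b - a
  <⇒0< {a} {b} p = subst (_< b - a) (+-inverseʳ a) (+-monoˡ-< (- a) p)

  0<⇒< : ∀ {a b} → 0ℚ < b - a → a < b
  0<⇒< {a} {b} p = subst₂ _<_ (+-identityˡ a)
    (solve 2 (λ a b → b :- a :+ a := b) refl a b) (+-monoˡ-< a p)

  ≤⇒0≤ : ∀ {a b} → a ≤ b → 0ℚ ≤ b - a
  ≤⇒0≤ {a} {b} p = subst (_≤ b - a) (+-inverseʳ a) (+-monoˡ-≤ (- a) p)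

  0≤⇒≤ : ∀ {a b} → 0ℚ ≤ b - a → a ≤ b
  0≤⇒≤ {a} {b} p = subst₂ _≤_ (+-identityˡ a)
    (solve 2 (λ a b → b :- a :+ a := b) refl a b) (+-monoˡ-≤ a p)

  inverse : ∀ {a} → 0ℚ < a → Σ ℚ λ i → 0ℚ < i × i * a ≡ 1ℚ
  inverse {a} p = (1/ a) , positive⁻¹ (1/ a) {{1/pos⇒pos a}} , *-inverseˡ a
    where
    instance
      _ = positive p
      _ = pos⇒nonZero a {{positive p}}

  *-cancelˡ-0< : ∀ {a b} → 0ℚ < a → 0ℚ < a * b → 0ℚ < b
  *-cancelˡ-0< {a} {b} p q with inverse p
  ... | i , i>0 , e = subst (0ℚ <_) h (0<* i>0 q)
    where
    h : i * (a * b) ≡ b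
    h = trans (sym (*-assoc i a b)) (trans (cong (_* b) e) (*-identityˡ b))

  *-cancelˡ-0≤ : ∀ {a b} → 0ℚ < a → 0ℚ ≤ a * b → 0ℚ ≤ b
  *-cancelˡ-0≤ {a} {b} p q with inverse p
  ... | i , i>0 , e = subst (0ℚ ≤_) h (0≤* (<⇒≤ i>0) q)
    where
    h : i * (a * b) ≡ b
    h = trans (sym (*-assoc i a b)) (trans (cong (_* b) e) (*-identityˡ b))

  *-cancelˡ-0≡ : ∀ {a b} → 0ℚ < a → a * b ≡ 0ℚ → b ≡ 0ℚ
  *-cancelˡ-0≡ {a} {b} p q with inverse p
  ... | i , i>0 , e = trans (sym h) (trans (cong (i *_) q) (*-zeroʳ i))
    where
    h : i * (a * b) ≡ b
    h = trans (sym (*-assoc i a b)) (trans (cong (_* b) e) (*-identityˡ b))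

  -- Linearity is stated through the single relation x = c v + y in which all
  -- linear combinations below are built up.
  record Func (n : ℕ) : Set where
    field
      app : Point n → ℚ
      lin : ∀ {x v y} c → (∀ j → x j ≡ c * v j + y j) → app x ≡ c * app v + app y
  open Func public

  app-0 : ∀ {n} (f : Func n) {x} → (∀ j → x j ≡ 0ℚ) → app f x ≡ 0ℚ
  app-0 f {x} e = begin
    app f x ≡⟨ solve 1 (λ a → a := (con 1ℚ :* a :+ a) :- a) refl (app f x) ⟩
    1ℚ * app f x + app f x - app f x ≡⟨ cong (_- app f x) (sym (lin f {x} {x} {x} 1ℚ h)) ⟩
    app f x - app f x ≡⟨ +-inverseʳ (app f x) ⟩
    0ℚ ∎
    where
    open ≡-Reasoning
    h : ∀ j → x j ≡ 1ℚ * x j + x j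
    h j rewrite e j = refl

  app-lin₂ : ∀ {n} (f : Func n) {x u v} a b → (∀ j → x j ≡ a * u j + b * v j) →
    app f x ≡ a * app f u + b * app f v
  app-lin₂ f {x} {u} {v} a b e = trans (lin f a e)
    (cong (a * app f u +_) (trans (lin f {y = λ _ → 0ℚ} b (λ j → sym (+-identityʳ (b * v j))))
      (trans (cong (b * app f v +_) (app-0 f (λ _ → refl))) (+-identityʳ _))))

  ev : ∀ {n} → Fin n → Func n
  ev j = record { app = λ x → x j ; lin = λ c e → e j }

  comb₂ : ∀ {n} → ℚ → Func n → ℚ → Func n → Func n
  comb₂ a f b g = record
    { app = λ x → a * app f x + b * app g x
    ; lin = λ {x} {v} {y} c e → trans (cong₂ (λ p q → a * p + b * q) (lin f c e) (lin g c e))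
        (solve 7 (λ a b c fv fy gv gy → a :* (c :* fv :+ fy) :+ b :* (c :* gv :+ gy)
          := c :* (a :* fv :+ b :* gv) :+ (a :* fy :+ b :* gy)) refl
          a b c (app f v) (app f y) (app g v) (app g y)) }

  negF : ∀ {n} → Func n → Func n
  negF f = record
    { app = λ x → - app f x
    ; lin = λ {x} {v} {y} c e → trans (cong -_ (lin f c e))
        (solve 3 (λ c a b → :- (c :* a :+ b) := c :* (:- a) :+ :- b) refl c (app f v) (app f y)) }

  -- One type with a condition `R` on the coefficients serves open cones, closed cones and spans
  -- alike. Every listed vector receives exactly one coefficient, so `Pos vs` demands that each
  -- generator really occurs, which is what makes it a relative interior. Equations between points
  -- are coordinatewise because points are functions.
  data Comb {n} (R : ℚ → Set) : List (Point n) → Point n → Set where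
    nil  : ∀ {x} → (∀ j → x j ≡ 0ℚ) → Comb R [] x
    cons : ∀ {v vs x} c y → R c → Comb R vs y → (∀ j → x j ≡ c * v j + y j) → Comb R (v ∷ vs) x

  Pos NN Span : ∀ {n} → List (Point n) → Point n → Set
  Pos = Comb (0ℚ <_)
  NN = Comb (0ℚ ≤_)
  Span = Comb (λ _ → ⊤)

  comb-cong : ∀ {n R} {vs : List (Point n)} {x x'} → (∀ j → x' j ≡ x j) → Comb R vs x → Comb R vs x'
  comb-cong e (nil z) = nil λ j → trans (e j) (z j)
  comb-cong e (cons c y r p h) = cons c y r p λ j → trans (e j) (h j)

  comb-map : ∀ {n} {R S : ℚ → Set} {vs : List (Point n)} {x} → (∀ c → R c → S c) → Comb R vs x → Comb S vs x
  comb-map f (nil z) = nil z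
  comb-map f (cons c y r p h) = cons c y (f c r) (comb-map f p) h

  comb-lin : ∀ {n} {R S T : ℚ → Set} {vs : List (Point n)} {x y z} a b →
    (∀ c d → R c → S d → T (a * c + b * d)) → Comb R vs x → Comb S vs y →
    (∀ j → z j ≡ a * x j + b * y j) → Comb T vs z
  comb-lin {x = x} {y} {z} a b f (nil e) (nil e') h = nil g
    where
    g : ∀ j → z j ≡ 0ℚ
    g j rewrite h j | e j | e' j = solve 2 (λ a b → a :* con 0ℚ :+ b :* con 0ℚ := con 0ℚ) refl a b
  comb-lin {x = x} {y} {z} a b f (cons {v = v} c x' r p e) (cons d y' s q e') h =
    cons (a * c + b * d) (λ j → a * x' j + b * y' j) (f c d r s)
      (comb-lin a b f p q λ _ → refl) g
    where
    g : ∀ j → z j ≡ (a * c + b * d) * v j + (a * x' j + b * y' j)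
    g j rewrite h j | e j | e' j = solve 7 (λ a b c d v x y → a :* (c :* v :+ x) :+ b :* (d :* v :+ y)
      := (a :* c :+ b :* d) :* v :+ (a :* x :+ b :* y)) refl a b c d (v j) (x' j) (y' j)

  pos-+ : ∀ {n} {vs : List (Point n)} {x y z} → Pos vs x → Pos vs y → (∀ j → z j ≡ x j + y j) → Pos vs z
  pos-+ {x = x} {y} p q e = comb-lin 1ℚ 1ℚ
    (λ c d r s → subst (0ℚ <_) (solve 2 (λ c d → c :+ d := con 1ℚ :* c :+ con 1ℚ :* d) refl c d) (0<+ r s)) p q
    λ j → trans (e j) (solve 2 (λ c d → c :+ d := con 1ℚ :* c :+ con 1ℚ :* d) refl (x j) (y j))

  pos-+-nn : ∀ {n} {vs : List (Point n)} {x y z} → Pos vs x → NN vs y → (∀ j → z j ≡ x j + y j) → Pos vs z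
  pos-+-nn {x = x} {y} p q e = comb-lin 1ℚ 1ℚ
    (λ c d r s → subst (0ℚ <_) (solve 2 (λ c d → c :+ d := con 1ℚ :* c :+ con 1ℚ :* d) refl c d) (0<+≤ r s)) p q
    λ j → trans (e j) (solve 2 (λ c d → c :+ d := con 1ℚ :* c :+ con 1ℚ :* d) refl (x j) (y j))

  span-lin : ∀ {n R S} {vs : List (Point n)} {x y z} a b → Comb R vs x → Comb S vs y →
    (∀ j → z j ≡ a * x j + b * y j) → Span vs z
  span-lin a b = comb-lin a b (λ _ _ _ _ → tt)

  comb-scale : ∀ {n} {R : ℚ → Set} {vs : List (Point n)} {x z} a → (∀ c → R c → R (a * c)) → Comb R vs x →
    (∀ j → z j ≡ a * x j) → Comb R vs z
  comb-scale {R = R} {x = x} a f p e = comb-lin a 0ℚ (λ c d r _ → subst R (h a c d) (f c r)) p p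
    λ j → trans (e j) (h a (x j) (x j))
    where
    h : ∀ a c d → a * c ≡ a * c + 0ℚ * d
    h = solve 3 (λ a c d → a :* c := a :* c :+ con 0ℚ :* d) refl

  pos-scale : ∀ {n} {vs : List (Point n)} {x z} a → 0ℚ < a → Pos vs x → (∀ j → z j ≡ a * x j) → Pos vs z
  pos-scale a p = comb-scale a (λ c r → 0<* p r)

  nn-scale : ∀ {n} {vs : List (Point n)} {x z} a → 0ℚ ≤ a → NN vs x → (∀ j → z j ≡ a * x j) → NN vs z
  nn-scale a p = comb-scale a (λ c r → 0≤* p r)

  pos⇒nn : ∀ {n} {vs : List (Point n)} {x} → Pos vs x → NN vs x
  pos⇒nn = comb-map λ _ → <⇒≤

  comb⇒span : ∀ {n R} {vs : List (Point n)} {x} → Comb R vs x → Span vs x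
  comb⇒span = comb-map λ _ _ → tt

  comb-0 : ∀ {n} {R : ℚ → Set} (vs : List (Point n)) {x} → R 0ℚ → (∀ j → x j ≡ 0ℚ) → Comb R vs x
  comb-0 [] r e = nil e
  comb-0 (v ∷ vs) {x} r e = cons 0ℚ x r (comb-0 vs r e) λ j → solve 2 (λ x v → x := con 0ℚ :* v :+ x) refl (x j) (v j)

  comb-∈ : ∀ {n} {R : ℚ → Set} {vs : List (Point n)} {v} → R 0ℚ → R 1ℚ → v ∈ vs → Comb R vs v
  comb-∈ {vs = v ∷ vs} r s (here refl) = cons 1ℚ (λ _ → 0ℚ) s (comb-0 vs r λ _ → refl)
    λ j → solve 1 (λ v → v := con 1ℚ :* v :+ con 0ℚ) refl (v j)
  comb-∈ {vs = u ∷ vs} {v} r s (there m) = cons 0ℚ v r (comb-∈ r s m)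
    λ j → solve 2 (λ u v → v := con 0ℚ :* u :+ v) refl (u j) (v j)

  nn-∈ : ∀ {n} {vs : List (Point n)} {v} → v ∈ vs → NN vs v
  nn-∈ = comb-∈ ≤-refl 0≤1

  span-∈ : ∀ {n} {vs : List (Point n)} {v} → v ∈ vs → Span vs v
  span-∈ = comb-∈ tt tt

  -- The plain sum of the generators, used as a base point wherever an open cone has to be
  -- inhabited.
  pos-total : ∀ {n} (vs : List (Point n)) → ∃ (Pos vs)
  pos-total [] = (λ _ → 0ℚ) , nil λ _ → refl
  pos-total (v ∷ vs) with pos-total vs
  ... | y , p = _ , cons 1ℚ y 0<1 p λ _ → refl

  -- Subspaces, cones, kernels and half-spaces all satisfy this for a suitable `R`; `comb-closed`
  -- then carries a property from generators to their combinations.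
  record Closed {n} (R : ℚ → Set) (D : Point n → Set) : Set where
    field
      at-0 : ∀ {x} → (∀ j → x j ≡ 0ℚ) → D x
      step : ∀ {x v y} c → R c → D v → D y → (∀ j → x j ≡ c * v j + y j) → D x
  open Closed public

  comb-closed : ∀ {n R} {D : Point n → Set} {vs x} → Closed R D → All D vs → Comb R vs x → D x
  comb-closed C [] (nil e) = at-0 C e
  comb-closed C (d ∷ ds) (cons c y r p e) = step C c r d (comb-closed C ds p) e

  span-closed : ∀ {n R} {vs : List (Point n)} → Closed R (Span vs)
  span-closed {vs = vs} = record
    { at-0 = comb-0 vs tt
    ; step = λ {x} {v} {y} c _ p q e → span-lin c 1ℚ p q λ j → trans (e j) (cong (c * v j +_) (sym (*-identityˡ (y j)))) }

  nn-closed : ∀ {n} {vs : List (Point n)} → Closed (0ℚ ≤_) (NN vs)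
  nn-closed {vs = vs} = record
    { at-0 = comb-0 vs ≤-refl
    ; step = λ {x} {v} {y} c r p q e → comb-lin c 1ℚ (λ a b s t → 0≤+ (0≤* r s) (0≤* 0≤1 t)) p q
        λ j → trans (e j) (cong (c * v j +_) (sym (*-identityˡ (y j)))) }

  ker-closed : ∀ {n R} (f : Func n) → Closed R (λ x → app f x ≡ 0ℚ)
  ker-closed f = record
    { at-0 = app-0 f
    ; step = λ c _ p q e → trans (lin f c e) (trans (cong₂ (λ a b → c * a + b) p q)
        (solve 1 (λ c → c :* con 0ℚ :+ con 0ℚ := con 0ℚ) refl c)) }

  half-closed : ∀ {n} (f : Func n) → Closed (0ℚ ≤_) (λ x → 0ℚ ≤ app f x)
  half-closed f = record
    { at-0 = λ e → ≤-reflexive (sym (app-0 f e))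
    ; step = λ c r p q e → subst (0ℚ ≤_) (sym (lin f c e)) (0≤+ (0≤* r p) q) }

  -- The marked generator enters with a positive coefficient and all other terms are nonnegative.
  -- Hence a functional that is nonnegative on the generators can vanish at a point of the open cone
  -- only by vanishing on every generator.
  pos-strict : ∀ {n} (f : Func n) {vs v x} → All (λ u → 0ℚ ≤ app f u) vs → v ∈ vs → 0ℚ < app f v →
    Pos vs x → 0ℚ < app f x
  pos-strict f (_ ∷ a) (here refl) h (cons c y r p e) = subst (0ℚ <_) (sym (lin f c e))
    (0<+≤ (0<* r h) (comb-closed (half-closed f) a (pos⇒nn p)))
  pos-strict f {v ∷ vs} {x = x} (b ∷ a) (there m) h (cons c y r p e) = subst (0ℚ <_)
    (trans (+-comm (app f y) (c * app f v)) (sym (lin f c e)))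
    (0<+≤ (pos-strict f a m h p) (0≤* (<⇒≤ r) b))

  comb-++ : ∀ {n R} {us vs : List (Point n)} {x y z} → Comb R us x → Comb R vs y →
    (∀ j → z j ≡ x j + y j) → Comb R (us ++ vs) z
  comb-++ {x = x} {y} {z} (nil e) q h = comb-cong g q
    where
    g : ∀ j → z j ≡ y j
    g j rewrite h j | e j = +-identityˡ (y j)
  comb-++ {x = x} {y} {z} (cons {v = v} c x' r p e) q h = cons c (λ j → x' j + y j) r (comb-++ p q λ _ → refl) g
    where
    g : ∀ j → z j ≡ c * v j + (x' j + y j)
    g j rewrite h j | e j = +-assoc (c * v j) (x' j) (y j)

  comb-split : ∀ {n R} (us {vs} : List (Point n)) {z} → Comb R (us ++ vs) z →
    Σ (Point n) λ x → Σ (Point n) λ y → Comb R us x × Comb R vs y × (∀ j → z j ≡ x j + y j)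
  comb-split [] {z = z} p = (λ _ → 0ℚ) , z , nil (λ _ → refl) , p , λ j → sym (+-identityˡ (z j))
  comb-split (u ∷ us) {z = z} (cons c w r p e) with comb-split us p
  ... | x , y , px , py , h = (λ j → c * u j + x j) , y , cons c x r px (λ _ → refl) , py , g
    where
    g : ∀ j → z j ≡ c * u j + x j + y j
    g j rewrite e j | h j = sym (+-assoc (c * u j) (x j) (y j))

-- Cutting an open cone by a hyperplane, in the manner of Fourier and Motzkin.

module Cut where

  open import Defs using (Point)
  open Lin
  open import Data.Rational
  open import Data.Rational.Properties
  open import Data.Rational.Solver
  open +-*-Solver
  open import Data.List using (List; []; _∷_; _++_; map)
  open import Data.List.Membership.Propositional using (_∈_)
  open import Data.List.Relation.Unary.Any using (here; there)
  open import Data.List.Membership.Propositional.Properties using (∈-++⁺ˡ; ∈-++⁺ʳ; ∈-map⁺)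
  open import Data.List.Relation.Unary.All as All using (All; []; _∷_)
  open import Data.List.Relation.Unary.All.Properties using (++⁺; map⁺)
  open import Data.Product using (Σ; ∃; _×_; _,_; proj₁; proj₂)
  open import Data.Sum using (_⊎_; inj₁; inj₂)
  open import Relation.Binary using (tri<; tri≈; tri>)
  open import Relation.Binary.PropositionalEquality

  -- A relation between the list and its three parts, so that the coefficients of a combination can
  -- be split and merged again in the original order by `trip-to` and `trip-from`.
  data Trip {n} (f : Func n) : (vs N Z P : List (Point n)) → Set where
    []  : Trip f [] [] [] []
    neg∷ : ∀ {v vs N Z P} → app f v < 0ℚ → Trip f vs N Z P → Trip f (v ∷ vs) (v ∷ N) Z P
    zer∷ : ∀ {v vs N Z P} → app f v ≡ 0ℚ → Trip f vs N Z P → Trip f (v ∷ vs) N (v ∷ Z) P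
    pos∷ : ∀ {v vs N Z P} → 0ℚ < app f v → Trip f vs N Z P → Trip f (v ∷ vs) N Z (v ∷ P)

  trip : ∀ {n} (f : Func n) vs → ∃ λ N → ∃ λ Z → ∃ λ P → Trip f vs N Z P
  trip f [] = _ , _ , _ , []
  trip f (v ∷ vs) with <-cmp (app f v) 0ℚ | trip f vs
  ... | tri< a _ _ | _ , _ , _ , t = _ , _ , _ , neg∷ a t
  ... | tri≈ _ b _ | _ , _ , _ , t = _ , _ , _ , zer∷ b t
  ... | tri> _ _ c | _ , _ , _ , t = _ , _ , _ , pos∷ c t

  trip-neg : ∀ {n} {f : Func n} {vs N Z P} → Trip f vs N Z P → All (λ v → app f v < 0ℚ) N
  trip-neg [] = []
  trip-neg (neg∷ x t) = x ∷ trip-neg t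
  trip-neg (zer∷ x t) = trip-neg t
  trip-neg (pos∷ x t) = trip-neg t

  trip-zer : ∀ {n} {f : Func n} {vs N Z P} → Trip f vs N Z P → All (λ v → app f v ≡ 0ℚ) Z
  trip-zer [] = []
  trip-zer (neg∷ x t) = trip-zer t
  trip-zer (zer∷ x t) = x ∷ trip-zer t
  trip-zer (pos∷ x t) = trip-zer t

  trip-pos : ∀ {n} {f : Func n} {vs N Z P} → Trip f vs N Z P → All (λ v → 0ℚ < app f v) P
  trip-pos [] = []
  trip-pos (neg∷ x t) = trip-pos t
  trip-pos (zer∷ x t) = trip-pos t
  trip-pos (pos∷ x t) = x ∷ trip-pos t

  trip-All : ∀ {n} {f : Func n} {vs N Z P} {D : Point n → Set} → Trip f vs N Z P → All D N → All D Z → All D P → All D vs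
  trip-All [] _ _ _ = []
  trip-All (neg∷ x t) (d ∷ a) b c = d ∷ trip-All t a b c
  trip-All (zer∷ x t) a (d ∷ b) c = d ∷ trip-All t a b c
  trip-All (pos∷ x t) a b (d ∷ c) = d ∷ trip-All t a b c

  trip-All⁻ : ∀ {n} {f : Func n} {vs N Z P} {D : Point n → Set} → Trip f vs N Z P → All D vs → All D N × All D Z × All D P
  trip-All⁻ [] [] = [] , [] , []
  trip-All⁻ (neg∷ x t) (d ∷ ds) with trip-All⁻ t ds
  ... | a , b , c = d ∷ a , b , c
  trip-All⁻ (zer∷ x t) (d ∷ ds) with trip-All⁻ t ds
  ... | a , b , c = a , d ∷ b , c
  trip-All⁻ (pos∷ x t) (d ∷ ds) with trip-All⁻ t ds
  ... | a , b , c = a , b , d ∷ c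

  trip-∈N : ∀ {n} {f : Func n} {vs N Z P v} → Trip f vs N Z P → v ∈ N → v ∈ vs
  trip-∈N t = All.lookup (proj₁ (trip-All⁻ t (All.tabulate λ m → m)))

  trip-∈Z : ∀ {n} {f : Func n} {vs N Z P v} → Trip f vs N Z P → v ∈ Z → v ∈ vs
  trip-∈Z t = All.lookup (proj₁ (proj₂ (trip-All⁻ t (All.tabulate λ m → m))))

  trip-∈P : ∀ {n} {f : Func n} {vs N Z P v} → Trip f vs N Z P → v ∈ P → v ∈ vs
  trip-∈P t = All.lookup (proj₂ (proj₂ (trip-All⁻ t (All.tabulate λ m → m))))

  trip-to : ∀ {n R} {f : Func n} {vs N Z P x} → Trip f vs N Z P → Comb R vs x →
    Σ (Point n) λ y → Σ (Point n) λ z → Σ (Point n) λ p →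
    Comb R N y × Comb R Z z × Comb R P p × (∀ j → x j ≡ (y j + p j) + z j)
  trip-to [] (nil e) = (λ _ → 0ℚ) , (λ _ → 0ℚ) , (λ _ → 0ℚ) , nil (λ _ → refl) , nil (λ _ → refl) , nil (λ _ → refl) , e
  trip-to {x = x} (neg∷ {v} _ t) (cons c w r q e) with trip-to t q
  ... | y , z , p , qy , qz , qp , h = _ , z , p , cons c y r qy (λ _ → refl) , qz , qp , g
    where
    g : ∀ j → x j ≡ ((c * v j + y j) + p j) + z j
    g j rewrite e j | h j = solve 4 (λ a b c d → a :+ (b :+ c :+ d) := (a :+ b :+ c) :+ d) refl (c * v j) (y j) (p j) (z j)
  trip-to {x = x} (zer∷ {v} _ t) (cons c w r q e) with trip-to t q
  ... | y , z , p , qy , qz , qp , h = y , _ , p , qy , cons c z r qz (λ _ → refl) , qp , g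
    where
    g : ∀ j → x j ≡ (y j + p j) + (c * v j + z j)
    g j rewrite e j | h j = solve 4 (λ a b c d → a :+ (b :+ c :+ d) := b :+ c :+ (a :+ d)) refl (c * v j) (y j) (p j) (z j)
  trip-to {x = x} (pos∷ {v} _ t) (cons c w r q e) with trip-to t q
  ... | y , z , p , qy , qz , qp , h = y , z , _ , qy , qz , cons c p r qp (λ _ → refl) , g
    where
    g : ∀ j → x j ≡ (y j + (c * v j + p j)) + z j
    g j rewrite e j | h j = solve 4 (λ a b c d → a :+ (b :+ c :+ d) := (b :+ (a :+ c)) :+ d) refl (c * v j) (y j) (p j) (z j)

  trip-from : ∀ {n R} {f : Func n} {vs N Z P y z p x} → Trip f vs N Z P →
    Comb R N y → Comb R Z z → Comb R P p → (∀ j → x j ≡ (y j + p j) + z j) → Comb R vs x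
  trip-from {y = y} {z} {p} {x} [] (nil a) (nil b) (nil c) e = nil g
    where
    g : ∀ j → x j ≡ 0ℚ
    g j rewrite e j | a j | b j | c j = refl
  trip-from {y = y} {z} {p} {x} (neg∷ {v} _ t) (cons c y' r qy h) qz qp e = cons c _ r (trip-from t qy qz qp λ _ → refl) g
    where
    g : ∀ j → x j ≡ c * v j + (y' j + p j + z j)
    g j rewrite e j | h j = solve 4 (λ a b c d → (a :+ b :+ c) :+ d := a :+ (b :+ c :+ d)) refl (c * v j) (y' j) (p j) (z j)
  trip-from {y = y} {z} {p} {x} (zer∷ {v} _ t) qy (cons c z' r qz h) qp e = cons c _ r (trip-from t qy qz qp λ _ → refl) g
    where
    g : ∀ j → x j ≡ c * v j + (y j + p j + z' j)
    g j rewrite e j | h j = solve 4 (λ a b c d → b :+ c :+ (a :+ d) := a :+ (b :+ c :+ d)) refl (c * v j) (y j) (p j) (z' j)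
  trip-from {y = y} {z} {p} {x} (pos∷ {v} _ t) qy qz (cons c p' r qp h) e = cons c _ r (trip-from t qy qz qp λ _ → refl) g
    where
    g : ∀ j → x j ≡ c * v j + (y j + p' j + z j)
    g j rewrite e j | h j = solve 4 (λ a b c d → (b :+ (a :+ c)) :+ d := a :+ (b :+ c :+ d)) refl (c * v j) (y j) (p' j) (z j)

  -- The point where the segment from u to v meets the hyperplane, up to a positive factor: both
  -- coefficients are positive when f u < 0 < f v. Only the ray matters, so no division occurs.
  crossing : ∀ {n} → Func n → Point n → Point n → Point n
  crossing f u v j = app f v * u j + (- app f u) * v j

  app-crossing : ∀ {n} (f : Func n) u v (g : Func n) → app g (crossing f u v) ≡ app f v * app g u + (- app f u) * app g v
  app-crossing f u v g = app-lin₂ g (app f v) (- app f u) (λ _ → refl)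

  cross₁ : ∀ {n} → Func n → Point n → List (Point n) → List (Point n)
  cross₁ f u P = map (crossing f u) P

  cross : ∀ {n} → Func n → List (Point n) → List (Point n) → List (Point n)
  cross f [] P = []
  cross f (u ∷ N) P = cross₁ f u P ++ cross f N P

  cross-∈ : ∀ {n} (f : Func n) {N P u v} → u ∈ N → v ∈ P → crossing f u v ∈ cross f N P
  cross-∈ f (here refl) m = ∈-++⁺ˡ (∈-map⁺ (crossing f _) m)
  cross-∈ f {u ∷ N} {P} (there k) m = ∈-++⁺ʳ (cross₁ f u P) (cross-∈ f k m)

  cross-All : ∀ {n} (f : Func n) N P {D : Point n → Set} → (∀ {u v} → u ∈ N → v ∈ P → D (crossing f u v)) → All D (cross f N P)
  cross-All f [] P h = []
  cross-All f (u ∷ N) P h = ++⁺ (map⁺ (All.tabulate (h (here refl)))) (cross-All f N P λ k m → h (there k) m)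

  cross₁-scalar : ∀ a b → a * b + 0ℚ ≡ 0ℚ → (- b) * a ≡ 0ℚ
  cross₁-scalar a b s = trans (solve 2 (λ a b → (:- b) :* a := :- (a :* b :+ con 0ℚ)) refl a b) (cong -_ s)

  cross₁-balance : ∀ a c i fv fu fp → i * (- fu) ≡ 1ℚ → a * fu + (c * fv + fp) ≡ 0ℚ → (a - c * i * fv) * fu + fp ≡ 0ℚ
  cross₁-balance a c i fv fu fp ie s = begin
    (a - c * i * fv) * fu + fp
      ≡⟨ solve 6 (λ a c i fv fu fp → (a :- c :* i :* fv) :* fu :+ fp :=
           (a :* fu :+ (c :* fv :+ fp)) :+ (c :* fv) :* (i :* (:- fu) :- con 1ℚ)) refl a c i fv fu fp ⟩
    (a * fu + (c * fv + fp)) + (c * fv) * (i * (- fu) - 1ℚ)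
      ≡⟨ cong₂ (λ k l → k + c * fv * (l - 1ℚ)) s ie ⟩
    0ℚ + c * fv * (1ℚ - 1ℚ)
      ≡⟨ solve 1 (λ t → con 0ℚ :+ t :* (con 1ℚ :- con 1ℚ) := con 0ℚ) refl (c * fv) ⟩
    0ℚ ∎
    where open ≡-Reasoning

  cross₁-coords : ∀ a c i fv fu u v p → i * (- fu) ≡ 1ℚ →
    a * u + (c * v + p) ≡ c * i * (fv * u + (- fu) * v) + ((a - c * i * fv) * u + p)
  cross₁-coords a c i fv fu u v p ie = begin
    a * u + (c * v + p)
      ≡⟨ solve 5 (λ a u c v p → a :* u :+ (c :* v :+ p) := a :* u :+ (c :* con 1ℚ :* v :+ p)) refl a u c v p ⟩
    a * u + (c * 1ℚ * v + p)
      ≡⟨ cong (λ l → a * u + (c * l * v + p)) (sym ie) ⟩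
    a * u + (c * (i * (- fu)) * v + p)
      ≡⟨ solve 8 (λ a c i fv fu u v p → a :* u :+ (c :* (i :* (:- fu)) :* v :+ p) :=
           c :* i :* (fv :* u :+ (:- fu) :* v) :+ ((a :- c :* i :* fv) :* u :+ p)) refl a c i fv fu u v p ⟩
    c * i * (fv * u + (- fu) * v) + ((a - c * i * fv) * u + p) ∎
    where open ≡-Reasoning

  -- Induction on `P`: the term c v is traded for c / (- f u) times its crossing with u, at the cost
  -- of changing the coefficient a of u. So a carries no sign condition; the balance equation is the
  -- invariant, and it forces a = 0 once `P` is used up.
  cross₁-to : ∀ {n} (f : Func n) {u P a p x} → app f u < 0ℚ → Pos P p → (∀ j → x j ≡ a * u j + p j) →
    a * app f u + app f p ≡ 0ℚ → Pos (cross₁ f u P) x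
  cross₁-to f {u} {a = a} {p} {x} fu (nil e) h s = nil g
    where
    a≡0 : a ≡ 0ℚ
    a≡0 = *-cancelˡ-0≡ (neg-0< fu) (cross₁-scalar a (app f u) (trans (cong (a * app f u +_) (sym (app-0 f e))) s))
    g : ∀ j → x j ≡ 0ℚ
    g j = trans (h j) (trans (cong₂ (λ b q → b * u j + q) a≡0 (e j)) (trans (+-identityʳ _) (*-zeroˡ (u j))))
  cross₁-to f {u} {a = a} {p} {x} fu (cons {v = v} c p' r q e) h s with inverse (neg-0< fu)
  ... | i , i>0 , ie = cons (c * i) (λ j → (a - c * i * app f v) * u j + p' j) (0<* r i>0)
      (cross₁-to f {a = a - c * i * app f v} {p = p'} fu q (λ _ → refl) s') g
    where
    s' : (a - c * i * app f v) * app f u + app f p' ≡ 0ℚ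
    s' = cross₁-balance a c i (app f v) (app f u) (app f p') ie (trans (cong (a * app f u +_) (sym (lin f c e))) s)
    g : ∀ j → x j ≡ c * i * crossing f u v j + ((a - c * i * app f v) * u j + p' j)
    g j = trans (h j) (trans (cong (a * u j +_) (e j)) (cross₁-coords a c i (app f v) (app f u) (u j) (v j) (p' j) ie))

  -- u collects a positive amount from each crossing, so its coefficient is positive unless there
  -- are none; the disjunction records this single exception.
  cross₁-from : ∀ {n} (f : Func n) {u P x} → app f u < 0ℚ → All (λ v → 0ℚ < app f v) P → Pos (cross₁ f u P) x →
    Σ ℚ λ a → Σ (Point n) λ p → 0ℚ ≤ a × (P ≡ [] ⊎ 0ℚ < a) × Pos P p × (∀ j → x j ≡ a * u j + p j)
  cross₁-from f {u} {[]} {x} fu [] (nil e) = 0ℚ , (λ _ → 0ℚ) , ≤-refl , inj₁ refl , nil (λ _ → refl) ,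
    λ j → trans (e j) (solve 1 (λ u → con 0ℚ := con 0ℚ :* u :+ con 0ℚ) refl (u j))
  cross₁-from f {u} {v ∷ P} {x} fu (fv ∷ a) (cons c x' r q e) with cross₁-from f fu a q
  ... | a' , p' , a≥0 , _ , q' , h = c * app f v + a' , _ , <⇒≤ pp , inj₂ pp ,
      cons (c * (- app f u)) p' (0<* r (neg-0< fu)) q' (λ _ → refl) , g
    where
    pp = 0<+≤ (0<* r fv) a≥0
    g : ∀ j → x j ≡ (c * app f v + a') * u j + (c * (- app f u) * v j + p' j)
    g j rewrite e j | h j = solve 7 (λ c fv fu a u v p → c :* (fv :* u :+ (:- fu) :* v) :+ (a :* u :+ p)
       := (c :* fv :+ a) :* u :+ (c :* (:- fu) :* v :+ p)) refl c (app f v) (app f u) a' (u j) (v j) (p' j)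

  pos-app<0 : ∀ {n} (f : Func n) {u N y} → All (λ v → app f v < 0ℚ) (u ∷ N) → Pos (u ∷ N) y → app f y < 0ℚ
  pos-app<0 f {y = y} (a ∷ as) p = 0<⇒< (subst (0ℚ <_) (sym (+-identityˡ (- app f y)))
    (pos-strict (negF f) (All.map (λ q → <⇒≤ (neg-0< q)) (a ∷ as)) (here refl) (neg-0< a) p))

  cross-balance : ∀ y p c u y' → y + p ≡ 0ℚ → y ≡ c * u + y' → p ≡ c * (- u) + (- y')
  cross-balance y p c u y' s l = begin
    p ≡⟨ solve 2 (λ a b → b := (a :+ b) :- a) refl y p ⟩
    (y + p) - y ≡⟨ cong₂ _-_ s l ⟩
    0ℚ - (c * u + y') ≡⟨ solve 3 (λ c a b → con 0ℚ :- (c :* a :+ b) := c :* (:- a) :+ :- b) refl c u y' ⟩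
    c * (- u) + (- y') ∎
    where open ≡-Reasoning

  app-* : ∀ {n} (f : Func n) t (p : Point n) → app f (λ j → t * p j) ≡ t * app f p
  app-* f t p = trans (lin f {v = p} {y = λ _ → 0ℚ} t (λ j → sym (+-identityʳ (t * p j))))
    (trans (cong (t * app f p +_) (app-0 f λ _ → refl)) (+-identityʳ (t * app f p)))

  inv-cancel : ∀ i t f → i * f ≡ 1ℚ → i * t * f ≡ t
  inv-cancel i t f ie = trans (solve 3 (λ i t f → i :* t :* f := t :* (i :* f)) refl i t f) (trans (cong (t *_) ie) (*-identityʳ t))

  split-coords : ∀ i f a b p → i * f ≡ 1ℚ → f ≡ a + b → p ≡ i * a * p + i * b * p
  split-coords i f a b p ie e = begin
      p ≡⟨ sym (*-identityˡ p) ⟩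
      1ℚ * p ≡⟨ cong (_* p) (sym ie) ⟩
      i * f * p ≡⟨ cong (λ t → i * t * p) e ⟩
      i * (a + b) * p ≡⟨ solve 4 (λ i a b p → i :* (a :+ b) :* p := i :* a :* p :+ i :* b :* p) refl i a b p ⟩
      i * a * p + i * b * p ∎
      where open ≡-Reasoning

  -- The parts are a / (a + b) and b / (a + b) times p, so each keeps every generator of `P` with a
  -- positive coefficient.
  proportional-split : ∀ {n} (f : Func n) {P p} a b → 0ℚ < a → 0ℚ < b → app f p ≡ a + b → Pos P p →
    Σ (Point n) λ p₁ → Σ (Point n) λ p₂ → Pos P p₁ × Pos P p₂ × app f p₁ ≡ a × app f p₂ ≡ b × (∀ j → p j ≡ p₁ j + p₂ j)
  proportional-split f {P} {p} a b a>0 b>0 e q =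
    let i , i>0 , ie = inverse (subst (0ℚ <_) (sym e) (0<+ a>0 b>0)) in
      (λ j → i * a * p j) , (λ j → i * b * p j) ,
      pos-scale (i * a) (0<* i>0 a>0) q (λ _ → refl) , pos-scale (i * b) (0<* i>0 b>0) q (λ _ → refl) ,
      trans (app-* f (i * a) p) (inv-cancel i a (app f p) ie) , trans (app-* f (i * b) p) (inv-cancel i b (app f p) ie) ,
      λ j → split-coords i (app f p) a b (p j) ie e

  cross-base : ∀ {n} (f : Func n) {u P y p x} → app f u < 0ℚ → Pos (u ∷ []) y → Pos P p →
    app f y + app f p ≡ 0ℚ → (∀ j → x j ≡ y j + p j) → Pos (cross f (u ∷ []) P) x
  cross-base f {u} {P} {y} {p} {x} a (cons c y' r (nil z) e) q s h =
    comb-++ {x = x} {y = λ _ → 0ℚ} (cross₁-to f {a = c} {p = p} a q g s') (nil λ _ → refl) (λ j → sym (+-identityʳ (x j)))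
    where
    s' : c * app f u + app f p ≡ 0ℚ
    s' = trans (cong (_+ app f p) (trans (sym (+-identityʳ (c * app f u))) (sym (trans (lin f c e) (cong (c * app f u +_) (app-0 f z)))))) s
    g : ∀ j → x j ≡ c * u j + p j
    g j = trans (h j) (cong (_+ p j) (trans (e j) (trans (cong (c * u j +_) (z j)) (+-identityʳ (c * u j)))))

  cross-step : ∀ {n} (f : Func n) {u} {vs P : List (Point n)} {y y' p₁ p₂ p x : Point n} c → app f u < 0ℚ → Pos P p₁ → Pos vs (λ j → y' j + p₂ j) →
    app f p₁ ≡ c * (- app f u) → (∀ j → p j ≡ p₁ j + p₂ j) → (∀ j → y j ≡ c * u j + y' j) → (∀ j → x j ≡ y j + p j) →
    Pos (cross₁ f u P ++ vs) x
  cross-step f {u} {vs} {P} {y} {y'} {p₁} {p₂} {p} {x} c a q₁ q₂ f₁ d e h =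
    comb-++ {x = λ j → c * u j + p₁ j} {y = λ j → y' j + p₂ j} (cross₁-to f {a = c} {p = p₁} a q₁ (λ _ → refl) e₁) q₂ g
    where
    e₁ : c * app f u + app f p₁ ≡ 0ℚ
    e₁ = trans (cong (c * app f u +_) f₁) (solve 2 (λ c u → c :* u :+ c :* (:- u) := con 0ℚ) refl c (app f u))
    g : ∀ j → x j ≡ (c * u j + p₁ j) + (y' j + p₂ j)
    g j = trans (h j) (trans (cong₂ _+_ (e j) (d j))
      (solve 4 (λ a y p q → (a :+ y) :+ (p :+ q) := (a :+ p) :+ (y :+ q)) refl (c * u j) (y' j) (p₁ j) (p₂ j)))

  -- The part of p paired with the first negative vector is the multiple of p
  -- that balances it under f.
  cross-to : ∀ {n} (f : Func n) {u N P y p x} → All (λ v → app f v < 0ℚ) (u ∷ N) →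
    Pos (u ∷ N) y → Pos P p → app f y + app f p ≡ 0ℚ → (∀ j → x j ≡ y j + p j) → Pos (cross f (u ∷ N) P) x
  cross-to f {u} {[]} (a ∷ []) qy q s h = cross-base f a qy q s h
  cross-to f {u} {u' ∷ N} {P} {y} {p} {x} (a ∷ as) (cons c y' r qy e) q s h =
    let p₁ , p₂ , q₁ , q₂ , f₁ , f₂ , d = proportional-split f (c * (- app f u)) (- app f y') (0<* r (neg-0< a)) (neg-0< (pos-app<0 f as qy))
           (cross-balance (app f y) (app f p) c (app f u) (app f y') s (lin f c e)) q
    in cross-step f {p₁ = p₁} {p₂ = p₂} c a q₁
         (cross-to f {p = p₂} as qy q₂ (trans (cong (app f y' +_) f₂) (+-inverseʳ (app f y'))) (λ _ → refl)) f₁ d e h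

  cross-from : ∀ {n} (f : Func n) {u N v P x} → All (λ v → app f v < 0ℚ) (u ∷ N) → All (λ v → 0ℚ < app f v) (v ∷ P) →
    Pos (cross f (u ∷ N) (v ∷ P)) x →
    Σ (Point n) λ y → Σ (Point n) λ p → Pos (u ∷ N) y × Pos (v ∷ P) p × (∀ j → x j ≡ y j + p j)
  cross-from f {u} {N} {v} {P} {x} (a ∷ as) b q with comb-split (cross₁ f u (v ∷ P)) q
  ... | x₁ , x₂ , q₁ , q₂ , h with cross₁-from f a b q₁
  ... | c , p , _ , inj₂ c>0 , qp , e with N | as | q₂
  ... | [] | _ | nil z = (λ j → c * u j + 0ℚ) , p , cons c (λ _ → 0ℚ) c>0 (nil λ _ → refl) (λ _ → refl) , qp , g
    where
    g : ∀ j → x j ≡ c * u j + 0ℚ + p j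
    g j rewrite h j | e j | z j = solve 2 (λ a p → a :+ p :+ con 0ℚ := a :+ con 0ℚ :+ p) refl (c * u j) (p j)
  ... | u' ∷ N' | as' | q₂' with cross-from f as' b q₂'
  ... | y' , p' , qy' , qp' , e' = _ , _ , cons c y' c>0 qy' (λ _ → refl) , pos-+ qp qp' (λ _ → refl) , g
    where
    g : ∀ j → x j ≡ (c * u j + y' j) + (p j + p' j)
    g j rewrite h j | e j | e' j = solve 4 (λ a p y q → a :+ p :+ (y :+ q) := (a :+ y) :+ (p :+ q)) refl (c * u j) (p j) (y' j) (p' j)

  app-+ : ∀ {n} (f : Func n) (x y : Point n) {z} → (∀ j → z j ≡ x j + y j) → app f z ≡ app f x + app f y
  app-+ f x y e = trans (lin f {v = x} {y = y} 1ℚ (λ j → trans (e j) (cong (_+ y j) (sym (*-identityˡ (x j))))))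
    (cong (_+ app f y) (*-identityˡ (app f x)))

  cut-to : ∀ {n} (f : Func n) {vs u N Z P x} → Trip f vs (u ∷ N) Z P → Pos vs x → app f x ≡ 0ℚ → Pos (cross f (u ∷ N) P ++ Z) x
  cut-to f {x = x} t q s with trip-to t q
  ... | y , z , p , qy , qz , qp , h = comb-++ (cross-to f (trip-neg t) qy qp bal (λ _ → refl)) qz h
    where
    open ≡-Reasoning
    bal : app f y + app f p ≡ 0ℚ
    bal = begin
      app f y + app f p ≡⟨ sym (app-+ f y p λ _ → refl) ⟩
      app f (λ j → y j + p j) ≡⟨ sym (+-identityʳ _) ⟩
      app f (λ j → y j + p j) + 0ℚ ≡⟨ cong (app f (λ j → y j + p j) +_) (sym (comb-closed (ker-closed f) (trip-zer t) qz)) ⟩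
      app f (λ j → y j + p j) + app f z ≡⟨ sym (app-+ f (λ j → y j + p j) z h) ⟩
      app f x ≡⟨ s ⟩
      0ℚ ∎

  -- Since both signs occur, every vector of either side takes part in some crossing and thus
  -- receives a positive coefficient.
  cut-from : ∀ {n} (f : Func n) {vs u N Z v P x} → Trip f vs (u ∷ N) Z (v ∷ P) → Pos (cross f (u ∷ N) (v ∷ P) ++ Z) x → Pos vs x
  cut-from f {u = u} {N} {Z} {v} {P} t q with comb-split (cross f (u ∷ N) (v ∷ P)) q
  ... | x₁ , z , q₁ , qz , h with cross-from f (trip-neg t) (trip-pos t) q₁
  ... | y , p , qy , qp , e = trip-from t qy qz qp λ j → trans (h j) (cong (_+ z j) (e j))

  cut-ker : ∀ {n} (f : Func n) {vs N Z P} → Trip f vs N Z P → All (λ w → app f w ≡ 0ℚ) (cross f N P ++ Z)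
  cut-ker f {N = N} {P = P} t = ++⁺ (cross-All f N P λ {u} {v} _ _ → trans (app-crossing f u v f)
    (solve 2 (λ a b → b :* a :+ (:- a) :* b := con 0ℚ) refl (app f u) (app f v))) (trip-zer t)

  cut-span : ∀ {n} (f : Func n) {vs N Z P} → Trip f vs N Z P → All (Span vs) (cross f N P ++ Z)
  cut-span f {N = N} {P = P} t = ++⁺ (cross-All f N P λ {u} {v} k m → span-lin (app f v) (- app f u) (span-∈ (trip-∈N t k)) (span-∈ (trip-∈P t m)) (λ _ → refl))
    (All.tabulate λ m → span-∈ (trip-∈Z t m))

-- Stiemke's theorem of the alternative and linear separation.

module Stiemke where

  open import Defs using (Point)
  open Lin
  open Cut
  open import Data.Rational
  open import Data.Rational.Properties
  open import Data.Rational.Solver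
  open +-*-Solver
  open import Data.Empty using (⊥; ⊥-elim)
  open import Data.List using (List; []; _∷_; _++_; map; tabulate)
  open import Data.List.Membership.Propositional using (_∈_)
  open import Data.List.Relation.Unary.Any using (here; there)
  open import Data.List.Membership.Propositional.Properties using (∈-++⁺ˡ; ∈-++⁺ʳ; ∈-++⁻; ∈-map⁻)
  open import Data.List.Relation.Unary.All as All using (All; []; _∷_)
  open import Data.List.Relation.Unary.All.Properties using (++⁺; ++⁻ˡ; ++⁻ʳ; map⁺; map⁻; tabulate⁻)
  open import Data.Product using (Σ; _×_; _,_; proj₁; proj₂)
  open import Data.Sum using (_⊎_; inj₁; inj₂; [_,_]′)
  open import Relation.Nullary using (Dec; yes; no)
  open import Relation.Binary.PropositionalEquality

  cross-∈⁻ : ∀ {n} (f : Func n) N P {w} → w ∈ cross f N P → Σ (Point n) λ u → Σ (Point n) λ v → u ∈ N × v ∈ P × w ≡ crossing f u v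
  cross-∈⁻ f (u ∷ N) P m = [ (λ k → let v , k' , e = ∈-map⁻ (crossing f u) k in u , v , here refl , k' , e)
    , (λ k → let u' , v , a , b , e = cross-∈⁻ f N P k in u' , v , there a , b , e) ]′ (∈-++⁻ (cross₁ f u P) m)

  ratio-at : ∀ {fn} gn → fn < 0ℚ → Σ ℚ λ t → gn + t * fn ≡ 0ℚ
  ratio-at {fn} gn p = let i , _ , ie = inverse (neg-0< p) in gn * i ,
    trans (solve 3 (λ g i f → g :+ g :* i :* f := g :* (con 1ℚ :- i :* (:- f))) refl gn i fn)
    (trans (cong (λ l → gn * (1ℚ - l)) ie) (*-zeroʳ gn))

  below-ratio : ∀ g f s t gv fv → f < 0ℚ → g + s * f < 0ℚ → g + t * f ≡ 0ℚ → fv < 0ℚ → 0ℚ ≤ gv + s * fv → 0ℚ ≤ gv + t * fv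
  below-ratio g f s t gv fv f<0 lt eq fv<0 h = subst (0ℚ ≤_)
    (solve 4 (λ gv s t fv → gv :+ s :* fv :+ (s :- t) :* (:- fv) := gv :+ t :* fv) refl gv s t fv)
    (0≤+ h (0≤* (<⇒≤ st) (<⇒≤ (neg-0< fv<0))))
    where
    st : 0ℚ < s - t
    st = *-cancelˡ-0< (neg-0< f<0) (subst (0ℚ <_)
      (trans (solve 4 (λ g f s t → (g :+ t :* f) :- (g :+ s :* f) := (:- f) :* (s :- t)) refl g f s t) refl)
      (subst (λ z → 0ℚ < z - (g + s * f)) (sym eq) (<⇒0< lt)))

  -- t is the minimum of g v / (- f v) over the negative side. The minimiser is returned because
  -- pairing it with a vector p of the positive side shows that g p + t f p is nonnegative in
  -- `cut-lift`.
  min-ratio : ∀ {n} (f g : Func n) u N → All (λ v → app f v < 0ℚ) (u ∷ N) →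
    Σ ℚ λ t → All (λ v → 0ℚ ≤ app g v + t * app f v) (u ∷ N) × Σ (Point n) λ m → m ∈ (u ∷ N) × app g m + t * app f m ≡ 0ℚ
  min-ratio f g u [] (a ∷ []) = let t , e = ratio-at (app g u) a in t , ≤-reflexive (sym e) ∷ [] , u , here refl , e
  min-ratio f g u (u' ∷ N) (a ∷ as) = choose (min-ratio f g u' N as)
    where
    choose : (Σ ℚ λ t → All (λ v → 0ℚ ≤ app g v + t * app f v) (u' ∷ N) × Σ (Point _) λ m → m ∈ (u' ∷ N) × app g m + t * app f m ≡ 0ℚ) → _
    choose (s , al , m , k , e) = decide (0ℚ ≤? (app g u + s * app f u))
      where
      decide : Dec (0ℚ ≤ app g u + s * app f u) → Σ ℚ λ t → All (λ v → 0ℚ ≤ app g v + t * app f v) (u ∷ u' ∷ N) × Σ (Point _) λ m → m ∈ (u ∷ u' ∷ N) × app g m + t * app f m ≡ 0ℚ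
      decide (yes p) = s , p ∷ al , m , there k , e
      decide (no p) = let t , e' = ratio-at (app g u) a in
        t , ≤-reflexive (sym e') ∷ All.zipWith (λ {v} (h , fv) → below-ratio (app g u) (app f u) s t (app g v) (app f v) a (≰⇒> p) e' fv h) (al , as)
        , u , here refl , e'

  -- The crossing lies in the kernel of f, so adding t f to g does not change the value there.
  crossing-invariant : ∀ fp fn gn gp t → fp * (gn + t * fn) + (- fn) * (gp + t * fp) ≡ fp * gn + (- fn) * gp
  crossing-invariant = solve 5 (λ fp fn gn gp t → fp :* (gn :+ t :* fn) :+ (:- fn) :* (gp :+ t :* fp) := fp :* gn :+ (:- fn) :* gp) refl

  -- A functional that is nonnegative on the cut extends to one on all of vs after
  -- adding the largest multiple of f allowed by the negative side.
  cut-lift : ∀ {n} (f g : Func n) {vs u N Z P} → Trip f vs (u ∷ N) Z P →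
    All (λ w → 0ℚ ≤ app g w) (cross f (u ∷ N) P ++ Z) → (Σ (Point n) λ w → w ∈ (cross f (u ∷ N) P ++ Z) × 0ℚ < app g w) →
    Σ (Func n) λ h → All (λ v → 0ℚ ≤ app h v) vs × Σ (Point n) λ v → v ∈ vs × 0ℚ < app h v
  cut-lift {n} f g {vs} {u} {N} {Z} {P} t al (w , w∈ , w>0) = comb₂ 1ℚ g μ f , trip-All t onN onZ onP , strict
    where
    mr = min-ratio f g u N (trip-neg t)
    μ : ℚ
    μ = proj₁ mr
    h : Point n → ℚ
    h v = app g v + μ * app f v
    to : ∀ v → h v ≡ 1ℚ * app g v + μ * app f v
    to v = cong (_+ μ * app f v) (sym (*-identityˡ (app g v)))
    hN : All (λ v → 0ℚ ≤ h v) (u ∷ N)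
    hN = proj₁ (proj₂ mr)
    m : Point n
    m = proj₁ (proj₂ (proj₂ mr))
    m∈ : m ∈ (u ∷ N)
    m∈ = proj₁ (proj₂ (proj₂ (proj₂ mr)))
    hm : h m ≡ 0ℚ
    hm = proj₂ (proj₂ (proj₂ (proj₂ mr)))
    pairing : ∀ a b → app g (crossing f a b) ≡ app f b * h a + (- app f a) * h b
    pairing a b = trans (app-crossing f a b g) (sym (crossing-invariant (app f b) (app f a) (app g a) (app g b) μ))
    hP : ∀ {p} → p ∈ P → 0ℚ ≤ h p
    hP {p} k = *-cancelˡ-0≤ (neg-0< (All.lookup (trip-neg t) m∈))
      (subst (0ℚ ≤_) (trans (pairing m p) (trans (cong (λ z → app f p * z + (- app f m) * h p) hm)
         (trans (cong (_+ (- app f m) * h p) (*-zeroʳ (app f p))) (+-identityˡ ((- app f m) * h p)))))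
        (All.lookup al (∈-++⁺ˡ (cross-∈ f m∈ k))))
    hZ : ∀ {z} → z ∈ Z → h z ≡ app g z
    hZ {z} k = trans (cong (λ l → app g z + μ * l) (All.lookup (trip-zer t) k))
      (trans (cong (app g z +_) (*-zeroʳ μ)) (+-identityʳ (app g z)))
    onN : All (λ v → 0ℚ ≤ 1ℚ * app g v + μ * app f v) (u ∷ N)
    onN = All.map (λ {v} → subst (0ℚ ≤_) (to v)) hN
    onP : All (λ v → 0ℚ ≤ 1ℚ * app g v + μ * app f v) P
    onP = All.tabulate λ {p} k → subst (0ℚ ≤_) (to p) (hP k)
    onZ : All (λ v → 0ℚ ≤ 1ℚ * app g v + μ * app f v) Z
    onZ = All.tabulate λ {z} k → subst (0ℚ ≤_) (trans (sym (hZ k)) (to z)) (All.lookup al (∈-++⁺ʳ (cross f (u ∷ N) P) k))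
    Goal : Set
    Goal = Σ (Point n) λ v → v ∈ vs × 0ℚ < 1ℚ * app g v + μ * app f v
    fromCross : (Σ (Point n) λ a → Σ (Point n) λ b → a ∈ (u ∷ N) × b ∈ P × w ≡ crossing f a b) → Goal
    fromCross (a , b , a∈ , b∈ , e) = decide (0ℚ <? h a)
      where
      total : 0ℚ < app f b * h a + (- app f a) * h b
      total = subst (0ℚ <_) (trans (cong (app g) e) (pairing a b)) w>0
      decide : Dec (0ℚ < h a) → Goal
      decide (yes p) = a , trip-∈N t a∈ , subst (0ℚ <_) (to a) p
      decide (no p) = b , trip-∈P t b∈ , subst (0ℚ <_) (to b) (*-cancelˡ-0< (neg-0< (All.lookup (trip-neg t) a∈))
        (subst (0ℚ <_) (solve 4 (λ fb ha fa hb → fb :* ha :+ (:- fa) :* hb :+ fb :* (:- ha) := (:- fa) :* hb) refl (app f b) (h a) (app f a) (h b))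
          (0<+≤ total (0≤* (<⇒≤ (All.lookup (trip-pos t) b∈)) (neg-0≤ (≮⇒≥ p))))))
    strict : Goal
    strict = [ (λ k → fromCross (cross-∈⁻ f (u ∷ N) P k))
      , (λ k → w , trip-∈Z t k , subst (0ℚ <_) (trans (sym (hZ k)) (to w)) w>0) ]′ (∈-++⁻ (cross f (u ∷ N) P) w∈)

  PosOrSep : ∀ {n} → List (Point n) → Set
  PosOrSep {n} vs = Pos vs (λ _ → 0ℚ) ⊎ (Σ (Func n) λ h → All (λ v → 0ℚ ≤ app h v) vs × Σ (Point n) λ v → v ∈ vs × 0ℚ < app h v)

  -- The measure of the induction: on the span of the vectors, 0 is the only common zero of the
  -- listed functionals. Passing to a cut inside the kernel of the first functional allows it to be
  -- dropped.
  separated-by : ∀ {n} (fs : List (Func n)) (vs : List (Point n)) → Set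
  separated-by fs vs = ∀ x → Span vs x → All (λ f → app f x ≡ 0ℚ) fs → ∀ j → x j ≡ 0ℚ

  stiemke-along : ∀ {n} (fs : List (Func n)) (vs : List (Point n)) → separated-by fs vs → PosOrSep vs

  -- Four sign patterns. If f takes one strict sign only, f or its negative separates; if it
  -- vanishes on all generators it is dropped; if both signs occur, the alternative for the cut is
  -- carried back by `cut-from` and `cut-lift`.
  stiemke-cut : ∀ {n} (f : Func n) fs (vs : List (Point n)) {N Z P} → separated-by (f ∷ fs) vs → Trip f vs N Z P → PosOrSep vs
  stiemke-cut f fs vs {[]} {Z} {[]} s t = stiemke-along fs vs λ x p a → s x p
    (comb-closed (ker-closed f) (trip-All {D = λ v → app f v ≡ 0ℚ} t [] (trip-zer t) []) p ∷ a)
  stiemke-cut f fs vs {u ∷ N} {Z} {[]} s t = inj₂ (negF f ,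
    trip-All t (All.map (λ p → <⇒≤ (neg-0< p)) (trip-neg t)) (All.map (λ p → ≤-reflexive (sym (cong -_ p))) (trip-zer t)) [] ,
    u , trip-∈N t (here refl) , neg-0< (All.lookup (trip-neg t) (here refl)))
  stiemke-cut f fs vs {[]} {Z} {v ∷ P} s t = inj₂ (f ,
    trip-All t [] (All.map (λ p → ≤-reflexive (sym p)) (trip-zer t)) (All.map <⇒≤ (trip-pos t)) ,
    v , trip-∈P t (here refl) , All.lookup (trip-pos t) (here refl))
  stiemke-cut f fs vs {u ∷ N} {Z} {v ∷ P} s t = [ (λ p → inj₁ (cut-from f t p)) , (λ (g , a , w) → inj₂ (cut-lift f g t a w)) ]′
    (stiemke-along fs (cross f (u ∷ N) (v ∷ P) ++ Z) λ x p a → s x (comb-closed span-closed (cut-span f t) p)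
      (comb-closed (ker-closed f) (cut-ker f t) p ∷ a))

  stiemke-along [] vs s = let x , p = pos-total vs in inj₁ (comb-cong (λ j → sym (s x (comb⇒span p) [] j)) p)
  stiemke-along (f ∷ fs) vs s = let N , Z , P , t = trip f vs in stiemke-cut f fs vs s t

  stiemke : ∀ {n} (vs : List (Point n)) → PosOrSep vs
  stiemke vs = stiemke-along (tabulate ev) vs λ x _ a j → tabulate⁻ a j

  opposite : ∀ {n} → Point n → Point n
  opposite x j = - x j

  app-opposite : ∀ {n} (h : Func n) x → app h (opposite x) ≡ - app h x
  app-opposite h x = trans (app-lin₂ h {u = x} {v = x} (- 1ℚ) 0ℚ (λ j → solve 1 (λ u → :- u := (:- con 1ℚ) :* u :+ con 0ℚ :* u) refl (x j)))
    (solve 1 (λ u → (:- con 1ℚ) :* u :+ con 0ℚ :* u := :- u) refl (app h x))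

  pos-opposite : ∀ {n} {vs : List (Point n)} {x} → Pos (opposite x ∷ vs) (λ _ → 0ℚ) → Pos vs x
  pos-opposite {vs = vs} {x} (cons c y c>0 q e) = build (inverse c>0)
    where
    build : (Σ ℚ λ i → 0ℚ < i × i * c ≡ 1ℚ) → Pos vs x
    build (i , i>0 , ie) = pos-scale i i>0 q λ j → begin
      x j ≡⟨ sym (*-identityˡ (x j)) ⟩
      1ℚ * x j ≡⟨ cong (_* x j) (sym ie) ⟩
      i * c * x j ≡⟨ solve 4 (λ i c x y → i :* c :* x := i :* (y :- (c :* (:- x) :+ y))) refl i c (x j) (y j) ⟩
      i * (y j - (c * (- x j) + y j)) ≡⟨ cong (λ a → i * (y j - a)) (sym (e j)) ⟩
      i * (y j - 0ℚ) ≡⟨ solve 2 (λ i y → i :* (y :- con 0ℚ) := i :* y) refl i (y j) ⟩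
      i * y j ∎
      where open ≡-Reasoning

  -- Moving x to the other side turns the question into a positive dependency of `opposite x ∷ vs`;
  -- the functional of the other alternative excludes x by `pos-strict`. Decidability is what turns
  -- membership into the integer-valued indicators summed below.
  pos-dec : ∀ {n} (vs : List (Point n)) x → Dec (Pos vs x)
  pos-dec vs x = [ (λ p → yes (pos-opposite p)) , (λ s → no (λ q → against s q)) ]′ (stiemke (opposite x ∷ vs))
    where
    against : (Σ (Func _) λ h → All (λ v → 0ℚ ≤ app h v) (opposite x ∷ vs) × Σ (Point _) λ v → v ∈ (opposite x ∷ vs) × 0ℚ < app h v) → Pos vs x → ⊥
    against (h , a , v , v∈ , v>0) q = <-irrefl (sym (app-0 h (λ _ → refl)))
      (pos-strict h a v∈ v>0 (cons 1ℚ x 0<1 q λ j → solve 1 (λ x → con 0ℚ := con 1ℚ :* (:- x) :+ x) refl (x j)))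

  -- Listing each vector together with its opposite forces a nonnegative functional to vanish on
  -- `vs`, so the alternative becomes membership in the span; the value at v is then normalised to
  -- 1.
  span-or-separated : ∀ {n} (vs : List (Point n)) v → Span vs v ⊎ Σ (Func n) λ f → All (λ u → app f u ≡ 0ℚ) vs × app f v ≡ 1ℚ
  span-or-separated {n} vs v = [ (λ p → inj₁ (comb-closed span-closed mem (comb⇒span (pos-opposite p)))) , (λ s → inj₂ (sep s)) ]′ (stiemke L)
    where
    L : List (Point n)
    L = opposite v ∷ vs ++ map opposite vs
    mem : All (Span vs) (vs ++ map opposite vs)
    mem = ++⁺ (All.tabulate span-∈) (map⁺ (All.tabulate λ {u} k → span-lin (- 1ℚ) 0ℚ (span-∈ k) (span-∈ k)
      λ j → solve 1 (λ u → :- u := (:- con 1ℚ) :* u :+ con 0ℚ :* u) refl (u j)))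
    sep : (Σ (Func n) λ h → All (λ u → 0ℚ ≤ app h u) L × Σ (Point n) λ u → u ∈ L × 0ℚ < app h u) →
      Σ (Func n) λ f → All (λ u → app f u ≡ 0ℚ) vs × app f v ≡ 1ℚ
    sep (h , _ ∷ a , w , w∈ , w>0) = let i , _ , ie = inverse (hv w∈) in
      comb₂ (- i) h 0ℚ h ,
      All.map (λ {u} z → trans (cong (λ l → (- i) * l + 0ℚ * l) z) (solve 1 (λ i → (:- i) :* con 0ℚ :+ con 0ℚ :* con 0ℚ := con 0ℚ) refl i)) zeros ,
      trans (solve 2 (λ i u → (:- i) :* u :+ con 0ℚ :* u := i :* (:- u)) refl i (app h v))
        (trans (cong (i *_) (sym (app-opposite h v))) ie)
      where
      zeros : All (λ u → app h u ≡ 0ℚ) vs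
      zeros = All.zipWith (λ {u} (p , q) → ≤-antisym (subst₂ _≤_ (solve 1 (λ u → :- (:- u) := u) refl (app h u)) refl
           (neg-≤0 (subst (0ℚ ≤_) (app-opposite h u) q))) p) (++⁻ˡ vs a , map⁻ (++⁻ʳ vs a))
      hv : w ∈ L → 0ℚ < app h (opposite v)
      hv (here refl) = w>0
      hv (there k) = ⊥-elim (<-irrefl (sym (comb-closed (ker-closed h) zeros (All.lookup mem k))) w>0)

-- An open cone contains a neighbourhood of each of its points within its span.

module Interior where

  open import Defs using (Point)
  open Lin
  open Stiemke
  open import Data.Nat using (zero; suc)
  open import Data.Fin using (zero; suc)
  open import Data.Rational
  open import Data.Rational.Properties
  open import Data.Rational.Solver
  open +-*-Solver
  open import Data.List using (List; []; _∷_)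
  open import Data.List.Relation.Unary.All as All using (All; _∷_)
  open import Data.Product using (Σ; _×_; _,_)
  open import Data.Sum using ([_,_]′)
  open import Relation.Nullary using (Dec; yes; no)
  open import Relation.Binary.PropositionalEquality

  min-pos : ∀ {a b} → 0ℚ < a → 0ℚ < b → Σ ℚ λ c → 0ℚ < c × c ≤ a × c ≤ b
  min-pos {a} {b} p q = [ (λ h → a , p , ≤-refl , h) , (λ h → b , q , h , ≤-refl) ]′ (≤-total a b)

  shift-pos : ∀ c d → 0ℚ < c → Σ ℚ λ δ → 0ℚ < δ × (∀ ε → 0ℚ ≤ ε → ε ≤ δ → 0ℚ < c + ε * d)
  shift-pos c d c>0 = decide (0ℚ ≤? d)
    where
    decide : Dec (0ℚ ≤ d) → Σ ℚ λ δ → 0ℚ < δ × (∀ ε → 0ℚ ≤ ε → ε ≤ δ → 0ℚ < c + ε * d)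
    decide (yes p) = 1ℚ , 0<1 , λ ε e _ → 0<+≤ c>0 (0≤* e p)
    decide (no p) = let i , i>0 , ie = inverse 1-d>0 in c * i , 0<* c>0 i>0 , λ ε _ e →
      subst (0ℚ <_) (eq i ε ie) (0<+≤ (0<* c>0 i>0) (0≤* (≤⇒0≤ e) (<⇒≤ (neg-0< (≰⇒> p)))))
      where
      1-d>0 : 0ℚ < 1ℚ + (- d)
      1-d>0 = 0<+ 0<1 (neg-0< (≰⇒> p))
      eq : ∀ i ε → i * (1ℚ + (- d)) ≡ 1ℚ → c * i + (c * i - ε) * (- d) ≡ c + ε * d
      eq i ε ie = trans (solve 4 (λ c i ε d → c :* i :+ (c :* i :- ε) :* (:- d) := c :* (i :* (con 1ℚ :+ :- d)) :+ ε :* d) refl c i ε d)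
        (cong (_+ ε * d) (trans (cong (c *_) ie) (*-identityʳ c)))

  -- Each coefficient is positive and stays so after adding a small enough multiple of the
  -- corresponding coefficient of y; finitely many bounds have a positive minimum. This is the
  -- device for moving from an interior point in any direction of the span.
  pos-extend : ∀ {n} {vs : List (Point n)} {x y} → Pos vs x → Span vs y →
    Σ ℚ λ δ → 0ℚ < δ × (∀ ε → 0ℚ ≤ ε → ε ≤ δ → Pos vs (λ j → x j + ε * y j))
  pos-extend {x = x} {y} (nil e) (nil e') = 1ℚ , 0<1 , λ ε _ _ → nil λ j →
    trans (cong₂ (λ a b → a + ε * b) (e j) (e' j)) (solve 1 (λ ε → con 0ℚ :+ ε :* con 0ℚ := con 0ℚ) refl ε)
  pos-extend {x = x} {y} (cons {v = v} c x' r p e) (cons d y' _ q e') =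
    let δ₁ , p₁ , h₁ = shift-pos c d r
        δ₂ , p₂ , h₂ = pos-extend p q
        δ , δ>0 , l₁ , l₂ = min-pos p₁ p₂
    in δ , δ>0 , λ ε ε≥0 ε≤ → cons (c + ε * d) (λ j → x' j + ε * y' j) (h₁ ε ε≥0 (≤-trans ε≤ l₁)) (h₂ ε ε≥0 (≤-trans ε≤ l₂))
      λ j → trans (cong₂ (λ a b → a + ε * b) (e j) (e' j))
        (solve 6 (λ c d v x y ε → c :* v :+ x :+ ε :* (d :* v :+ y) := (c :+ ε :* d) :* v :+ (x :+ ε :* y)) refl c d (v j) (x' j) (y' j) ε)

  consPt : ∀ {n} → ℚ → Point n → Point (suc n)
  consPt a x zero = a
  consPt a x (suc j) = x j

  tailFunc : ∀ {n} → Func (suc n) → Func n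
  tailFunc f = record
    { app = λ x → app f (consPt 0ℚ x)
    ; lin = λ {x} {v} {y} c e → lin f {consPt 0ℚ x} {consPt 0ℚ v} {consPt 0ℚ y} c
        λ { zero → solve 1 (λ c → con 0ℚ := c :* con 0ℚ :+ con 0ℚ) refl c ; (suc j) → e j } }

  e₀ : ∀ {n} → Point (suc n)
  e₀ = consPt 1ℚ (λ _ → 0ℚ)

  app-head-tail : ∀ {n} (f : Func (suc n)) y → app f y ≡ y zero * app f e₀ + app (tailFunc f) (λ j → y (suc j))
  app-head-tail f y = lin f {y} {e₀} {consPt 0ℚ (λ j → y (suc j))} (y zero)
    λ { zero → solve 1 (λ y → y := y :* con 1ℚ :+ con 0ℚ) refl (y zero)
      ; (suc j) → solve 2 (λ y z → z := y :* con 0ℚ :+ z) refl (y zero) (y (suc j)) }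

  ∣∣-bound-+ : ∀ a b {p q} → ∣ a ∣ ≤ p → ∣ b ∣ ≤ q → ∣ a + b ∣ ≤ p + q
  ∣∣-bound-+ a b h k = ≤-trans (∣p+q∣≤∣p∣+∣q∣ a b) (+-mono-≤ h k)

  ∣∣-bound-* : ∀ a b {p q} → 0ℚ ≤ q → ∣ a ∣ ≤ p → ∣ b ∣ ≤ q → ∣ a * b ∣ ≤ p * q
  ∣∣-bound-* a b {p} {q} q≥0 h k = subst (_≤ p * q) (sym (∣p*q∣≡∣p∣*∣q∣ a b)) (0≤⇒≤ (subst (0ℚ ≤_)
    (solve 4 (λ a b p q → (p :- a) :* q :+ a :* (q :- b) := p :* q :- a :* b) refl ∣ a ∣ ∣ b ∣ p q)
    (0≤+ (0≤* (≤⇒0≤ h) q≥0) (0≤* (0≤∣p∣ a) (≤⇒0≤ k)))))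

  0≤a+∣a∣ : ∀ a → 0ℚ ≤ a + ∣ a ∣
  0≤a+∣a∣ a = [ (λ e → 0≤+ (∣p∣≡p⇒0≤p e) (0≤∣p∣ a)) , (λ e → ≤-reflexive (sym (trans (cong (a +_) e) (+-inverseʳ a)))) ]′ (∣p∣≡p∨∣p∣≡-p a)

  -- K is the sum of the absolute values of f on the unit vectors.
  func-bound : ∀ n (f : Func n) → Σ ℚ λ K → 0ℚ ≤ K × (∀ y δ → 0ℚ ≤ δ → (∀ j → ∣ y j ∣ ≤ δ) → ∣ app f y ∣ ≤ δ * K)
  func-bound zero f = 0ℚ , ≤-refl , λ y δ _ _ → ≤-reflexive (trans (cong ∣_∣ (app-0 f λ ())) (sym (*-zeroʳ δ)))
  func-bound (suc n) f = let K , K≥0 , h = func-bound n (tailFunc f) in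
    ∣ app f e₀ ∣ + K , 0≤+ (0≤∣p∣ (app f e₀)) K≥0 , λ y δ δ≥0 b →
      subst₂ (λ a k → ∣ a ∣ ≤ k) (sym (app-head-tail f y)) (sym (*-distribˡ-+ δ ∣ app f e₀ ∣ K))
        (∣∣-bound-+ (y zero * app f e₀) (app (tailFunc f) (λ j → y (suc j)))
          (∣∣-bound-* (y zero) (app f e₀) (0≤∣p∣ (app f e₀)) (b zero) ≤-refl)
          (h (λ j → y (suc j)) δ δ≥0 (λ j → b (suc j))))

  coord-bound : ∀ n (v : Point n) → Σ ℚ λ V → 0ℚ ≤ V × (∀ j → ∣ v j ∣ ≤ V)
  coord-bound zero v = 0ℚ , ≤-refl , λ ()
  coord-bound (suc n) v = let V , V≥0 , h = coord-bound n (λ j → v (suc j)) in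
    ∣ v zero ∣ + V , 0≤+ (0≤∣p∣ (v zero)) V≥0 ,
    λ { zero → subst (_≤ ∣ v zero ∣ + V) (+-identityʳ ∣ v zero ∣) (+-monoʳ-≤ ∣ v zero ∣ V≥0)
      ; (suc j) → ≤-trans (h j) (subst (_≤ ∣ v zero ∣ + V) (+-identityˡ V) (+-monoˡ-≤ V (0≤∣p∣ (v zero)))) }

  small-below : ∀ c K → 0ℚ < c → 0ℚ ≤ K → Σ ℚ λ δ → 0ℚ < δ × (∀ ε → ε ≤ δ → ε * K < c)
  small-below c K c>0 K≥0 = let i , i>0 , ie = inverse {K + 1ℚ} (subst (0ℚ <_) (+-comm 1ℚ K) (0<+≤ 0<1 K≥0)) in
    c * i , 0<* c>0 i>0 , λ ε h → 0<⇒< (subst (0ℚ <_) (eq i ε ie) (0<+≤ (0<* c>0 i>0) (0≤* (≤⇒0≤ h) K≥0)))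
    where
    eq : ∀ i ε → i * (K + 1ℚ) ≡ 1ℚ → c * i + (c * i - ε) * K ≡ c - ε * K
    eq i ε ie = trans (solve 4 (λ c i ε k → c :* i :+ (c :* i :- ε) :* k := c :* (i :* (k :+ con 1ℚ)) :- ε :* k) refl c i ε K)
      (cong (_- ε * K) (trans (cong (c *_) ie) (*-identityʳ c)))

  Interior : ∀ {n} → List (Point n) → Point n → Set
  Interior vs x = Σ ℚ λ δ → 0ℚ < δ × (∀ y → Span vs y → (∀ j → ∣ y j ∣ ≤ δ) → Pos vs (λ j → x j + y j))

  -- The coefficient of v is left alone, and the whole perturbation is absorbed by `vs`, whose span
  -- contains it.
  interior-dependent : ∀ {n} {v : Point n} {vs x x'} c → 0ℚ < c → (∀ j → x j ≡ c * v j + x' j) →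
    Span vs v → Interior vs x' → Interior (v ∷ vs) x
  interior-dependent {v = v} {vs} {x} {x'} c c>0 e s (δ , δ>0 , h) = δ , δ>0 , go
    where
    go : ∀ y → Span (v ∷ vs) y → (∀ j → ∣ y j ∣ ≤ δ) → Pos (v ∷ vs) (λ j → x j + y j)
    go y q b = cons c (λ j → x' j + y j) c>0 (h y (comb-closed span-closed (s ∷ All.tabulate span-∈) q) b)
      λ j → trans (cong (_+ y j) (e j)) (+-assoc (c * v j) (x' j) (y j))

  -- f reads off the coefficient of v, so that of a perturbation y is at most δ K, and what remains
  -- lies in the span of `vs` with entries at most δ (1 + K V). The two thresholds keep the
  -- coefficient of v positive and the remainder within the radius valid for `vs`.
  interior-independent : ∀ {n} {v : Point n} {vs x x'} c → 0ℚ < c → (∀ j → x j ≡ c * v j + x' j) →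
    (f : Func n) → All (λ u → app f u ≡ 0ℚ) vs → app f v ≡ 1ℚ → Interior vs x' → Interior (v ∷ vs) x
  interior-independent {n} {v} {vs} {x} {x'} c c>0 e f z o (δ' , δ'>0 , h) =
    let K , K≥0 , hK = func-bound n f
        V , V≥0 , hV = coord-bound n v
        δ₁ , δ₁>0 , l₁ = small-below c K c>0 K≥0
        δ₂ , δ₂>0 , l₂ = small-below δ' (1ℚ + K * V) δ'>0 (0≤+ 0≤1 (0≤* K≥0 V≥0))
        δ , δ>0 , m₁ , m₂ = min-pos δ₁>0 δ₂>0
    in δ , δ>0 , λ y q b → finish y δ K V q (hK y δ (<⇒≤ δ>0) b) V≥0 hV b (l₁ δ m₁) (l₂ δ m₂)
    where
    finish : ∀ y δ K V → Span (v ∷ vs) y → ∣ app f y ∣ ≤ δ * K → 0ℚ ≤ V → (∀ j → ∣ v j ∣ ≤ V) → (∀ j → ∣ y j ∣ ≤ δ) →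
      δ * K < c → δ * (1ℚ + K * V) < δ' → Pos (v ∷ vs) (λ j → x j + y j)
    finish y δ K V (cons d y' _ q e') hK V≥0 hV b lt₁ lt₂ = cons (c + d) (λ j → x' j + y' j) cd (h y' q small)
      λ j → trans (cong₂ _+_ (e j) (e' j)) (solve 5 (λ c d v x y → c :* v :+ x :+ (d :* v :+ y) := (c :+ d) :* v :+ (x :+ y)) refl c d (v j) (x' j) (y' j))
      where
      fy : app f y ≡ d
      fy = trans (lin f d e') (trans (cong₂ (λ a b → d * a + b) o (comb-closed (ker-closed f) z q))
         (trans (+-identityʳ (d * 1ℚ)) (*-identityʳ d)))
      d≤ : ∣ d ∣ ≤ δ * K
      d≤ = subst (λ a → ∣ a ∣ ≤ δ * K) fy hK
      cd : 0ℚ < c + d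
      cd = subst (0ℚ <_) (solve 3 (λ c d a → c :- a :+ (d :+ a) := c :+ d) refl c d ∣ d ∣)
        (0<+≤ (<⇒0< (≤-<-trans d≤ lt₁)) (0≤a+∣a∣ d))
      small : ∀ j → ∣ y' j ∣ ≤ δ'
      small j = ≤-trans (subst (λ a → ∣ a ∣ ≤ δ + δ * K * V) (sym y'j)
          (∣∣-bound-+ (y j) (- (d * v j)) (b j) (subst (_≤ δ * K * V) (sym (∣-p∣≡∣p∣ (d * v j))) (∣∣-bound-* d (v j) V≥0 d≤ (hV j)))))
        (<⇒≤ (subst (_< δ') (solve 3 (λ δ K V → δ :* (con 1ℚ :+ K :* V) := δ :+ δ :* K :* V) refl δ K V) lt₂))
        where
        y'j : y' j ≡ y j - d * v j
        y'j = trans (solve 2 (λ a y → y := (a :+ y) :- a) refl (d * v j) (y' j)) (cong (_- d * v j) (sym (e' j)))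

  pos-interior : ∀ {n} (vs : List (Point n)) {x} → Pos vs x → Interior vs x
  pos-interior [] {x} (nil e) = 1ℚ , 0<1 , λ { y (nil z) _ → nil λ j → trans (cong₂ _+_ (e j) (z j)) refl }
  pos-interior (v ∷ vs) {x} (cons c x' c>0 p e) =
    [ (λ s → interior-dependent c c>0 e s (pos-interior vs p))
    , (λ (f , z , o) → interior-independent c c>0 e f z o (pos-interior vs p)) ]′ (span-or-separated vs v)

-- Linear independence and rank.

module Rank where

  open import Defs using (Point)
  open Lin
  open Stiemke
  open import Data.Nat using (ℕ; zero; suc; _≤′_; ≤′-reflexive; ≤′-step)
  open import Data.Fin using (Fin; zero; suc; punchIn)
  open import Data.Fin.Properties using (any?)
  open import Data.Rational hiding (_≟_)
  open import Data.Rational.Properties hiding (_≟_)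
  import Data.Rational.Properties as ℚₚ
  open import Data.Rational.Solver
  open +-*-Solver
  open import Algebra.Bundles using (CommutativeRing)
  open import Algebra.Properties.Semiring.Sum (CommutativeRing.semiring +-*-commutativeRing) public
  open import Data.Vec.Functional using (insertAt)
  open import Data.Vec.Functional.Properties using (insertAt-lookup; insertAt-punchIn)
  open import Data.Empty using (⊥-elim)
  open import Data.List using (List; []; _∷_)
  open import Data.List.Membership.Propositional using (_∈_)
  open import Data.List.Relation.Unary.Any using (here; there)
  open import Data.List.Relation.Unary.All as All using (All; _∷_)
  open import Data.Product using (Σ; ∃; _×_; _,_; proj₁; proj₂)
  open import Data.Sum using ([_,_]′)
  open import Data.Unit using (⊤; tt)
  open import Function using (_∘_)
  open import Relation.Nullary using (¬_; Dec; yes; no; ¬?)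
  open import Relation.Nullary.Decidable using (decidable-stable)
  open import Relation.Binary using (tri<; tri≈; tri>)
  open import Relation.Binary.PropositionalEquality

  combination : ∀ {n} k → (Fin k → ℚ) → (Fin k → Point n) → Point n
  combination k c v j = sum (λ i → c i * v i j)

  Indep : ∀ {n} k → (Fin k → Point n) → Set
  Indep k v = ∀ c → (∀ j → combination k c v j ≡ 0ℚ) → ∀ i → c i ≡ 0ℚ

  app-combination : ∀ {n} (f : Func n) k c v → app f (combination k c v) ≡ sum (λ i → c i * app f (v i))
  app-combination f zero c v = app-0 f λ _ → refl
  app-combination f (suc k) c v = trans (lin f (c zero) (λ _ → refl))
    (cong (c zero * app f (v zero) +_) (app-combination f k (c ∘ suc) (v ∘ suc)))

  closed-combination : ∀ {n} {D : Point n → Set} → Closed (λ _ → ⊤) D → ∀ k c {v} → (∀ i → D (v i)) → D (combination k c v)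
  closed-combination C zero c d = at-0 C λ _ → refl
  closed-combination C (suc k) c d = step C (c zero) tt (d zero) (closed-combination C k (c ∘ suc) (d ∘ suc)) λ _ → refl

  sum-0 : ∀ k {f : Fin k → ℚ} → (∀ i → f i ≡ 0ℚ) → sum f ≡ 0ℚ
  sum-0 k e = trans (sum-cong-≗ e) (sum-replicate-zero k)

  *-cancelˡ-≢0 : ∀ {a b} → ¬ a ≡ 0ℚ → a * b ≡ 0ℚ → b ≡ 0ℚ
  *-cancelˡ-≢0 {a} {b} h e with <-cmp a 0ℚ
  ... | tri< p _ _ = *-cancelˡ-0≡ (neg-0< p) (trans (sym (neg-distribˡ-* a b)) (cong -_ e))
  ... | tri≈ _ p _ = ⊥-elim (h p)
  ... | tri> _ _ p = *-cancelˡ-0≡ p e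

  _◂_ : ∀ {n k} → Point n → (Fin k → Point n) → Fin (suc k) → Point n
  (u ◂ v) zero = u
  (u ◂ v) (suc i) = v i

  indep-◂ : ∀ {n k} (f : Func n) {u} {v : Fin k → Point n} → ¬ app f u ≡ 0ℚ → (∀ i → app f (v i) ≡ 0ℚ) → Indep k v → Indep (suc k) (u ◂ v)
  indep-◂ {k = k} f {u} {v} h z I c e = λ { zero → c₀ ; (suc i) → I (c ∘ suc) rest i }
    where
    fe : c zero * app f u + sum (λ i → c (suc i) * app f (v i)) ≡ 0ℚ
    fe = trans (sym (app-combination f (suc k) c (u ◂ v))) (app-0 f e)
    c₀ : c zero ≡ 0ℚ
    c₀ = *-cancelˡ-≢0 h (trans (*-comm (app f u) (c zero)) (trans (sym (+-identityʳ (c zero * app f u)))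
      (trans (cong (c zero * app f u +_) (sym (sum-0 k λ i → trans (cong (c (suc i) *_) (z i)) (*-zeroʳ (c (suc i)))))) fe)))
    rest : ∀ j → combination k (c ∘ suc) v j ≡ 0ℚ
    rest j = trans (trans (sym (+-identityˡ (combination k (c ∘ suc) v j)))
      (cong (_+ combination k (c ∘ suc) v j) (sym (trans (cong (_* u j) c₀) (*-zeroˡ (u j)))))) (e j)

  indep-tail : ∀ {n k} (v : Fin (suc k) → Point n) → Indep (suc k) v → Indep k (v ∘ suc)
  indep-tail {k = k} v I c e i = I c' e' (suc i)
    where
    c' : Fin (suc k) → ℚ
    c' zero = 0ℚ
    c' (suc i) = c i
    e' : ∀ j → combination (suc k) c' v j ≡ 0ℚ
    e' j = trans (cong (_+ combination k c (v ∘ suc) j) (*-zeroˡ (v zero j))) (trans (+-identityˡ _) (e j))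

  indep-take : ∀ {n k m} {D : Point n → Set} → k ≤′ m → (v : Fin m → Point n) → (∀ i → D (v i)) → Indep m v →
    Σ (Fin k → Point n) λ w → (∀ i → D (w i)) × Indep k w
  indep-take (≤′-reflexive refl) v d I = v , d , I
  indep-take {D = D} (≤′-step l) v d I = indep-take {D = D} l (v ∘ suc) (d ∘ suc) (indep-tail v I)

  eliminate : ∀ {n} → Func n → Point n → Point n → Point n
  eliminate f p x j = app f p * x j + (- app f x) * p j

  app-eliminate : ∀ {n} (f : Func n) p x → app f (eliminate f p x) ≡ 0ℚ
  app-eliminate f p x = trans (app-lin₂ f (app f p) (- app f x) (λ _ → refl))
    (solve 2 (λ p x → p :* x :+ (:- x) :* p := con 0ℚ) refl (app f p) (app f x))

  -- A relation with coefficients c i among the eliminated vectors is one among the original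
  -- vectors, with coefficients c i times f (v p) away from p and r at p. All of these vanish, and f
  -- (v p) is nonzero.
  indep-eliminate : ∀ {n k} (f : Func n) (v : Fin (suc k) → Point n) (p : Fin (suc k)) → ¬ app f (v p) ≡ 0ℚ →
    Indep (suc k) v → Indep k (λ i → eliminate f (v p) (v (punchIn p i)))
  indep-eliminate {n} {k} f v p h I c e i = *-cancelˡ-≢0 h (trans (*-comm fp (c i)) (trans (sym (insertAt-punchIn c' p r i)) (I d e' (punchIn p i))))
    where
    fp : ℚ
    fp = app f (v p)
    c' : Fin k → ℚ
    c' i = c i * fp
    r : ℚ
    r = sum (λ i → c i * (- app f (v (punchIn p i))))
    d : Fin (suc k) → ℚ
    d = insertAt c' p r
    e' : ∀ j → combination (suc k) d v j ≡ 0ℚ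
    e' j = begin
      sum (λ i → d i * v i j)
        ≡⟨ sum-remove {i = p} (λ i → d i * v i j) ⟩
      d p * v p j + sum (λ i → d (punchIn p i) * v (punchIn p i) j)
        ≡⟨ cong₂ _+_ (cong (_* v p j) (insertAt-lookup c' p r)) (sum-cong-≗ λ i → cong (_* v (punchIn p i) j) (insertAt-punchIn c' p r i)) ⟩
      r * v p j + sum (λ i → c' i * v (punchIn p i) j)
        ≡⟨ cong (_+ sum (λ i → c' i * v (punchIn p i) j)) (*-distribʳ-sum (v p j) (λ i → c i * (- app f (v (punchIn p i))))) ⟩
      sum (λ i → c i * (- app f (v (punchIn p i))) * v p j) + sum (λ i → c' i * v (punchIn p i) j)
        ≡⟨ sym (∑-distrib-+ (λ i → c i * (- app f (v (punchIn p i))) * v p j) (λ i → c' i * v (punchIn p i) j)) ⟩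
      sum (λ i → c i * (- app f (v (punchIn p i))) * v p j + c' i * v (punchIn p i) j)
        ≡⟨ sum-cong-≗ (λ i → solve 5 (λ c g w q u → c :* g :* w :+ c :* q :* u := c :* (q :* u :+ g :* w)) refl
             (c i) (- app f (v (punchIn p i))) (v p j) fp (v (punchIn p i) j)) ⟩
      sum (λ i → c i * eliminate f (v p) (v (punchIn p i)) j)
        ≡⟨ e j ⟩
      0ℚ ∎
      where open ≡-Reasoning

  -- Passing to the kernel of f costs one vector: a vector outside the kernel serves as pivot, and
  -- if there is none the first vector is dropped.
  indep-cut : ∀ {n k} (f : Func n) {D : Point n → Set} → Closed (λ _ → ⊤) D → (v : Fin (suc k) → Point n) → (∀ i → D (v i)) → Indep (suc k) v →
    Σ (Fin k → Point n) λ w → (∀ i → D (w i) × app f (w i) ≡ 0ℚ) × Indep k w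
  indep-cut {n} {k} f {D} C v d I = decide (any? λ i → ¬? (app f (v i) ℚₚ.≟ 0ℚ))
    where
    decide : Dec (∃ λ i → ¬ app f (v i) ≡ 0ℚ) → Σ (Fin k → Point n) λ w → (∀ i → D (w i) × app f (w i) ≡ 0ℚ) × Indep k w
    decide (yes (p , h)) = (λ i → eliminate f (v p) (v (punchIn p i))) ,
      (λ i → step C (app f (v p)) tt (d (punchIn p i)) (step C (- app f (v (punchIn p i))) tt (d p) (at-0 C (λ _ → refl)) (λ j → sym (+-identityʳ _))) (λ _ → refl)
           , app-eliminate f (v p) (v (punchIn p i))) , indep-eliminate f v p h I
    decide (no h) = v ∘ suc , (λ i → d (suc i) , decidable-stable (app f (v (suc i)) ℚₚ.≟ 0ℚ) λ q → h (suc i , q)) , indep-tail v I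

  HasRank : ∀ {n} → List (Point n) → ℕ → Set
  HasRank {n} vs r = (Σ (Fin r → Point n) λ v → (∀ i → Span vs (v i)) × Indep r v)
    × (∀ (v : Fin (suc r) → Point n) → (∀ i → Span vs (v i)) → ¬ Indep (suc r) v)

  indep-single : ∀ {n} (f : Func n) (v : Fin 1 → Point n) → ¬ app f (v zero) ≡ 0ℚ → Indep 1 v
  indep-single f v h c e zero = *-cancelˡ-≢0 h (trans (*-comm (app f (v zero)) (c zero))
    (trans (sym (+-identityʳ (c zero * app f (v zero)))) (trans (sym (app-combination f 1 c v)) (app-0 f e))))

  -- Elimination bounds the new rank from below; from above, u lies outside the kernel of f and so
  -- extends every independent family of the cut by one. The exact drop by one is what changes the
  -- sign of the Euler characteristic.
  rank-cut : ∀ {n r} (f : Func n) {vs ws : List (Point n)} → HasRank vs r →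
    (∀ x → Span ws x → Span vs x × app f x ≡ 0ℚ) → (∀ x → Span vs x → app f x ≡ 0ℚ → Span ws x) →
    ∀ {u} → Span vs u → ¬ app f u ≡ 0ℚ → Σ ℕ λ r' → r ≡ suc r' × HasRank ws r'
  rank-cut {r = zero} f (_ , up) _ _ {u} su h = ⊥-elim (up (λ _ → u) (λ _ → su) (indep-single f (λ _ → u) h))
  rank-cut {r = suc r} f ((v , sv , I) , up) to from {u} su h = r , refl ,
    (let w , dw , J = indep-cut f span-closed v sv I in w , (λ i → from (w i) (proj₁ (dw i)) (proj₂ (dw i))) , J) ,
    λ w sw J → up (u ◂ w) (λ { zero → su ; (suc i) → proj₁ (to (w i) (sw i)) }) (indep-◂ f h (λ i → proj₂ (to (w i) (sw i))) J)

  -- The basis consists of listed vectors, not merely of vectors in the span: `dim⇒rank` has to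
  -- apply `HasDim`, which speaks of points of the polytope only.
  SpanBasis : ∀ {n} → List (Point n) → Set
  SpanBasis {n} vs = Σ ℕ λ r → (Σ (Fin r → Point n) λ v → (∀ i → v i ∈ vs) × Indep r v)
    × (∀ (v : Fin (suc r) → Point n) → (∀ i → Span vs (v i)) → ¬ Indep (suc r) v)

  span-basis-dependent : ∀ {n} {v : Point n} {vs} → Span vs v → SpanBasis vs → SpanBasis (v ∷ vs)
  span-basis-dependent s (r , (b , m , I) , up) = r , (b , (λ i → there (m i)) , I) ,
    λ w sw → up w λ i → comb-closed span-closed (s ∷ All.tabulate span-∈) (sw i)

  span-basis-independent : ∀ {n} {v : Point n} {vs} (f : Func n) → All (λ u → app f u ≡ 0ℚ) vs → app f v ≡ 1ℚ → SpanBasis vs → SpanBasis (v ∷ vs)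
  span-basis-independent {n} {v} {vs} f z o (r , (b , m , I) , up) = suc r ,
    (v ◂ b , (λ { zero → here refl ; (suc i) → there (m i) }) , indep-◂ f (λ e → 1≢0 (trans (sym o) e)) (λ i → All.lookup z (m i)) I) ,
    λ w sw J → let w' , d , J' = indep-cut f span-closed w sw J in up w' (λ i → drop (proj₁ (d i)) (proj₂ (d i))) J'
    where
    drop : ∀ {x} → Span (v ∷ vs) x → app f x ≡ 0ℚ → Span vs x
    drop {x} (cons c y _ p e) fx = comb-cong (λ j → trans (e j) (trans (cong (λ c → c * v j + y j) c≡0) (trans (cong (_+ y j) (*-zeroˡ (v j))) (+-identityˡ (y j))))) p
      where
      c≡0 : c ≡ 0ℚ
      c≡0 = trans (sym (trans (lin f c e) (trans (cong₂ (λ a b → c * a + b) o (comb-closed (ker-closed f) z p)) (trans (+-identityʳ (c * 1ℚ)) (*-identityʳ c))))) fx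

  no-indep-in-0 : ∀ {n} (v : Fin 1 → Point n) → (∀ j → v zero j ≡ 0ℚ) → ¬ Indep 1 v
  no-indep-in-0 v e I = 1≢0 (I (λ _ → 1ℚ) (λ j → cong (λ a → 1ℚ * a + 0ℚ) (e j)) zero)

  rank-[] : ∀ {n} → HasRank {n} [] 0
  rank-[] = ((λ ()) , (λ ()) , λ _ _ ()) , λ v s → no-indep-in-0 v (at0 (s zero))
    where
    at0 : ∀ {x} → Span [] x → ∀ j → x j ≡ 0ℚ
    at0 (nil e) = e

  span-basis : ∀ {n} (vs : List (Point n)) → SpanBasis vs
  span-basis [] = 0 , ((λ ()) , (λ ()) , λ _ _ ()) , proj₂ rank-[]
  span-basis (v ∷ vs) = [ (λ s → span-basis-dependent s (span-basis vs)) , (λ (f , z , o) → span-basis-independent f z o (span-basis vs)) ]′ (span-or-separated vs v)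

-- Sums over lists and over the fibres of a key.

module ListSum where

  open import Data.Integer using (ℤ; 0ℤ; 1ℤ; _+_; _*_; -_)
  open import Data.Integer.Properties
  open import Data.Integer.Solver
  open +-*-Solver
  open import Data.Bool using (if_then_else_)
  open import Data.Nat using (suc; _<_; s≤s)
  import Data.Nat.Properties as ℕₚ
  open import Data.List using (List; []; _∷_; map; length; filter)
  open import Data.List.Properties using (filter-notAll)
  open import Data.List.Relation.Unary.All as All using (All; []; _∷_)
  open import Data.List.Relation.Unary.Any using (here)
  open import Relation.Nullary using (¬_; Dec; yes; no; does; ¬?)
  open import Relation.Nullary.Decidable using (dec-true; dec-false)
  open import Relation.Binary.Definitions using (DecidableEquality)
  open import Relation.Binary.PropositionalEquality

  𝟙 : ∀ {P : Set} → Dec P → ℤ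
  𝟙 d = if does d then 1ℤ else 0ℤ

  𝟙-yes : ∀ {P : Set} (d : Dec P) → P → 𝟙 d ≡ 1ℤ
  𝟙-yes d p = cong (if_then 1ℤ else 0ℤ) (dec-true d p)

  𝟙-no : ∀ {P : Set} (d : Dec P) → ¬ P → 𝟙 d ≡ 0ℤ
  𝟙-no d p = cong (if_then 1ℤ else 0ℤ) (dec-false d p)

  𝟙-cong : ∀ {P Q : Set} (d : Dec P) (e : Dec Q) → (P → Q) → (Q → P) → 𝟙 d ≡ 𝟙 e
  𝟙-cong (yes p) e f g = sym (𝟙-yes e (f p))
  𝟙-cong (no p) e f g = sym (𝟙-no e λ q → p (g q))

  module _ {A : Set} where

    sumL : (A → ℤ) → List A → ℤ
    sumL f [] = 0ℤ
    sumL f (x ∷ xs) = f x + sumL f xs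

    sumL-cong : ∀ {f g : A → ℤ} {xs} → All (λ x → f x ≡ g x) xs → sumL f xs ≡ sumL g xs
    sumL-cong [] = refl
    sumL-cong (e ∷ es) = cong₂ _+_ e (sumL-cong es)

    sumL-ext : ∀ {f g : A → ℤ} → (∀ x → f x ≡ g x) → ∀ xs → sumL f xs ≡ sumL g xs
    sumL-ext e xs = sumL-cong (All.universal e xs)

    sumL-zero : ∀ xs {f : A → ℤ} → All (λ x → f x ≡ 0ℤ) xs → sumL f xs ≡ 0ℤ
    sumL-zero [] [] = refl
    sumL-zero (x ∷ xs) (e ∷ es) = trans (cong₂ _+_ e (sumL-zero xs es)) refl

    sumL-+ : ∀ (f g : A → ℤ) xs → sumL (λ x → f x + g x) xs ≡ sumL f xs + sumL g xs
    sumL-+ f g [] = refl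
    sumL-+ f g (x ∷ xs) = trans (cong (f x + g x +_) (sumL-+ f g xs))
      (solve 4 (λ a b c d → a :+ b :+ (c :+ d) := a :+ c :+ (b :+ d)) refl (f x) (g x) (sumL f xs) (sumL g xs))

    sumL-*ˡ : ∀ c (f : A → ℤ) xs → sumL (λ x → c * f x) xs ≡ c * sumL f xs
    sumL-*ˡ c f [] = sym (*-zeroʳ c)
    sumL-*ˡ c f (x ∷ xs) = trans (cong (c * f x +_) (sumL-*ˡ c f xs)) (sym (*-distribˡ-+ c (f x) (sumL f xs)))

    sumL-neg : ∀ (f : A → ℤ) xs → sumL (λ x → - f x) xs ≡ - sumL f xs
    sumL-neg f [] = refl
    sumL-neg f (x ∷ xs) = trans (cong (- f x +_) (sumL-neg f xs)) (sym (neg-distrib-+ (f x) (sumL f xs)))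

  sumL-map : ∀ {A B : Set} (h : B → A) (f : A → ℤ) xs → sumL f (map h xs) ≡ sumL (λ x → f (h x)) xs
  sumL-map h f [] = refl
  sumL-map h f (x ∷ xs) = cong (f (h x) +_) (sumL-map h f xs)

  module _ {A K : Set} (_≟_ : DecidableEquality K) (C : A → ℤ) (key : A → K) where

    private
      others : K → List A → List A
      others κ = filter (λ x → ¬? (key x ≟ κ))

      split-at : ∀ κ (g : K → ℤ) xs →
        sumL (λ x → C x * g (key x)) xs ≡ g κ * sumL (λ x → C x * 𝟙 (key x ≟ κ)) xs + sumL (λ x → C x * g (key x)) (others κ xs)
      split-at κ g [] = trans (sym (*-zeroʳ (g κ))) (sym (+-identityʳ (g κ * 0ℤ)))
      split-at κ g (x ∷ xs) with key x ≟ κ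
      ... | yes refl = trans (cong (C x * g (key x) +_) (split-at κ g xs))
        (solve 4 (λ c g s r → c :* g :+ (g :* s :+ r) := g :* (c :* con 1ℤ :+ s) :+ r) refl
           (C x) (g (key x)) (sumL (λ x → C x * 𝟙 (key x ≟ κ)) xs) (sumL (λ x → C x * g (key x)) (others κ xs)))
      ... | no _ = trans (cong (C x * g (key x) +_) (split-at κ g xs))
        (solve 5 (λ c h g s r → c :* h :+ (g :* s :+ r) := g :* (c :* con 0ℤ :+ s) :+ (c :* h :+ r)) refl
           (C x) (g (key x)) (g κ) (sumL (λ x → C x * 𝟙 (key x ≟ κ)) xs) (sumL (λ x → C x * g (key x)) (others κ xs)))

      go : ∀ m xs → length xs < m → (∀ κ → sumL (λ x → C x * 𝟙 (key x ≟ κ)) xs ≡ 0ℤ) →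
        ∀ (g : K → ℤ) → sumL (λ x → C x * g (key x)) xs ≡ 0ℤ
      go (suc m) [] _ _ _ = refl
      go (suc m) (x ∷ xs) (s≤s l) h g = begin
        sumL (λ y → C y * g (key y)) (x ∷ xs)
          ≡⟨ split-at κ g (x ∷ xs) ⟩
        g κ * sumL (λ y → C y * 𝟙 (key y ≟ κ)) (x ∷ xs) + sumL (λ y → C y * g (key y)) (others κ (x ∷ xs))
          ≡⟨ cong₂ (λ a b → g κ * a + b) (h κ) (go m (others κ (x ∷ xs)) shorter rest g) ⟩
        g κ * 0ℤ + 0ℤ
          ≡⟨ +-identityʳ (g κ * 0ℤ) ⟩
        g κ * 0ℤ
          ≡⟨ *-zeroʳ (g κ) ⟩
        0ℤ ∎
        where
        open ≡-Reasoning
        κ : K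
        κ = key x
        shorter : length (others κ (x ∷ xs)) < m
        shorter = ℕₚ.<-≤-trans (filter-notAll (λ y → ¬? (key y ≟ κ)) (x ∷ xs) (here λ ne → ne refl)) l
        rest : ∀ κ' → sumL (λ y → C y * 𝟙 (key y ≟ κ')) (others κ (x ∷ xs)) ≡ 0ℤ
        rest κ' = begin
          sumL (λ y → C y * 𝟙 (key y ≟ κ')) (others κ (x ∷ xs))
            ≡⟨ sym (+-identityˡ (sumL (λ y → C y * 𝟙 (key y ≟ κ')) (others κ (x ∷ xs)))) ⟩
          0ℤ + sumL (λ y → C y * 𝟙 (key y ≟ κ')) (others κ (x ∷ xs))
            ≡⟨ cong (_+ sumL (λ y → C y * 𝟙 (key y ≟ κ')) (others κ (x ∷ xs))) (sym (trans (cong (𝟙 (κ ≟ κ') *_) (h κ)) (*-zeroʳ (𝟙 (κ ≟ κ'))))) ⟩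
          𝟙 (κ ≟ κ') * sumL (λ y → C y * 𝟙 (key y ≟ κ)) (x ∷ xs) + sumL (λ y → C y * 𝟙 (key y ≟ κ')) (others κ (x ∷ xs))
            ≡⟨ sym (split-at κ (λ k → 𝟙 (k ≟ κ')) (x ∷ xs)) ⟩
          sumL (λ y → C y * 𝟙 (key y ≟ κ')) (x ∷ xs)
            ≡⟨ h κ' ⟩
          0ℤ ∎

    -- The fibre of the first key contributes g κ times a zero sum. Removing it preserves the
    -- hypothesis for all keys and shortens the list, whose length is the measure of the recursion.
    fiber-sums : ∀ xs → (∀ κ → sumL (λ x → C x * 𝟙 (key x ≟ κ)) xs ≡ 0ℤ) → ∀ (g : K → ℤ) → sumL (λ x → C x * g (key x)) xs ≡ 0ℤ
    fiber-sums xs = go (suc (length xs)) xs ℕₚ.≤-refl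

-- Combinatorial Euler characteristic, ranges of functionals and level sections.

module Euler where

  open import Defs using (Point; sign)
  open Lin
  open Stiemke
  open Rank using (HasRank; rank-[])
  open ListSum
  open import Data.Nat using (ℕ; suc)
  open import Data.Fin using (zero)
  open import Data.Integer using (ℤ; 0ℤ; 1ℤ)
  import Data.Integer as ℤ
  open import Data.Rational
  open import Data.Rational.Properties
  open import Data.Rational.Solver
  open +-*-Solver
  open import Data.Empty using (⊥-elim)
  open import Data.List using (List; []; _∷_)
  open import Data.List.Membership.Propositional using (_∈_)
  open import Data.List.Relation.Unary.Any using (here; there)
  open import Data.List.Relation.Unary.All as All using (All; []; _∷_)
  open import Data.Product using (Σ; _×_; _,_; proj₁; proj₂)
  open import Data.Sum using (inj₁; inj₂)
  open import Relation.Nullary using (¬_; Dec; yes; no)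
  open import Relation.Nullary.Decidable using (_×-dec_)
  open import Relation.Binary using (Tri; tri<; tri≈; tri>)
  open import Relation.Binary.PropositionalEquality

  -- Let f have range [a,b] on a relatively open polytope. The fibre of f over t has
  -- one dimension less if a < t < b, is everything if a = b = t, and is empty
  -- otherwise; φ is the resulting factor between the Euler characteristics.
  φ : ℚ → ℚ → ℚ → ℤ
  φ a b t = 𝟙 ((a ≟ t) ×-dec (b ≟ t)) ℤ.- 𝟙 ((a <? t) ×-dec (t <? b))

  φ-in : ∀ a b t → a < t → t < b → φ a b t ≡ ℤ.- 1ℤ
  φ-in a b t p q = cong₂ ℤ._-_ (𝟙-no ((a ≟ t) ×-dec (b ≟ t)) λ (e , _) → <-irrefl e p) (𝟙-yes ((a <? t) ×-dec (t <? b)) (p , q))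

  φ-pt : ∀ a b t → a ≡ t → b ≡ t → φ a b t ≡ 1ℤ
  φ-pt a b t p q = cong₂ ℤ._-_ (𝟙-yes ((a ≟ t) ×-dec (b ≟ t)) (p , q)) (𝟙-no ((a <? t) ×-dec (t <? b)) λ (l , _) → <-irrefl p l)

  φ-out : ∀ a b t → ¬ (a ≡ t × b ≡ t) → ¬ (a < t × t < b) → φ a b t ≡ 0ℤ
  φ-out a b t p q = cong₂ ℤ._-_ (𝟙-no ((a ≟ t) ×-dec (b ≟ t)) p) (𝟙-no ((a <? t) ×-dec (t <? b)) q)

  -- The hypotheses say that neither endpoint lies in the interval from t' up to but excluding t.
  -- For a < b the fibre is empty over a and below, nonempty strictly between a and b, and empty
  -- from b on, so lowering t to t' alters φ only at t = b; for a = b it is altered only there as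
  -- well.
  φ-jump : ∀ a b t t' → a ≤ b → t' < t → (a < t → a < t') → (b < t → b < t') →
    φ a b t ℤ.- φ a b t' ≡ 𝟙 (b ≟ t)
  φ-jump a b t t' a≤b t'<t ha hb = by (<-cmp b t) (<-cmp a t)
    where
    Goal : Set
    Goal = φ a b t ℤ.- φ a b t' ≡ 𝟙 (b ≟ t)
    value : ∀ {k l} → φ a b t ≡ k → φ a b t' ≡ l → 𝟙 (b ≟ t) ≡ k ℤ.- l → Goal
    value p q r = trans (cong₂ ℤ._-_ p q) (sym r)
    by : Tri (b < t) (b ≡ t) (t < b) → Tri (a < t) (a ≡ t) (t < a) → Goal
    by (tri< b<t _ _) _ = value
      (φ-out a b t (λ (_ , e) → <-irrefl e b<t) (λ (_ , l) → <-asym b<t l))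
      (φ-out a b t' (λ (_ , e) → <-irrefl e (hb b<t)) (λ (_ , l) → <-asym (hb b<t) l))
      (𝟙-no (b ≟ t) λ e → <-irrefl e b<t)
    by (tri≈ _ b≡t _) (tri< a<t _ _) = value
      (φ-out a b t (λ (e , _) → <-irrefl e a<t) (λ (_ , l) → <-irrefl (sym b≡t) l))
      (φ-in a b t' (ha a<t) (subst (t' <_) (sym b≡t) t'<t))
      (𝟙-yes (b ≟ t) b≡t)
    by (tri≈ _ b≡t _) (tri≈ _ a≡t _) = value
      (φ-pt a b t a≡t b≡t)
      (φ-out a b t' (λ (e , _) → <-irrefl (trans (sym e) a≡t) t'<t) (λ (l , _) → <-asym t'<t (subst (_< t') a≡t l)))
      (𝟙-yes (b ≟ t) b≡t)
    by (tri≈ _ b≡t _) (tri> _ _ t<a) = ⊥-elim (<-irrefl (sym b≡t) (<-≤-trans t<a a≤b))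
    by (tri> _ _ t<b) (tri< a<t _ _) = value
      (φ-in a b t a<t t<b) (φ-in a b t' (ha a<t) (<-trans t'<t t<b)) (𝟙-no (b ≟ t) λ e → <-irrefl (sym e) t<b)
    by (tri> _ _ t<b) (tri≈ _ a≡t _) = value
      (φ-out a b t (λ (_ , e) → <-irrefl (sym e) t<b) (λ (l , _) → <-irrefl a≡t l))
      (φ-out a b t' (λ (e , _) → <-irrefl (trans (sym e) a≡t) t'<t) (λ (l , _) → <-asym t'<t (subst (_< t') a≡t l)))
      (𝟙-no (b ≟ t) λ e → <-irrefl (sym e) t<b)
    by (tri> _ _ t<b) (tri> _ _ t<a) = value
      (φ-out a b t (λ (_ , e) → <-irrefl (sym e) t<b) (λ (l , _) → <-asym t<a l))
      (φ-out a b t' (λ (e , _) → <-irrefl (sym e) (<-trans t'<t t<a)) (λ (l , _) → <-asym (<-trans t'<t t<a) l))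
      (𝟙-no (b ≟ t) λ e → <-irrefl (sym e) t<b)

  below-all : ∀ (cs : List ℚ) t → Σ ℚ λ t' → t' < t × All (λ c → c < t → c < t') cs
  below-all [] t = t - 1ℚ , 0<⇒< (subst (0ℚ <_) (solve 1 (λ t → con 1ℚ := t :- (t :- con 1ℚ)) refl t) 0<1) , []
  below-all (c ∷ cs) t = let t' , l , a = below-all cs t in decide t' l a (c <? t)
    where
    decide : ∀ t' → t' < t → All (λ c → c < t → c < t') cs → Dec (c < t) → Σ ℚ λ t' → t' < t × All (λ c → c < t → c < t') (c ∷ cs)
    decide t' l a (no p) = t' , l , (λ q → ⊥-elim (p q)) ∷ a
    decide t' l a (yes p) = let m , lo , hi = <-dense {t' ⊔ c} {t} (⊔-lub-< l p) in
      m , hi , (λ _ → ≤-<-trans (p≤q⊔p t' c) lo) ∷ All.map (λ f q → <-trans (f q) (≤-<-trans (p≤p⊔q t' c) lo)) a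
      where
      ⊔-lub-< : t' < t → c < t → t' ⊔ c < t
      ⊔-lub-< x y with ≤-total t' c
      ... | inj₁ h = subst (_< t) (sym (p≤q⇒p⊔q≡q h)) y
      ... | inj₂ h = subst (_< t) (sym (p≥q⇒p⊔q≡p h)) x

  module _ {n : ℕ} where

    weight : Func (suc n)
    weight = ev zero

    -- The equation f = t on the hyperplane of weight one, made homogeneous.
    level : Func (suc n) → ℚ → Func (suc n)
    level f t = comb₂ 1ℚ f (- t) weight

  -- An item stands for the relatively open polytope of all x with (1 , x) a positive
  -- combination of the generators, whose coordinate zero is a homogenising weight;
  -- the rank is the dimension plus one.
  record Item (n : ℕ) : Set where
    field
      coef : ℤ
      gens : List (Point (suc n))
      weight>0 : All (λ v → 0ℚ < v zero) gens
      rnk : ℕ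
      hasRank : HasRank gens rnk
  open Item public

  -- With r one more than the dimension d this is minus (-1)^d, a uniform sign that drops out of
  -- linear relations. The empty list needs its own value: it stands for the empty polytope,
  -- although its rank 0 would give 1.
  eulG : ∀ {n} → List (Point n) → ℕ → ℤ
  eulG [] r = 0ℤ
  eulG (_ ∷ _) r = sign r

  eul : ∀ {n} → Item n → ℤ
  eul i = eulG (gens i) (rnk i)

  mem : ∀ {n} → Point (suc n) → Item n → ℤ
  mem x i = 𝟙 (pos-dec (gens i) x)

  -- A generator v represents the point v / v zero, and the comparison with the bound at that point
  -- is multiplied out by the weight.
  IsMax IsMin : ∀ {n} → Func (suc n) → List (Point (suc n)) → ℚ → Set
  IsMax f vs b = All (λ v → app f v ≤ b * v zero) vs × Σ (Point _) λ m → m ∈ vs × app f m ≡ b * m zero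
  IsMin f vs a = All (λ v → a * v zero ≤ app f v) vs × Σ (Point _) λ m → m ∈ vs × app f m ≡ a * m zero

  ratio-of : ∀ a {w} → 0ℚ < w → Σ ℚ λ b → a ≡ b * w
  ratio-of a {w} p = let i , _ , ie = inverse p in a * i ,
    sym (trans (*-assoc a i w) (trans (cong (a *_) ie) (*-identityʳ a)))

  multiple-≤ : ∀ {a b c w} → 0ℚ < w → b < c → a ≤ b * w → a ≤ c * w
  multiple-≤ {a} {b} {c} {w} p h q = ≤-trans q (*-monoʳ-≤-nonNeg w {{pos⇒nonNeg w {{positive p}}}} (<⇒≤ h))

  <-cancel : ∀ {a b w} → 0ℚ < w → a * w < b * w → a < b
  <-cancel {a} {b} {w} p h = *-cancelʳ-<-nonNeg w {{pos⇒nonNeg w {{positive p}}}} h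

  max-step : ∀ {n} (f : Func (suc n)) v u vs → All (λ v → 0ℚ < v zero) (v ∷ u ∷ vs) →
    Σ ℚ (IsMax f (v ∷ vs)) → Σ ℚ (IsMax f (v ∷ u ∷ vs))
  max-step f v u vs (w ∷ p ∷ ps) (b , (q ∷ qs) , m , k , e) = decide (app f u ≤? b * u zero) (ratio-of (app f u) p)
    where
    keep : m ∈ (v ∷ vs) → m ∈ (v ∷ u ∷ vs)
    keep (here x) = here x
    keep (there x) = there (there x)
    decide : Dec (app f u ≤ b * u zero) → (Σ ℚ λ c → app f u ≡ c * u zero) → Σ ℚ (IsMax f (v ∷ u ∷ vs))
    decide (yes h) _ = b , q ∷ h ∷ qs , m , keep k , e
    decide (no h) (c , ce) = c , multiple-≤ w b<c q ∷ ≤-reflexive ce ∷ All.zipWith (λ (w , q) → multiple-≤ w b<c q) (ps , qs) ,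
        u , there (here refl) , ce
      where
      b<c : b < c
      b<c = <-cancel p (subst (b * u zero <_) ce (≰⇒> h))

  max-exists : ∀ {n} (f : Func (suc n)) v vs → All (λ v → 0ℚ < v zero) (v ∷ vs) → Σ ℚ (IsMax f (v ∷ vs))
  max-exists f v [] (w ∷ []) = let b , e = ratio-of (app f v) w in b , ≤-reflexive e ∷ [] , v , here refl , e
  max-exists f v (u ∷ vs) (w ∷ p ∷ ps) = max-step f v u vs (w ∷ p ∷ ps) (max-exists f v vs (w ∷ ps))

  neg-multiple-≤ : ∀ a b w → - a ≤ b * w → (- b) * w ≤ a
  neg-multiple-≤ a b w h = subst₂ _≤_ (neg-distribˡ-* b w) (solve 1 (λ a → :- (:- a) := a) refl a) (neg-antimono-≤ h)

  neg-multiple-≡ : ∀ a b w → - a ≡ b * w → a ≡ (- b) * w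
  neg-multiple-≡ a b w h = trans (solve 1 (λ a → a := :- (:- a)) refl a) (trans (cong -_ h) (neg-distribˡ-* b w))

  min-of-max : ∀ {n} (f : Func (suc n)) vs → Σ ℚ (IsMax (negF f) vs) → Σ ℚ (IsMin f vs)
  min-of-max f vs (b , al , m , k , e) = - b , All.map (λ {u} → neg-multiple-≤ (app f u) b (u zero)) al , m , k , neg-multiple-≡ (app f m) b (m zero) e

  min-exists : ∀ {n} (f : Func (suc n)) v vs → All (λ v → 0ℚ < v zero) (v ∷ vs) → Σ ℚ (IsMin f (v ∷ vs))
  min-exists f v vs ws = min-of-max f (v ∷ vs) (max-exists (negF f) v vs ws)

  -- The value 0 on the empty list is a default; such an item has Euler characteristic 0 and never
  -- contributes.
  hiG loG : ∀ {n} → Func (suc n) → (vs : List (Point (suc n))) → All (λ v → 0ℚ < v zero) vs → ℚ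
  hiG f [] _ = 0ℚ
  hiG f (v ∷ vs) w = proj₁ (max-exists f v vs w)
  loG f [] _ = 0ℚ
  loG f (v ∷ vs) w = proj₁ (min-exists f v vs w)

  hi lo : ∀ {n} → Func (suc n) → Item n → ℚ
  hi f i = hiG f (gens i) (weight>0 i)
  lo f i = loG f (gens i) (weight>0 i)

  ≤-of-attained : ∀ a b c w → 0ℚ < w → c ≤ b * w → c ≡ a * w → a ≤ b
  ≤-of-attained a b c w p h e = *-cancelʳ-≤-pos w {{positive p}} (subst (_≤ b * w) e h)

  max-≤ : ∀ {n} (f : Func (suc n)) {vs a b} → All (λ v → 0ℚ < v zero) vs → IsMax f vs a → IsMax f vs b → a ≤ b
  max-≤ f {a = a} {b} w (_ , m , k , e) (h , _) = ≤-of-attained a b (app f m) (m zero) (All.lookup w k) (All.lookup h k) e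

  max-unique : ∀ {n} (f : Func (suc n)) {vs a b} → All (λ v → 0ℚ < v zero) vs → IsMax f vs a → IsMax f vs b → a ≡ b
  max-unique f w p q = ≤-antisym (max-≤ f w p q) (max-≤ f w q p)

  min-≤-max : ∀ {n} (f : Func (suc n)) {vs a b} → All (λ v → 0ℚ < v zero) vs → IsMin f vs a → IsMax f vs b → a ≤ b
  min-≤-max f {a = a} {b} w (_ , m , k , e) (h , _) = ≤-of-attained a b (app f m) (m zero) (All.lookup w k) (All.lookup h k) e

  lo≤hiG : ∀ {n} (f : Func (suc n)) vs w → loG f vs w ≤ hiG f vs w
  lo≤hiG f [] w = ≤-refl
  lo≤hiG f (v ∷ vs) w = min-≤-max f w (proj₂ (min-exists f v vs w)) (proj₂ (max-exists f v vs w))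

  app-level : ∀ {n} (f : Func (suc n)) t v → app (level f t) v ≡ app f v - t * v zero
  app-level f t v = solve 3 (λ a t w → con 1ℚ :* a :+ (:- t) :* w := a :- t :* w) refl (app f v) t (v zero)

  level-0 : ∀ {n} (f : Func (suc n)) t {v} → app (level f t) v ≡ 0ℚ → app f v ≡ t * v zero
  level-0 f t {v} e = trans (solve 2 (λ a b → a := (a :- b) :+ b) refl (app f v) (t * v zero))
    (trans (cong (_+ t * v zero) (trans (sym (app-level f t v)) e)) (+-identityˡ (t * v zero)))

  level-< : ∀ {n} (f : Func (suc n)) t {v} → app (level f t) v < 0ℚ → app f v < t * v zero
  level-< f t {v} h = 0<⇒< (subst (0ℚ <_) (trans (cong -_ (app-level f t v)) (solve 2 (λ a b → :- (a :- b) := b :- a) refl (app f v) (t * v zero))) (neg-0< h))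

  level-> : ∀ {n} (f : Func (suc n)) t {v} → 0ℚ < app (level f t) v → t * v zero < app f v
  level-> f t {v} h = 0<⇒< (subst (0ℚ <_) (app-level f t v) h)

  -- Membership is compared at weight one, because the empty list still has the origin as a
  -- combination. The last component lets the section inherit any subspace containing the item and
  -- adds the kernel of the level; the induction over slices consumes both.
  Section : ∀ {n} → Func (suc n) → ℚ → Item n → Set
  Section {n} f t i = Σ (Item n) λ s → coef s ≡ coef i × eul s ≡ eul i ℤ.* φ (lo f i) (hi f i) t
    × (∀ (x : Point (suc n)) → x zero ≡ 1ℚ → app (level f t) x ≡ 0ℚ → mem x s ≡ mem x i)
    × All (λ (v : Point (suc n)) → Span (gens i) v × app (level f t) v ≡ 0ℚ) (gens s)

  ¬pos-[] : ∀ {n} {x : Point (suc n)} → x zero ≡ 1ℚ → ¬ Pos [] x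
  ¬pos-[] e (nil z) = 1≢0 (trans (sym e) (z zero))

  section-empty : ∀ {n} (f : Func (suc n)) t (i : Item n) → eul i ℤ.* φ (lo f i) (hi f i) t ≡ 0ℤ →
    (∀ (x : Point (suc n)) → app (level f t) x ≡ 0ℚ → ¬ Pos (gens i) x) → Section f t i
  section-empty f t i e h = record { coef = coef i ; gens = [] ; weight>0 = [] ; rnk = 0 ; hasRank = rank-[] } ,
    refl , sym e , (λ x x₀ z → trans (𝟙-no (pos-dec [] x) (¬pos-[] x₀)) (sym (𝟙-no (pos-dec (gens i) x) (h x z)))) , []

  section-flat : ∀ {n} (f : Func (suc n)) t (i : Item n) → eul i ≡ eul i ℤ.* φ (lo f i) (hi f i) t →
    All (λ (v : Point (suc n)) → app (level f t) v ≡ 0ℚ) (gens i) → Section f t i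
  section-flat f t i e h = i , refl , e , (λ _ _ _ → refl) , All.tabulate λ m → span-∈ m , All.lookup h m

-- Additivity of the Euler characteristic by slicing.

module EulerMain where

  open import Defs using (Point; sign)
  open Lin
  open Cut
  open Stiemke
  open Interior using (pos-extend)
  open Rank using (sum-0; HasRank; rank-cut)
  open ListSum
  open Euler
  open import Data.Nat using (ℕ; zero; suc)
  open import Data.Fin using (zero)
  open import Data.Integer using (ℤ; 0ℤ; 1ℤ)
  import Data.Integer as ℤ
  import Data.Integer.Properties as ℤₚ
  import Data.Integer.Solver as ℤSolver
  open import Data.Rational
  open import Data.Rational.Properties
  open import Data.Rational.Solver
  open +-*-Solver
  open import Data.Empty using (⊥-elim)
  open import Data.List using (List; []; _∷_; _++_; map)
  open import Data.List.Membership.Propositional using (_∈_)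
  open import Data.List.Relation.Unary.Any using (here; there)
  open import Data.List.Relation.Unary.All as All using (All; []; _∷_)
  open import Data.List.Relation.Unary.All.Properties using (++⁺; map⁺; map⁻)
  open import Data.Product using (Σ; _×_; _,_; proj₁; proj₂)
  open import Data.Sum using (_⊎_; inj₁; inj₂; [_,_]′)
  open import Data.Unit using (⊤; tt)
  open import Relation.Nullary using (¬_)
  open import Relation.Binary.PropositionalEquality

  eulG-∈ : ∀ {n} {vs : List (Point n)} {v} r → v ∈ vs → eulG vs r ≡ sign r
  eulG-∈ r (here _) = refl
  eulG-∈ r (there _) = refl

  loG-≤ : ∀ {n} (f : Func (suc n)) vs w {v} → v ∈ vs → loG f vs w * v zero ≤ app f v
  loG-≤ f (u ∷ vs) w k = All.lookup (proj₁ (proj₂ (min-exists f u vs w))) k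

  hiG-≥ : ∀ {n} (f : Func (suc n)) vs w {v} → v ∈ vs → app f v ≤ hiG f vs w * v zero
  hiG-≥ f (u ∷ vs) w k = All.lookup (proj₁ (proj₂ (max-exists f u vs w))) k

  loG-attained : ∀ {n} (f : Func (suc n)) vs w {v} → v ∈ vs → Σ (Point (suc n)) λ m → m ∈ vs × app f m ≡ loG f vs w * m zero
  loG-attained f (u ∷ vs) w k = proj₂ (proj₂ (min-exists f u vs w))

  hiG-attained : ∀ {n} (f : Func (suc n)) vs w {v} → v ∈ vs → Σ (Point (suc n)) λ m → m ∈ vs × app f m ≡ hiG f vs w * m zero
  hiG-attained f (u ∷ vs) w k = proj₂ (proj₂ (max-exists f u vs w))

  lo-below : ∀ {n} (f : Func (suc n)) t vs w {v} → v ∈ vs → app (level f t) v < 0ℚ → loG f vs w < t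
  lo-below f t vs w {v} k h = <-cancel {loG f vs w} {t} {v zero} (All.lookup w k) (≤-<-trans (loG-≤ f vs w k) (level-< f t {v} h))

  hi-above : ∀ {n} (f : Func (suc n)) t vs w {v} → v ∈ vs → 0ℚ < app (level f t) v → t < hiG f vs w
  hi-above f t vs w {v} k h = <-cancel {t} {hiG f vs w} {v zero} (All.lookup w k) (<-≤-trans (level-> f t {v} h) (hiG-≥ f vs w k))

  level-≤ : ∀ {n} (f : Func (suc n)) t v → app (level f t) v ≤ 0ℚ → app f v ≤ t * v zero
  level-≤ f t v h = 0≤⇒≤ (subst (0ℚ ≤_) (trans (cong -_ (app-level f t v)) (solve 2 (λ a b → :- (a :- b) := b :- a) refl (app f v) (t * v zero))) (neg-0≤ h))

  level-≥ : ∀ {n} (f : Func (suc n)) t v → 0ℚ ≤ app (level f t) v → t * v zero ≤ app f v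
  level-≥ f t v h = 0≤⇒≤ (subst (0ℚ ≤_) (app-level f t v) h)

  hi-≤ : ∀ {n} (f : Func (suc n)) t vs w {v} → v ∈ vs → All (λ (v : Point (suc n)) → app (level f t) v ≤ 0ℚ) vs → hiG f vs w ≤ t
  hi-≤ f t vs w k a = let m , k' , e = hiG-attained f vs w k in
    ≤-of-attained (hiG f vs w) t (app f m) (m zero) (All.lookup w k') (level-≤ f t m (All.lookup a k')) e

  lo-≥ : ∀ {n} (f : Func (suc n)) t vs w {v} → v ∈ vs → All (λ (v : Point (suc n)) → 0ℚ ≤ app (level f t) v) vs → t ≤ loG f vs w
  lo-≥ f t vs w k a = let m , k' , e = loG-attained f vs w k in
    *-cancelʳ-≤-pos (m zero) {{positive (All.lookup w k')}} (subst (t * m zero ≤_) e (level-≥ f t m (All.lookup a k')))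

  φ-flat : ∀ {n} (f : Func (suc n)) t vs w r → All (λ (v : Point (suc n)) → app (level f t) v ≡ 0ℚ) vs →
    eulG vs r ≡ eulG vs r ℤ.* φ (loG f vs w) (hiG f vs w) t
  φ-flat f t [] w r a = sym (ℤₚ.*-zeroˡ (φ 0ℚ 0ℚ t))
  φ-flat f t (v ∷ vs) w r a = sym (trans (cong (sign r ℤ.*_) (φ-pt l h t (≤-antisym (≤-trans l≤h h≤t) t≤l) (≤-antisym h≤t (≤-trans t≤l l≤h)))) (ℤₚ.*-identityʳ (sign r)))
    where
    l h : ℚ
    l = loG f (v ∷ vs) w
    h = hiG f (v ∷ vs) w
    l≤h : l ≤ h
    l≤h = lo≤hiG f (v ∷ vs) w
    h≤t : h ≤ t
    h≤t = hi-≤ f t (v ∷ vs) w (here refl) (All.map ≤-reflexive a)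
    t≤l : t ≤ l
    t≤l = lo-≥ f t (v ∷ vs) w (here refl) (All.map (λ e → ≤-reflexive (sym e)) a)

  *φ-out : ∀ e a b t → ¬ (a ≡ t × b ≡ t) → ¬ (a < t × t < b) → e ℤ.* φ a b t ≡ 0ℤ
  *φ-out e a b t p q = trans (cong (e ℤ.*_) (φ-out a b t p q)) (ℤₚ.*-zeroʳ e)

  neg-*-neg1 : ∀ s → (ℤ.- s) ℤ.* (ℤ.- 1ℤ) ≡ s
  neg-*-neg1 s = S.solve 1 (λ s → (S.:- s) S.:* (S.:- S.con 1ℤ) S.:= s) refl s
    where module S = ℤSolver.+-*-Solver

  -- Let x₀ be an interior point of the cut. Then x₀ + δ x is still a positive combination of `vs`
  -- and lies in the kernel, hence in the cut, and x is a difference quotient of the two.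
  mixed-span : ∀ {n} (L : Func n) {vs u N Z v P} → Trip L vs (u ∷ N) Z (v ∷ P) → ∀ (x : Point n) → Span vs x → app L x ≡ 0ℚ →
    Span (cross L (u ∷ N) (v ∷ P) ++ Z) x
  mixed-span L {vs} {u} {N} {Z} {v} {P} t x s e =
    let x₀ , p₀ = pos-total ws
        δ , δ>0 , h = pos-extend {y = x} (cut-from L t p₀) s
        i , _ , ie = inverse δ>0
    in span-lin i (- i) (cut-to L {x = λ j → x₀ j + δ * x j} t (h δ (<⇒≤ δ>0) ≤-refl) (ker δ x₀ (comb-closed (ker-closed L) (cut-ker L t) p₀))) p₀
         (λ j → coords i δ (x₀ j) (x j) ie)
    where
    ws : List (Point _)
    ws = cross L (u ∷ N) (v ∷ P) ++ Z
    ker : ∀ δ x₀ → app L x₀ ≡ 0ℚ → app L (λ j → x₀ j + δ * x j) ≡ 0ℚ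
    ker δ x₀ e₀ = trans (lin L {v = x} {y = x₀} δ (λ j → +-comm (x₀ j) (δ * x j))) (trans (cong₂ (λ a b → δ * a + b) e e₀)
      (trans (+-identityʳ (δ * 0ℚ)) (*-zeroʳ δ)))
    coords : ∀ i δ a b → i * δ ≡ 1ℚ → b ≡ i * (a + δ * b) + (- i) * a
    coords i δ a b ie = trans (sym (*-identityˡ b)) (trans (cong (_* b) (sym ie))
      (solve 4 (λ i δ a b → i :* δ :* b := i :* (a :+ δ :* b) :+ (:- i) :* a) refl i δ a b))

  -- Both signs occur, so t lies strictly inside the range of f and the rank drops by exactly one;
  -- the resulting change of sign is the value -1 of φ.
  section-mixed : ∀ {n} (f : Func (suc n)) t (i : Item n) {u N Z v P} → Trip (level f t) (gens i) (u ∷ N) Z (v ∷ P) → Section f t i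
  section-mixed {n} f t i {u} {N} {Z} {v} {P} tr = build (rank-cut L (hasRank i)
      (λ x s → comb-closed span-closed (cut-span L tr) s , comb-closed (ker-closed L) (cut-ker L tr) s)
      (mixed-span L tr) (span-∈ u∈) λ e → <-irrefl e u<0)
    where
    L : Func (suc n)
    L = level f t
    ws : List (Point (suc n))
    ws = cross L (u ∷ N) (v ∷ P) ++ Z
    u∈ : u ∈ gens i
    u∈ = trip-∈N tr (here refl)
    v∈ : v ∈ gens i
    v∈ = trip-∈P tr (here refl)
    u<0 : app L u < 0ℚ
    u<0 = All.lookup (trip-neg tr) (here refl)
    v>0 : 0ℚ < app L v
    v>0 = All.lookup (trip-pos tr) (here refl)
    W = trip-All⁻ tr (weight>0 i)
    w>0 : All (λ v → 0ℚ < v zero) ws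
    w>0 = ++⁺ (cross-All L (u ∷ N) (v ∷ P) λ k m →
        0<+ (0<* (All.lookup (trip-pos tr) m) (All.lookup (proj₁ W) k))
            (0<* (neg-0< (All.lookup (trip-neg tr) k)) (All.lookup (proj₂ (proj₂ W)) m)))
      (proj₁ (proj₂ W))
    build : (Σ ℕ λ r → rnk i ≡ suc r × HasRank ws r) → Section f t i
    build (r , e , hr) = record { coef = coef i ; gens = ws ; weight>0 = w>0 ; rnk = r ; hasRank = hr } , refl ,
      sym (trans (cong₂ ℤ._*_ (trans (eulG-∈ (rnk i) u∈) (cong sign e))
          (φ-in (lo f i) (hi f i) t (lo-below f t (gens i) (weight>0 i) u∈ u<0) (hi-above f t (gens i) (weight>0 i) v∈ v>0)))
        (neg-*-neg1 (sign r))) ,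
      (λ x _ z → 𝟙-cong (pos-dec ws x) (pos-dec (gens i) x) (cut-from L tr) (λ p → cut-to L tr p z)) ,
      All.zipWith (λ p → p) (cut-span L tr , cut-ker L tr)

  section-trip : ∀ {n} (f : Func (suc n)) t (i : Item n) {N Z P} → Trip (level f t) (gens i) N Z P → Section f t i
  section-trip f t i {[]} {Z} {[]} tr = section-flat f t i (φ-flat f t (gens i) (weight>0 i) (rnk i) a) a
    where
    a : All (λ (v : Point _) → app (level f t) v ≡ 0ℚ) (gens i)
    a = trip-All tr [] (trip-zer tr) []
  section-trip f t i {u ∷ N} {Z} {[]} tr = section-empty f t i
      (*φ-out (eul i) (lo f i) (hi f i) t (λ (e , _) → <-irrefl e l) (λ (_ , h) → <-irrefl refl (<-≤-trans h (hi-≤ f t (gens i) (weight>0 i) u∈ a))))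
      (λ x e p → <-irrefl (sym (trans (cong -_ e) refl)) (pos-strict (negF (level f t)) (All.map neg-0≤ a) u∈ (neg-0< u<0) p))
    where
    u∈ : u ∈ gens i
    u∈ = trip-∈N tr (here refl)
    u<0 : app (level f t) u < 0ℚ
    u<0 = All.lookup (trip-neg tr) (here refl)
    a : All (λ (v : Point _) → app (level f t) v ≤ 0ℚ) (gens i)
    a = trip-All tr (All.map <⇒≤ (trip-neg tr)) (All.map ≤-reflexive (trip-zer tr)) []
    l : lo f i < t
    l = lo-below f t (gens i) (weight>0 i) u∈ u<0
  section-trip f t i {[]} {Z} {v ∷ P} tr = section-empty f t i
      (*φ-out (eul i) (lo f i) (hi f i) t (λ (_ , e) → <-irrefl (sym e) l) (λ (h , _) → <-irrefl refl (<-≤-trans h (lo-≥ f t (gens i) (weight>0 i) v∈ a))))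
      (λ x e p → <-irrefl (sym e) (pos-strict (level f t) a v∈ v>0 p))
    where
    v∈ : v ∈ gens i
    v∈ = trip-∈P tr (here refl)
    v>0 : 0ℚ < app (level f t) v
    v>0 = All.lookup (trip-pos tr) (here refl)
    a : All (λ (v : Point _) → 0ℚ ≤ app (level f t) v) (gens i)
    a = trip-All tr [] (All.map (λ e → ≤-reflexive (sym e)) (trip-zer tr)) (All.map <⇒≤ (trip-pos tr))
    l : t < hi f i
    l = hi-above f t (gens i) (weight>0 i) v∈ v>0
  section-trip f t i {u ∷ N} {Z} {v ∷ P} tr = section-mixed f t i tr

  sectionOf : ∀ {n} (f : Func (suc n)) t (i : Item n) → Section f t i
  sectionOf f t i = let N , Z , P , tr = trip (level f t) (gens i) in section-trip f t i tr

  -- D shrinks with each slice while `fs`, together with the weight, still separates its points.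
  -- With no functional left, D has at most one point of weight one.
  Sep : ∀ {n} → (Point (suc n) → Set) → List (Func (suc n)) → Set
  Sep {n} D fs = ∀ (x y : Point (suc n)) → D x → D y → x zero ≡ y zero → All (λ f → app f x ≡ app f y) fs → ∀ j → x j ≡ y j

  Cancels : ∀ {n} → (Point (suc n) → Set) → List (Item n) → Set
  Cancels {n} D is = ∀ (x : Point (suc n)) → D x → x zero ≡ 1ℚ → sumL (λ i → coef i ℤ.* mem x i) is ≡ 0ℤ

  -- An item inside D is either empty or the single point p. In the latter case it has rank 1,
  -- whence the minus sign.
  point-eul : ∀ {n} {D : Point (suc n) → Set} → Closed (λ _ → ⊤) D → Sep D [] → ∀ (p : Point (suc n)) → D p → p zero ≡ 1ℚ →
    ∀ (i : Item n) → All D (gens i) → eul i ≡ ℤ.- mem p i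
  point-eul {n} {D} C sep p dp p₀ i d = go (gens i) (weight>0 i) (rnk i) (hasRank i) d
    where
    go : ∀ vs → All (λ (v : Point (suc n)) → 0ℚ < v zero) vs → ∀ r → HasRank vs r → All D vs → eulG vs r ≡ ℤ.- 𝟙 (pos-dec vs p)
    go [] w r hr d = cong ℤ.-_ (sym (𝟙-no (pos-dec [] p) (¬pos-[] p₀)))
    go (v ∷ vs) w r hr d = trans (rank1 (rank-cut (weight {n}) {ws = []} hr (λ { x (nil z) → comb-0 (v ∷ vs) tt z , z zero }) zero-span
          (span-∈ (here refl)) (λ e → <-irrefl (sym e) (All.lookup w (here refl))))) (cong ℤ.-_ (sym (𝟙-yes (pos-dec (v ∷ vs) p) isPos)))
      where
      zero-span : ∀ (x : Point (suc n)) → Span (v ∷ vs) x → x zero ≡ 0ℚ → Span [] x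
      zero-span x s e = nil (sep x (λ _ → 0ℚ) (comb-closed C d s) (at-0 C (λ _ → refl)) e [])
      rank1 : (Σ ℕ λ r' → r ≡ suc r' × HasRank [] r') → sign r ≡ ℤ.- 1ℤ
      rank1 (zero , e , _) = cong sign e
      rank1 (suc r' , e , (b , s , I) , _) = ⊥-elim (1≢0 (I (λ _ → 1ℚ) (λ j → sum-0 (suc r') λ k → trans (cong (1ℚ *_) (at0 (s k) j)) refl) zero))
        where
        at0 : ∀ {x} → Span [] x → ∀ j → x j ≡ 0ℚ
        at0 (nil e) = e
      isPos : Pos (v ∷ vs) p
      isPos = let y , q = pos-total (v ∷ vs)
                  y₀>0 = pos-strict (weight {n}) (All.map <⇒≤ w) (here refl) (All.lookup w (here refl)) q
                  k , k>0 , ke = inverse y₀>0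
              in pos-scale k k>0 q (sep p (λ j → k * y j) dp (step C k tt (comb-closed C d (comb⇒span q)) (at-0 C (λ _ → refl)) (λ j → sym (+-identityʳ (k * y j)))) (trans p₀ (sym ke)) [])

  -- If no item has a generator, every term is 0. Otherwise some generator, rescaled to weight one,
  -- is the point at which `Cancels` is evaluated.
  euler-base : ∀ {n} {D : Point (suc n) → Set} → Closed (λ _ → ⊤) D → Sep D [] → ∀ (is : List (Item n)) → All (λ i → All D (gens i)) is →
    Cancels D is → sumL (λ i → coef i ℤ.* eul i) is ≡ 0ℤ
  euler-base {n} {D} C sep is d c = [ (λ (v , dv , v>0) → nonempty v dv v>0) , sumL-zero is ]′ (find is d)
    where
    find : ∀ is → All (λ i → All D (gens i)) is → (Σ (Point (suc n)) λ v → D v × 0ℚ < v zero) ⊎ All (λ i → coef i ℤ.* eul i ≡ 0ℤ) is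
    find [] [] = inj₂ []
    find (i ∷ is) (d ∷ ds) = [ inj₁ , (λ e → [ inj₁ , (λ es → inj₂ (trans (cong (coef i ℤ.*_) e) (ℤₚ.*-zeroʳ (coef i)) ∷ es)) ]′ (find is ds)) ]′ (look (gens i) (weight>0 i) d)
      where
      look : ∀ vs → All (λ (v : Point (suc n)) → 0ℚ < v zero) vs → All D vs → (Σ (Point (suc n)) λ v → D v × 0ℚ < v zero) ⊎ eulG vs (rnk i) ≡ 0ℤ
      look [] _ _ = inj₂ refl
      look (v ∷ _) (w ∷ _) (d ∷ _) = inj₁ (v , d , w)
    nonempty : ∀ v → D v → 0ℚ < v zero → sumL (λ i → coef i ℤ.* eul i) is ≡ 0ℤ
    nonempty v dv v>0 = at (proj₁ inv) (proj₂ (proj₂ inv))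
      where
      inv = inverse v>0
      at : ∀ k → k * v zero ≡ 1ℚ → sumL (λ i → coef i ℤ.* eul i) is ≡ 0ℤ
      at k ke = begin
        sumL (λ i → coef i ℤ.* eul i) is
          ≡⟨ sumL-cong (All.map (λ {i} di → trans (cong (coef i ℤ.*_) (point-eul C sep p dp ke i di)) (sym (ℤₚ.neg-distribʳ-* (coef i) (mem p i)))) d) ⟩
        sumL (λ i → ℤ.- (coef i ℤ.* mem p i)) is
          ≡⟨ sumL-neg (λ i → coef i ℤ.* mem p i) is ⟩
        ℤ.- sumL (λ i → coef i ℤ.* mem p i) is
          ≡⟨ cong ℤ.-_ (c p dp ke) ⟩
        0ℤ ∎
        where
        open ≡-Reasoning
        p : Point (suc n)
        p j = k * v j
        dp : D p
        dp = step C k tt dv (at-0 C (λ _ → refl)) (λ j → sym (+-identityʳ (k * v j)))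

  -- `jump` counts every item at its own maximum, so adding up its relations over all t, by
  -- `fiber-sums` with the constant function 1, gives the total. The recursion through `slice`
  -- consumes one functional.
  euler : ∀ {n} (fs : List (Func (suc n))) {D : Point (suc n) → Set} → Closed (λ _ → ⊤) D → Sep D fs → ∀ (is : List (Item n)) →
    All (λ i → All D (gens i)) is → Cancels D is → sumL (λ i → coef i ℤ.* eul i) is ≡ 0ℤ

  -- The sections at level t again cancel, now inside the kernel of the level, where the weight
  -- determines f; hence the remaining functionals suffice for separation and `euler` applies to
  -- them.
  slice : ∀ {n} (f : Func (suc n)) (fs : List (Func (suc n))) {D : Point (suc n) → Set} → Closed (λ _ → ⊤) D → Sep D (f ∷ fs) → ∀ (is : List (Item n)) →
    All (λ i → All D (gens i)) is → Cancels D is → ∀ t → sumL (λ i → coef i ℤ.* (eul i ℤ.* φ (lo f i) (hi f i) t)) is ≡ 0ℤ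
  slice {n} f fs {D} C sep is d c t = begin
      sumL (λ i → coef i ℤ.* (eul i ℤ.* φ (lo f i) (hi f i) t)) is
        ≡⟨ sumL-ext (λ i → sym (cong₂ ℤ._*_ (proj₁ (proj₂ (sectionOf f t i))) (proj₁ (proj₂ (proj₂ (sectionOf f t i)))))) is ⟩
      sumL (λ i → coef (sec i) ℤ.* eul (sec i)) is
        ≡⟨ sym (sumL-map sec (λ i → coef i ℤ.* eul i) is) ⟩
      sumL (λ i → coef i ℤ.* eul i) (map sec is)
        ≡⟨ euler fs C' sep' (map sec is) (map⁺ (All.map (λ {i} → within i) d)) c' ⟩
      0ℤ ∎
    where
    open ≡-Reasoning
    sec : Item n → Item n
    sec i = proj₁ (sectionOf f t i)
    D' : Point (suc n) → Set
    D' x = D x × app (level f t) x ≡ 0ℚ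
    C' : Closed (λ _ → ⊤) D'
    C' = record { at-0 = λ e → at-0 C e , app-0 (level f t) e
                ; step = λ c _ (d , z) (d' , z') e → step C c tt d d' e , step (ker-closed (level f t)) c tt z z' e }
    sep' : Sep D' fs
    sep' x y (dx , zx) (dy , zy) e a = sep x y dx dy e (trans (level-0 f t {x} zx) (trans (cong (t *_) e) (sym (level-0 f t {y} zy))) ∷ a)
    within : ∀ i → All D (gens i) → All D' (gens (sec i))
    within i di = All.map (λ (s , z) → comb-closed C di s , z) (proj₂ (proj₂ (proj₂ (proj₂ (sectionOf f t i)))))
    c' : Cancels D' (map sec is)
    c' x (dx , z) x₀ = trans (sumL-map sec (λ i → coef i ℤ.* mem x i) is)
      (trans (sumL-ext (λ i → cong₂ ℤ._*_ (proj₁ (proj₂ (sectionOf f t i))) (proj₁ (proj₂ (proj₂ (proj₂ (sectionOf f t i)))) x x₀ z)) is) (c x dx x₀))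

  -- The contribution of an item to the difference of the slices at t and just
  -- below t is nonzero exactly when t is the maximum of f on it.
  jump : ∀ {n} (f : Func (suc n)) (fs : List (Func (suc n))) {D : Point (suc n) → Set} → Closed (λ _ → ⊤) D → Sep D (f ∷ fs) → ∀ (is : List (Item n)) →
    All (λ i → All D (gens i)) is → Cancels D is → ∀ t → sumL (λ i → (coef i ℤ.* eul i) ℤ.* 𝟙 (hi f i ≟ t)) is ≡ 0ℤ
  jump {n} f fs C sep is d c t = with-below (below-all (map (lo f) is) t) (below-all (map (hi f) is) t)
    where
    with-below : (Σ ℚ λ t' → t' < t × All (λ c → c < t → c < t') (map (lo f) is)) → (Σ ℚ λ t' → t' < t × All (λ c → c < t → c < t') (map (hi f) is)) →
      sumL (λ i → (coef i ℤ.* eul i) ℤ.* 𝟙 (hi f i ≟ t)) is ≡ 0ℤ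
    with-below (t₁ , l₁ , a₁) (t₂ , l₂ , a₂) = begin
      sumL (λ i → (coef i ℤ.* eul i) ℤ.* 𝟙 (hi f i ≟ t)) is
        ≡⟨ sumL-cong (All.zipWith (λ {i} → term i) (map⁻ a₁ , map⁻ a₂)) ⟩
      sumL (λ i → A i ℤ.+ ℤ.- B i) is
        ≡⟨ sumL-+ A (λ i → ℤ.- B i) is ⟩
      sumL A is ℤ.+ sumL (λ i → ℤ.- B i) is
        ≡⟨ cong₂ ℤ._+_ (slice f fs C sep is d c t) (trans (sumL-neg B is) (cong ℤ.-_ (slice f fs C sep is d c t'))) ⟩
      0ℤ ∎
      where
      open ≡-Reasoning
      -- The larger of the two thresholds is still below t, and neither a minimum nor a maximum of
      -- an item falls into the gap.
      t' : ℚ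
      t' = t₁ ⊔ t₂
      t'<t : t' < t
      t'<t = [ (λ h → subst (_< t) (sym (p≤q⇒p⊔q≡q h)) l₂) , (λ h → subst (_< t) (sym (p≥q⇒p⊔q≡p h)) l₁) ]′ (≤-total t₁ t₂)
      A B : Item n → ℤ
      A i = coef i ℤ.* (eul i ℤ.* φ (lo f i) (hi f i) t)
      B i = coef i ℤ.* (eul i ℤ.* φ (lo f i) (hi f i) t')
      term : ∀ i → (lo f i < t → lo f i < t₁) × (hi f i < t → hi f i < t₂) → (coef i ℤ.* eul i) ℤ.* 𝟙 (hi f i ≟ t) ≡ A i ℤ.+ ℤ.- B i
      term i (p , q) = trans (cong ((coef i ℤ.* eul i) ℤ.*_) (sym (φ-jump (lo f i) (hi f i) t t' (lo≤hiG f (gens i) (weight>0 i)) t'<t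
          (λ h → <-≤-trans (p h) (p≤p⊔q t₁ t₂)) (λ h → <-≤-trans (q h) (p≤q⊔p t₁ t₂)))))
        (S.solve 4 (λ c e a b → (c S.:* e) S.:* (a S.:+ S.:- b) S.:= c S.:* (e S.:* a) S.:+ S.:- (c S.:* (e S.:* b))) refl
          (coef i) (eul i) (φ (lo f i) (hi f i) t) (φ (lo f i) (hi f i) t'))
        where module S = ℤSolver.+-*-Solver

  euler [] C sep is d c = euler-base C sep is d c
  euler (f ∷ fs) C sep is d c = trans (sumL-ext (λ i → sym (ℤₚ.*-identityʳ (coef i ℤ.* eul i))) is)
    (fiber-sums _≟_ (λ i → coef i ℤ.* eul i) (hi f) is (jump f fs C sep is d c) (λ _ → 1ℤ))

-- Base polytopes as cones over their vertices.

module Polytope where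

  open import Defs
  open Lin
  open Interior
  open Rank
  open import Data.Bool using (true; false)
  open import Data.Nat using (ℕ; zero; suc)
  import Data.Nat as ℕ
  import Data.Nat.Properties as ℕₚ
  open import Data.Fin using (Fin; zero; suc)
  open import Data.Fin.Subset using (Subset)
  open import Data.Fin.Subset.Properties using (_⊆?_)
  open import Data.Rational hiding (_≟_)
  open import Data.Rational.Properties hiding (_≟_)
  open import Data.Rational.Solver
  open +-*-Solver
  open import Data.Vec using ([]; _∷_)
  open import Data.Empty using (⊥; ⊥-elim)
  open import Data.List using (List; []; _∷_; map; filter; tabulate; foldr)
  open import Data.List.Membership.Propositional using (_∈_)
  open import Data.List.Membership.Propositional.Properties using (∈-++⁺ˡ; ∈-++⁺ʳ; ∈-map⁺; ∈-map⁻; ∈-filter⁺; ∈-filter⁻)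
  open import Data.List.Relation.Unary.Any using (here)
  open import Data.List.Relation.Unary.All as All using (All; []; _∷_)
  open import Data.List.Relation.Unary.All.Properties using (map⁺)
  open import Data.Product using (Σ; _×_; _,_; proj₁; proj₂)
  open import Function using (_∘_; id)
  open import Relation.Nullary using (¬_; Dec)
  open import Relation.Nullary.Decidable using (_×-dec_)
  open import Relation.Binary.PropositionalEquality

  sumFin≡sum : ∀ k (f : Fin k → ℚ) → sumFin k f ≡ sum f
  sumFin≡sum k f = go k id
    where
    go : ∀ m (g : Fin m → Fin k) → foldr (λ i q → f i + q) 0ℚ (tabulate g) ≡ sum (f ∘ g)
    go zero g = refl
    go (suc m) g = cong (f (g zero) +_) (go m (g ∘ suc))

  hom : ∀ {n} → Point n → Point (suc n)
  hom = consPt 1ℚ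

  dotF : ∀ {n} → Point n → Func n
  dotF {n} w = record
    { app = λ x → sum (λ j → w j * x j)
    ; lin = λ {x} {v} {y} c e → begin
        sum (λ j → w j * x j)
          ≡⟨ sum-cong-≗ (λ j → trans (cong (w j *_) (e j)) (solve 4 (λ w c v y → w :* (c :* v :+ y) := c :* (w :* v) :+ w :* y) refl (w j) c (v j) (y j))) ⟩
        sum (λ j → c * (w j * v j) + w j * y j)
          ≡⟨ ∑-distrib-+ (λ j → c * (w j * v j)) (λ j → w j * y j) ⟩
        sum (λ j → c * (w j * v j)) + sum (λ j → w j * y j)
          ≡⟨ cong (_+ sum (λ j → w j * y j)) (sym (*-distribˡ-sum c (λ j → w j * v j))) ⟩
        c * sum (λ j → w j * v j) + sum (λ j → w j * y j) ∎ }
    where open ≡-Reasoning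

  dot≡ : ∀ {n} (w x : Point n) → dot w x ≡ app (dotF w) x
  dot≡ {n} w x = sumFin≡sum n (λ j → w j * x j)

  -- `Face` is phrased with `dot`, whereas separation produces abstract functionals; this
  -- translates.
  coefficients : ∀ {n} (f : Func n) → Σ (Point n) λ w → ∀ x → app f x ≡ app (dotF w) x
  coefficients {zero} f = (λ ()) , λ x → app-0 f λ ()
  coefficients {suc n} f = let w , e = coefficients (tailFunc f) in
    consPt (app f e₀) w , λ x → trans (app-head-tail f x) (cong₂ _+_ (*-comm (x zero) (app f e₀)) (e (λ j → x (suc j))))

  allSub-complete : ∀ {n} (X : Subset n) → X ∈ allSub n
  allSub-complete [] = here refl
  allSub-complete {suc n} (true ∷ X) = ∈-++⁺ˡ (∈-map⁺ (true ∷_) (allSub-complete X))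
  allSub-complete {suc n} (false ∷ X) = ∈-++⁺ʳ (map (true ∷_) (allSub n)) (∈-map⁺ (false ∷_) (allSub-complete X))

  isBasis? : ∀ {n} (M : RawMatroid n) B → Dec (IsBasis M B)
  isBasis? M B = (B ⊆? ground M) ×-dec ((Data.Fin.Subset.∣ B ∣ ℕ.≟ rk M B) ×-dec (rk M B ℕ.≟ rank M))

  bases : ∀ {n} → RawMatroid n → List (Subset n)
  bases {n} M = filter (isBasis? M) (allSub n)

  ∈-bases : ∀ {n} (M : RawMatroid n) {B} → IsBasis M B → B ∈ bases M
  ∈-bases M {B} b = ∈-filter⁺ (isBasis? M) (allSub-complete B) b

  vertices : ∀ {n} → RawMatroid n → List (Point (suc n))
  vertices M = map (λ B → hom (indicator B)) (bases M)

  ∈-vertices : ∀ {n} (M : RawMatroid n) {B} → IsBasis M B → hom (indicator B) ∈ vertices M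
  ∈-vertices M b = ∈-map⁺ (λ B → hom (indicator B)) (∈-bases M b)

  ∈-vertices⁻ : ∀ {n} (M : RawMatroid n) {v} → v ∈ vertices M → Σ (Subset n) λ B → IsBasis M B × v ≡ hom (indicator B)
  ∈-vertices⁻ {n} M m = let B , k , e = ∈-map⁻ (λ B → hom (indicator B)) m in B , proj₂ (∈-filter⁻ (isBasis? M) {xs = allSub n} k) , e

  vertices-weight : ∀ {n} (M : RawMatroid n) → All (λ v → 0ℚ < v zero) (vertices M)
  vertices-weight M = map⁺ (All.universal (λ _ → 0<1) (bases M))

  closed-combination-R : ∀ {n R} {D : Point n → Set} → Closed R D → ∀ k c {v} → (∀ i → R (c i)) → (∀ i → D (v i)) → D (combination k c v)
  closed-combination-R C zero c r d = at-0 C λ _ → refl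
  closed-combination-R C (suc k) c r d = step C (c zero) (r zero) (d zero) (closed-combination-R C k (c ∘ suc) (r ∘ suc) (d ∘ suc)) λ _ → refl

  hom-combination : ∀ {n} k (c : Fin k → ℚ) (p : Fin k → Point n) {x} → sumFin k c ≡ 1ℚ → (∀ j → x j ≡ sumFin k (λ i → c i * p i j)) →
    ∀ j → hom x j ≡ combination k c (λ i → hom (p i)) j
  hom-combination k c p e h zero = trans (sym e) (trans (sumFin≡sum k c) (sum-cong-≗ λ i → sym (*-identityʳ (c i))))
  hom-combination k c p e h (suc j) = trans (h j) (sumFin≡sum k (λ i → c i * p i j))

  inP⇒nn : ∀ {n} (M : RawMatroid n) {x} → InP M x → NN (vertices M) (hom x)
  inP⇒nn M (k , bs , c , b , c≥0 , e , h) = comb-cong (hom-combination k c (λ i → indicator (bs i)) e h)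
    (closed-combination-R nn-closed k c c≥0 λ i → nn-∈ (∈-vertices M (b i)))

  Listed : ∀ {n} → RawMatroid n → Point (suc n) → Set
  Listed {n} M y = Σ ℕ λ k → Σ (Fin k → Subset n) λ bs → Σ (Fin k → ℚ) λ c →
    (∀ i → IsBasis M (bs i)) × (∀ i → 0ℚ ≤ c i) × (∀ j → y j ≡ combination k c (λ i → hom (indicator (bs i))) j)

  listed : ∀ {n} (M : RawMatroid n) Bs {y} → All (IsBasis M) Bs → NN (map (λ B → hom (indicator B)) Bs) y → Listed M y
  listed M [] [] (nil e) = 0 , (λ ()) , (λ ()) , (λ ()) , (λ ()) , e
  listed M (B ∷ Bs) {y} (b ∷ bs) (cons c y' r p e) = extend (listed M Bs bs p)
    where
    extend : Listed M y' → Listed M y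
    extend (k , Bs' , c' , b' , r' , e') = suc k , (λ { zero → B ; (suc i) → Bs' i }) , (λ { zero → c ; (suc i) → c' i }) ,
      (λ { zero → b ; (suc i) → b' i }) , (λ { zero → r ; (suc i) → r' i }) ,
      λ j → trans (e j) (cong (c * hom (indicator B) j +_) (e' j))

  nn⇒inP : ∀ {n} (M : RawMatroid n) {x} → NN (vertices M) (hom x) → InP M x
  nn⇒inP {n} M {x} p = from (listed M (bases M) (All.tabulate λ m → proj₂ (∈-filter⁻ (isBasis? M) {xs = allSub n} m)) p)
    where
    from : Listed M (hom x) → InP M x
    from (k , bs , c , b , r , e) = k , bs , c , b , r ,
      trans (sumFin≡sum k c) (trans (sum-cong-≗ λ i → sym (*-identityʳ (c i))) (sym (e zero))) ,
      λ j → trans (e (suc j)) (sym (sumFin≡sum k (λ i → c i * indicator (bs i) j)))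

  basis-inP : ∀ {n} (M : RawMatroid n) {B} → IsBasis M B → InP M (indicator B)
  basis-inP M b = nn⇒inP M (nn-∈ (∈-vertices M b))

  homIndep⇒affIndep : ∀ {n} k (v : Fin k → Point n) → Indep k (λ i → hom (v i)) → AffIndep k v
  homIndep⇒affIndep k v I c e h = I c λ
    { zero → trans (sum-cong-≗ λ i → *-identityʳ (c i)) (trans (sym (sumFin≡sum k c)) e)
    ; (suc j) → trans (sym (sumFin≡sum k (λ i → c i * v i j))) (h j) }

  affIndep⇒homIndep : ∀ {n} k (v : Fin k → Point n) → AffIndep k v → Indep k (λ i → hom (v i))
  affIndep⇒homIndep k v A c e = A c (trans (sumFin≡sum k c) (trans (sum-cong-≗ λ i → sym (*-identityʳ (c i))) (e zero)))
    (λ j → trans (sumFin≡sum k (λ i → c i * v i j)) (e (suc j)))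

  HomP : ∀ {n} → RawMatroid n → Point (suc n) → Set
  HomP {n} M y = Σ (Point n) λ x → InP M x × y ≡ hom x

  indep-bound : ∀ {n} (M : RawMatroid n) {d k} → HasDim M d → (v : Fin k → Point (suc n)) → (∀ i → HomP M (v i)) → Indep k v → k ℕ.≤ suc d
  indep-bound {n} M {d} {k} (_ , up) v h I = ℕₚ.≮⇒≥ λ l → contra (indep-take {D = HomP M} (ℕₚ.≤⇒≤′ l) v h I)
    where
    contra : (Σ (Fin (suc (suc d)) → Point (suc n)) λ w → (∀ i → HomP M (w i)) × Indep (suc (suc d)) w) → ⊥
    contra (w , hw , J) = up (λ i → proj₁ (hw i)) (λ i → proj₁ (proj₂ (hw i)))
      (homIndep⇒affIndep (suc (suc d)) (λ i → proj₁ (hw i)) λ c e → J c λ j →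
        trans (sum-cong-≗ λ i → cong (λ y → c i * y j) (proj₂ (proj₂ (hw i)))) (e j))

  -- The lower bound lifts affinely independent points. For the upper bound, `HasDim` controls
  -- points of the polytope only, so arbitrary vectors of the span are first compared with a basis
  -- chosen among the vertices.
  dim⇒rank : ∀ {n} (M : RawMatroid n) {d} → HasDim M d → HasRank (vertices M) (suc d)
  dim⇒rank {n} M {d} hd@((v , pv , A) , up) =
    ((λ i → hom (v i)) , (λ i → comb⇒span (inP⇒nn M (pv i))) , affIndep⇒homIndep (suc d) v A) ,
    λ w s I → contra (span-basis (vertices M)) w s I
    where
    contra : SpanBasis (vertices M) → (w : Fin (suc (suc d)) → Point (suc n)) → (∀ i → Span (vertices M) (w i)) → ¬ Indep (suc (suc d)) w
    contra (r , (b , m , I) , upr) w s J = at (indep-take {D = Span (vertices M)} (ℕₚ.≤⇒≤′ (ℕ.s≤s r≤)) w s J)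
      where
      inHom : ∀ {v} → v ∈ vertices M → HomP M v
      inHom k = let B , bB , e = ∈-vertices⁻ M k in indicator B , basis-inP M bB , e
      r≤ : r ℕ.≤ suc d
      r≤ = indep-bound M hd b (λ i → inHom (m i)) I
      at : (Σ (Fin (suc r) → Point (suc n)) λ w → (∀ i → Span (vertices M) (w i)) × Indep (suc r) w) → ⊥
      at (w' , s' , J') = upr w' s' J'

  dim-mono : ∀ {n} (M N : RawMatroid n) {d e} → HasDim M d → HasDim N e → (∀ x → InP N x → InP M x) → e ℕ.≤ d
  dim-mono M N {d} {e} hd ((v , pv , A) , _) sub = ℕ.s≤s⁻¹ (indep-bound M hd (λ i → hom (v i)) (λ i → v i , sub (v i) (pv i) , refl) (affIndep⇒homIndep (suc e) v A))

  -- The positive combinations of all vertices form the relative interior: see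
  -- relInt⇒inRelInt and inRelInt⇒relInt.
  RelInt : ∀ {n} → RawMatroid n → Point n → Set
  RelInt M x = Pos (vertices M) (hom x)

  relInt⇒inP : ∀ {n} (M : RawMatroid n) {x} → RelInt M x → InP M x
  relInt⇒inP M p = nn⇒inP M (pos⇒nn p)

  -- The sum of the vertices, rescaled to weight one, is their barycentre; the given point
  -- guarantees that there is a vertex.
  nonempty-center : ∀ {n} (M : RawMatroid n) {x} → InP M x → Σ (Point n) (RelInt M)
  nonempty-center {n} M {x} p = find (vertices M) refl (inP⇒nn M p)
    where
    find : ∀ vs → vertices M ≡ vs → NN vs (hom x) → Σ (Point n) (RelInt M)
    find [] _ (nil e) = ⊥-elim (1≢0 (e zero))
    find (v ∷ vs) eq _ = let y , q = pos-total (vertices M)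
                             v∈ = subst (v ∈_) (sym eq) (here refl)
                             y>0 = pos-strict (ev zero) (All.map <⇒≤ (vertices-weight M)) v∈ (All.lookup (vertices-weight M) v∈) q
                             i , i>0 , ie = inverse y>0
                         in (λ j → i * y (suc j)) , pos-scale i i>0 q λ { zero → sym ie ; (suc j) → refl }

  inAff⇒span : ∀ {n} (M : RawMatroid n) {y} → InAff M y → Span (vertices M) (hom y)
  inAff⇒span M (k , p , c , ip , e , h) = comb-cong (hom-combination k c p e h)
    (closed-combination span-closed k c λ i → comb⇒span (inP⇒nn M (ip i)))

  -- The difference y - x is a small vector of the span, so `pos-interior` keeps x + (y - x) in the
  -- open cone.
  relInt⇒inRelInt : ∀ {n} (M : RawMatroid n) {x} → RelInt M x → InRelInt M x
  relInt⇒inRelInt {n} M {x} p = relInt⇒inP M p , build (pos-interior (vertices M) p)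
    where
    build : Interior (vertices M) (hom x) → Σ ℚ λ ε → (0ℚ < ε) × (∀ y → InAff M y → (∀ j → ∣ y j - x j ∣ < ε) → InP M y)
    build (δ , δ>0 , h) = δ , δ>0 , λ y a b → relInt⇒inP M (comb-cong (λ j → solve 2 (λ x y → y := x :+ (con 1ℚ :* y :+ (:- con 1ℚ) :* x)) refl (hom x j) (hom y j))
      (h (λ j → 1ℚ * hom y j + (- 1ℚ) * hom x j) (span-lin 1ℚ (- 1ℚ) (inAff⇒span M a) (comb⇒span p) (λ _ → refl))
        λ { zero → <⇒≤ δ>0 ; (suc j) → <⇒≤ (subst (λ z → ∣ z ∣ < δ) (solve 2 (λ y x → y :- x := con 1ℚ :* y :+ (:- con 1ℚ) :* x) refl (y j) (x j)) (b j)) }))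

  -- A point of the relative interior is a proper convex combination of the
  -- barycentre and a slightly more distant point of the polytope.
  inRelInt⇒relInt : ∀ {n} (M : RawMatroid n) {z} → InRelInt M z → RelInt M z
  inRelInt⇒relInt {n} M {z} (pz , ε , ε>0 , h) = go (nonempty-center M pz)
    where
    go : Σ (Point n) (RelInt M) → RelInt M z
    go (c , pc) = use (coord-bound n (λ j → z j - c j))
      where
      use : (Σ ℚ λ V → 0ℚ ≤ V × (∀ j → ∣ z j - c j ∣ ≤ V)) → RelInt M z
      use (V , V≥0 , b) = finish (small-below ε V ε>0 V≥0)
        where
        finish : (Σ ℚ λ δ → 0ℚ < δ × (∀ e → e ≤ δ → e * V < ε)) → RelInt M z
        finish (η , η>0 , lt) = combine (inverse {1ℚ + η} (0<+ 0<1 η>0))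
          where
          y : Point n
          y j = z j + η * (z j - c j)
          aff : InAff M y
          aff = 2 , (λ { zero → z ; (suc zero) → c }) , (λ { zero → 1ℚ + η ; (suc zero) → - η }) ,
            (λ { zero → pz ; (suc zero) → relInt⇒inP M pc }) ,
            solve 1 (λ η → (con 1ℚ :+ η) :+ (:- η :+ con 0ℚ) := con 1ℚ) refl η ,
            λ j → solve 3 (λ z c η → z :+ η :* (z :- c) := (con 1ℚ :+ η) :* z :+ ((:- η) :* c :+ con 0ℚ)) refl (z j) (c j) η
          near : ∀ j → ∣ y j - z j ∣ < ε
          near j = ≤-<-trans (subst (λ a → ∣ a ∣ ≤ η * V) (solve 3 (λ z c η → η :* (z :- c) := z :+ η :* (z :- c) :- z) refl (z j) (c j) η)
            (∣∣-bound-* η (z j - c j) V≥0 (≤-reflexive (0≤p⇒∣p∣≡p (<⇒≤ η>0))) (b j))) (lt η ≤-refl)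
          combine : (Σ ℚ λ i → 0ℚ < i × i * (1ℚ + η) ≡ 1ℚ) → RelInt M z
          combine (i , i>0 , ie) = pos-+-nn (pos-scale (i * η) (0<* i>0 η>0) pc (λ _ → refl)) (nn-scale i (<⇒≤ i>0) (inP⇒nn M (h y aff near)) (λ _ → refl))
            λ { zero → sym (trans (solve 2 (λ i η → i :* η :* con 1ℚ :+ i :* con 1ℚ := i :* (con 1ℚ :+ η)) refl i η) ie)
              ; (suc j) → sym (trans (solve 4 (λ i η z c → i :* η :* c :+ i :* (z :+ η :* (z :- c)) := i :* (con 1ℚ :+ η) :* z) refl i η (z j) (c j))
                  (trans (cong (_* z j) ie) (*-identityˡ (z j)))) }

-- Interior cells partition the relative interior; the valuation for one functional.

module Subdivision where

  open import Defs
  open Lin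
  open Stiemke
  open Interior
  open Rank
  open ListSum
  open Euler
  open EulerMain
  open Polytope
  open import Data.Bool using (Bool; true; false; if_then_else_)
  open import Data.Nat using (ℕ; zero; suc; _∸_)
  import Data.Nat as ℕ
  import Data.Nat.Properties as ℕₚ
  open import Data.Nat.Induction using (<-wellFounded)
  open import Induction.WellFounded using (Acc; acc)
  open import Data.Fin using (Fin; zero; suc)
  import Data.Fin as Fin
  import Data.Fin.Properties as Finₚ
  open import Data.Integer using (ℤ; 0ℤ; 1ℤ)
  import Data.Integer as ℤ
  import Data.Integer.Properties as ℤₚ
  import Data.Integer.Solver as ℤSolver
  open import Data.Rational hiding (_≟_)
  open import Data.Rational.Properties hiding (_≟_)
  import Data.Rational.Properties as ℚₚ
  open import Data.Rational.Solver
  open +-*-Solver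
  open import Data.Empty using (⊥; ⊥-elim)
  open import Data.List using (List; []; _∷_; map; tabulate; allFin)
  open import Data.List.Membership.Propositional using (_∈_)
  open import Data.List.Relation.Unary.Any using (here; there)
  open import Data.List.Relation.Unary.All as All using (All; _∷_)
  open import Data.List.Relation.Unary.All.Properties using (tabulate⁻)
  open import Data.Maybe using (Maybe; just; nothing)
  open import Data.Product using (Σ; ∃; _×_; _,_; proj₁; proj₂)
  open import Data.Sum using ([_,_]′)
  open import Data.Unit using (⊤; tt)
  open import Function using (id)
  open import Relation.Nullary using (¬_; Dec; yes; no)
  open import Relation.Binary.Definitions using (DecidableEquality)
  open import Data.List.Properties using (map-tabulate)
  open import Data.List.Relation.Unary.Any using (Any; any?)
  open import Data.List.Membership.Propositional using (find)
  open import Data.List.Relation.Unary.All.Properties using (¬Any⇒All¬)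
  open import Relation.Binary.PropositionalEquality

  -- As x is not a positive combination, the alternative for `opposite x ∷ vs` yields a separating
  -- h. Nonnegativity at x and at its opposite gives h x = 0, so strictness occurs at some vector of
  -- `vs`: the face cut out by h is proper.
  supporting : ∀ {n} (vs : List (Point n)) x → NN vs x → ¬ Pos vs x →
    Σ (Func n) λ h → All (λ v → 0ℚ ≤ app h v) vs × app h x ≡ 0ℚ × Σ (Point n) λ v → v ∈ vs × 0ℚ < app h v
  supporting {n} vs x p np = [ (λ q → ⊥-elim (np (pos-opposite q))) , sep ]′ (stiemke (opposite x ∷ vs))
    where
    sep : (Σ (Func n) λ h → All (λ u → 0ℚ ≤ app h u) (opposite x ∷ vs) × Σ (Point n) λ u → u ∈ (opposite x ∷ vs) × 0ℚ < app h u) → _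
    sep (h , m≥0 ∷ a , w , w∈ , w>0) = h , a , hx , strict w∈
      where
      hx : app h x ≡ 0ℚ
      hx = ≤-antisym (subst₂ _≤_ (solve 1 (λ u → :- (:- u) := u) refl (app h x)) refl (neg-≤0 (subst (0ℚ ≤_) (app-opposite h x) m≥0)))
             (comb-closed (half-closed h) a p)
      strict : w ∈ (opposite x ∷ vs) → Σ (Point n) λ v → v ∈ vs × 0ℚ < app h v
      strict (here refl) = ⊥-elim (<-irrefl (sym (trans (app-opposite h x) (cong -_ hx))) w>0)
      strict (there k) = w , k , w>0

  -- A face is a set of maxima while h attains its minimum 0 on it, hence the negative of the linear
  -- part of h. The constant term k comes from the weight coordinate.
  supporting-face : ∀ {n} (M : RawMatroid n) (h : Func (suc n)) {x} → InP M x → All (λ v → 0ℚ ≤ app h v) (vertices M) → app h (hom x) ≡ 0ℚ →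
    Σ (Point n) λ w → Face M w x × (∀ y → Face M w y → app h (hom y) ≡ 0ℚ)
  supporting-face {n} M h {x} px a hx = w , (px , top) , zero-on
    where
    k : ℚ
    k = app h e₀
    u : Point n
    u = proj₁ (coefficients (tailFunc h))
    w : Point n
    w j = - u j
    happ : ∀ y → app h (hom y) ≡ k - dot w y
    happ y = begin
      app h (hom y) ≡⟨ app-head-tail h (hom y) ⟩
      1ℚ * k + app (tailFunc h) y ≡⟨ cong (1ℚ * k +_) (proj₂ (coefficients (tailFunc h)) y) ⟩
      1ℚ * k + sum (λ j → u j * y j) ≡⟨ cong (1ℚ * k +_) (sum-cong-≗ λ j → solve 2 (λ u y → u :* y := (:- con 1ℚ) :* ((:- u) :* y)) refl (u j) (y j)) ⟩
      1ℚ * k + sum (λ j → (- 1ℚ) * (w j * y j)) ≡⟨ cong (1ℚ * k +_) (sym (*-distribˡ-sum (- 1ℚ) (λ j → w j * y j))) ⟩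
      1ℚ * k + (- 1ℚ) * sum (λ j → w j * y j) ≡⟨ cong (λ s → 1ℚ * k + (- 1ℚ) * s) (sym (dot≡ w y)) ⟩
      1ℚ * k + (- 1ℚ) * dot w y ≡⟨ solve 2 (λ k d → con 1ℚ :* k :+ (:- con 1ℚ) :* d := k :- d) refl k (dot w y) ⟩
      k - dot w y ∎
      where open ≡-Reasoning
    h≥0 : ∀ {y} → InP M y → 0ℚ ≤ app h (hom y)
    h≥0 p = comb-closed (half-closed h) a (inP⇒nn M p)
    diff : ∀ x y → app h (hom y) - app h (hom x) ≡ dot w x - dot w y
    diff x y = trans (cong₂ _-_ (happ y) (happ x)) (solve 3 (λ k a b → (k :- a) :- (k :- b) := b :- a) refl k (dot w y) (dot w x))
    top : ∀ y → InP M y → dot w y ≤ dot w x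
    top y p = 0≤⇒≤ (subst (0ℚ ≤_) (trans (trans (sym (+-identityʳ (app h (hom y)))) (cong (app h (hom y) +_) (cong -_ (sym hx)))) (diff x y)) (h≥0 p))
    zero-on : ∀ y → Face M w y → app h (hom y) ≡ 0ℚ
    zero-on y (py , ty) = ≤-antisym (0≤⇒≤ (subst (0ℚ ≤_) (trans (sym (diff y x)) (trans (cong (_- app h (hom y)) hx) refl)) (≤⇒0≤ (ty x px)))) (h≥0 py)

  -- From a relative interior point x one can move slightly away from y and stay in the polytope. If
  -- the value at y were below that at x, it would exceed the maximum there.
  face-of-relInt : ∀ {n} (M : RawMatroid n) w {x} → RelInt M x → Face M w x → ∀ y → InP M y → Face M w y
  face-of-relInt {n} M w {x} rx (_ , top) y py = py , λ z pz → ≤-trans (top z pz) y-top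
    where
    ext : Σ ℚ λ δ → 0ℚ < δ × (∀ ε → 0ℚ ≤ ε → ε ≤ δ → Pos (vertices M) (λ j → hom x j + ε * (hom x j + (- 1ℚ) * hom y j)))
    ext = pos-extend rx (span-lin 1ℚ (- 1ℚ) (comb⇒span rx) (comb⇒span (inP⇒nn M py)) λ j → cong (_+ (- 1ℚ) * hom y j) (sym (*-identityˡ (hom x j))))
    y-top : dot w x ≤ dot w y
    y-top = use ext
      where
      use : (Σ ℚ λ δ → 0ℚ < δ × (∀ ε → 0ℚ ≤ ε → ε ≤ δ → Pos (vertices M) (λ j → hom x j + ε * (hom x j + (- 1ℚ) * hom y j)))) → dot w x ≤ dot w y
      use (δ , δ>0 , h) = 0≤⇒≤ (*-cancelˡ-0≤ δ>0 (subst (0ℚ ≤_) gap (≤⇒0≤ (top z pz))))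
        where
        z : Point n
        z j = x j + δ * (x j + (- 1ℚ) * y j)
        pz : InP M z
        pz = relInt⇒inP M (comb-cong (λ { zero → solve 1 (λ δ → con 1ℚ := con 1ℚ :+ δ :* (con 1ℚ :+ (:- con 1ℚ) :* con 1ℚ)) refl δ ; (suc j) → refl }) (h δ (<⇒≤ δ>0) ≤-refl))
        dz : dot w z ≡ (1ℚ + δ) * dot w x + (- δ) * dot w y
        dz = trans (dot≡ w z) (trans (app-lin₂ (dotF w) {u = x} {v = y} (1ℚ + δ) (- δ) λ j →
            solve 3 (λ x y δ → x :+ δ :* (x :+ (:- con 1ℚ) :* y) := (con 1ℚ :+ δ) :* x :+ (:- δ) :* y) refl (x j) (y j) δ)
          (cong₂ (λ a b → (1ℚ + δ) * a + (- δ) * b) (sym (dot≡ w x)) (sym (dot≡ w y))))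
        gap : dot w x - dot w z ≡ δ * (dot w y - dot w x)
        gap = trans (cong (λ d → dot w x - d) dz) (solve 3 (λ a b δ → a :- ((con 1ℚ :+ δ) :* a :+ (:- δ) :* b) := δ :* (b :- a)) refl (dot w x) (dot w y) δ)

  module _ {n} {M : RawMatroid n} {s} {Ms : Fin s → RawMatroid n} (S : IsSubdivision M s Ms)
           {dims : Fin s → ℕ} (hds : ∀ i → HasDim (Ms i) (dims i)) where

    open IsSubdivision S

    piece⊆ : ∀ i x → InP (Ms i) x → InP M x
    piece⊆ i x p = proj₂ (cover x) (i , p)

    -- Independent points of the face, on which h vanishes, stay independent after adjoining the
    -- vertex v with h v > 0.
    smaller-dim : ∀ i j w (h : Func (suc n)) → (∀ y → Face (Ms i) w y → app h (hom y) ≡ 0ℚ) → Face (Ms i) w ≐ InP (Ms j) →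
      (Σ (Point (suc n)) λ v → v ∈ vertices (Ms i) × 0ℚ < app h v) → dims j ℕ.< dims i
    smaller-dim i j w h z eq (v , v∈ , v>0) = ℕ.s≤s⁻¹ (indep-bound (Ms i) (hds i) (v ◂ λ k → hom (p k)) inHom
        (indep-◂ h (λ e → <-irrefl (sym e) v>0) (λ k → z (p k) (inFace k)) (affIndep⇒homIndep (suc (dims j)) p A)))
      where
      p : Fin (suc (dims j)) → Point n
      p = proj₁ (proj₁ (hds j))
      A : AffIndep (suc (dims j)) p
      A = proj₂ (proj₂ (proj₁ (hds j)))
      inFace : ∀ k → Face (Ms i) w (p k)
      inFace k = proj₂ (eq (p k)) (proj₁ (proj₂ (proj₁ (hds j))) k)
      inHom : ∀ k → HomP (Ms i) ((v ◂ λ k → hom (p k)) k)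
      inHom zero = let B , b , e = ∈-vertices⁻ (Ms i) v∈ in indicator B , basis-inP (Ms i) b , e
      inHom (suc k) = p k , proj₁ (inFace k) , refl

    -- A point outside the relative interior of its cell lies on a proper face, which is a cell by
    -- `faces-in` and has smaller dimension; this is the recursion.
    in-some-relInt : ∀ i x → InP (Ms i) x → Acc ℕ._<_ (dims i) → Σ (Fin s) λ j → RelInt (Ms j) x
    in-some-relInt i x p (acc rec) = decide (pos-dec (vertices (Ms i)) (hom x))
      where
      decide : Dec (RelInt (Ms i) x) → Σ (Fin s) λ j → RelInt (Ms j) x
      decide (yes q) = i , q
      decide (no nq) =
        let h , a , hx , v = supporting (vertices (Ms i)) (hom x) (inP⇒nn (Ms i) p) nq
            w , fx , z = supporting-face (Ms i) h p a hx
            j , eq = faces-in i w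
        in in-some-relInt j x (proj₁ (eq x) fx) (rec (smaller-dim i j w h z eq v))

    -- The intersection of two different cells is a face of both. A face containing a relative
    -- interior point is everything, so the cells would coincide as polytopes, against `distinct`.
    relInt-unique : ∀ i j x → RelInt (Ms i) x → RelInt (Ms j) x → i ≡ j
    relInt-unique i j x p q = decide (i Fin.≟ j)
      where
      decide : Dec (i ≡ j) → i ≡ j
      decide (yes e) = e
      decide (no ne) = ⊥-elim ([ (λ e → e x (relInt⇒inP (Ms i) p , relInt⇒inP (Ms j) q)) , common ]′ (intersections i j ne))
        where
        common : (∃ λ w → (λ x → InP (Ms i) x × InP (Ms j) x) ≐ Face (Ms i) w) × (∃ λ w → (λ x → InP (Ms i) x × InP (Ms j) x) ≐ Face (Ms j) w) → ⊥
        common ((w , ei) , (w' , ej)) = distinct i j ne λ y →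
          (λ py → proj₂ (proj₂ (ei y) (face-of-relInt (Ms i) w p (proj₁ (ei x) both) y py))) ,
          (λ py → proj₁ (proj₂ (ej y) (face-of-relInt (Ms j) w' q (proj₁ (ej x) both) y py)))
          where
          both : InP (Ms i) x × InP (Ms j) x
          both = relInt⇒inP (Ms i) p , relInt⇒inP (Ms j) q

    -- Write x = δ z + (x - δ z) with z a point of the cell in the relative interior of P(M). For
    -- small δ the second summand stays in the cone of the cell, while the first involves all
    -- vertices of P(M) with positive coefficients.
    interior⇒relInt : ∀ i → NotInBoundary M (Ms i) → ∀ x → RelInt (Ms i) x → RelInt M x
    interior⇒relInt i (z , pz , rz) x px = use (pos-extend px (span-lin (- 1ℚ) 0ℚ (comb⇒span (inP⇒nn (Ms i) pz)) (comb⇒span px) (λ _ → refl)))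
      where
      sub : ∀ {y} → NN (vertices (Ms i)) y → NN (vertices M) y
      sub = comb-closed nn-closed (All.tabulate λ k → let B , b , e = ∈-vertices⁻ (Ms i) k in
        subst (NN (vertices M)) (sym e) (inP⇒nn M (piece⊆ i (indicator B) (basis-inP (Ms i) b))))
      use : (Σ ℚ λ δ → 0ℚ < δ × (∀ ε → 0ℚ ≤ ε → ε ≤ δ → Pos (vertices (Ms i)) (λ j → hom x j + ε * ((- 1ℚ) * hom z j + 0ℚ * hom x j)))) → RelInt M x
      use (δ , δ>0 , h) = pos-+-nn (pos-scale δ δ>0 (inRelInt⇒relInt M rz) (λ _ → refl)) (sub (pos⇒nn (h δ (<⇒≤ δ>0) ≤-refl)))
        λ j → solve 3 (λ x z δ → x := δ :* z :+ (x :+ δ :* ((:- con 1ℚ) :* z :+ con 0ℚ :* x))) refl (hom x j) (hom z j) δ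

    relInt⇒interior : ∀ i x → RelInt (Ms i) x → RelInt M x → NotInBoundary M (Ms i)
    relInt⇒interior i x p q = x , relInt⇒inP (Ms i) p , relInt⇒inRelInt M q

  sumL-allFin-suc : ∀ {s} (f : Fin (suc s) → ℤ) → sumL f (allFin (suc s)) ≡ f zero ℤ.+ sumL (λ i → f (suc i)) (allFin s)
  sumL-allFin-suc {s} f = cong (λ a → f zero ℤ.+ a) (trans (cong (sumL f) (sym (map-tabulate id Fin.suc))) (sumL-map Fin.suc f (allFin s)))

  sumL-single : ∀ {s} (f : Fin s → ℤ) i → (∀ j → j ≢ i → f j ≡ 0ℤ) → sumL f (allFin s) ≡ f i
  sumL-single {suc s} f zero h = trans (sumL-allFin-suc f)
    (trans (cong (λ a → f zero ℤ.+ a) (sumL-zero (allFin s) (All.universal (λ j → h (suc j) λ ()) (allFin s)))) (ℤₚ.+-identityʳ (f zero)))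
  sumL-single {suc s} f (suc i) h = trans (sumL-allFin-suc f)
    (trans (cong₂ ℤ._+_ (h zero λ ()) (sumL-single (λ j → f (suc j)) i λ j ne → h (suc j) (λ e → ne (Finₚ.suc-injective e)))) (ℤₚ.+-identityˡ (f (suc i))))

  signAt : ∀ {s} → ℕ → (Fin s → ℕ) → (Fin s → Bool) → Fin s → ℤ
  signAt d dims int i = if int i then sign (d ∸ dims i) else 0ℤ

  sign-+ : ∀ a b → sign (a ℕ.+ b) ≡ sign a ℤ.* sign b
  sign-+ zero b = sym (ℤₚ.*-identityˡ (sign b))
  sign-+ (suc a) b = trans (cong ℤ.-_ (sign-+ a b)) (ℤₚ.neg-distribˡ-* (sign a) (sign b))

  sign-sq : ∀ a → sign a ℤ.* sign a ≡ 1ℤ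
  sign-sq zero = refl
  sign-sq (suc a) = trans (S.solve 1 (λ x → (S.:- x) S.:* (S.:- x) S.:= x S.:* x) refl (sign a)) (sign-sq a)
    where module S = ℤSolver.+-*-Solver

  sign-∸ : ∀ {a d} → a ℕ.≤ d → sign (d ∸ a) ≡ sign d ℤ.* sign a
  sign-∸ {a} {d} l = begin
    sign (d ∸ a) ≡⟨ sym (ℤₚ.*-identityʳ (sign (d ∸ a))) ⟩
    sign (d ∸ a) ℤ.* 1ℤ ≡⟨ cong (λ k → sign (d ∸ a) ℤ.* k) (sym (sign-sq a)) ⟩
    sign (d ∸ a) ℤ.* (sign a ℤ.* sign a) ≡⟨ sym (ℤₚ.*-assoc (sign (d ∸ a)) (sign a) (sign a)) ⟩
    sign (d ∸ a) ℤ.* sign a ℤ.* sign a ≡⟨ cong (λ k → k ℤ.* sign a) (sym (sign-+ (d ∸ a) a)) ⟩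
    sign (d ∸ a ℕ.+ a) ℤ.* sign a ≡⟨ cong (λ k → sign k ℤ.* sign a) (ℕₚ.m∸n+n≡m l) ⟩
    sign d ℤ.* sign a ∎
    where open ≡-Reasoning

  polytopeItem : ∀ {n} → ℤ → (N : RawMatroid n) → ∀ {d} → HasDim N d → Item n
  polytopeItem c N hd = record { coef = c ; gens = vertices N ; weight>0 = vertices-weight N ; rnk = _ ; hasRank = dim⇒rank N hd }

  polytopeItem-eul : ∀ {n} c (N : RawMatroid n) {d} (hd : HasDim N d) → eul (polytopeItem c N hd) ≡ ℤ.- sign d
  polytopeItem-eul {n} c N {d} hd@((v , pv , _) , _) = go (vertices N) (inP⇒nn N (pv zero))
    where
    go : ∀ vs → NN vs (hom (v zero)) → eulG vs (suc d) ≡ ℤ.- sign d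
    go [] (nil e) = ⊥-elim (1≢0 (e zero))
    go (_ ∷ _) _ = refl

  support : ∀ {n} → Point n → Func (suc n)
  support w = tailF (dotF w)
    where
    tailF : ∀ {n} → Func n → Func (suc n)
    tailF f = record { app = λ x → app f (λ j → x (suc j)) ; lin = λ c e → lin f c (λ j → e (suc j)) }

  module _ {n} {M : RawMatroid n} {s} {Ms : Fin s → RawMatroid n} (S : IsSubdivision M s Ms)
           {d} (hd : HasDim M d) {dims : Fin s → ℕ} (hds : ∀ i → HasDim (Ms i) (dims i))
           (int : Fin s → Bool) (hint : ∀ i → (int i ≡ true → NotInBoundary M (Ms i)) × (NotInBoundary M (Ms i) → int i ≡ true)) where

    member : Point (suc n) → RawMatroid n → ℤ
    member x N = 𝟙 (pos-dec (vertices N) x)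

    indicator-int : Fin s → ℤ
    indicator-int i = if int i then 1ℤ else 0ℤ

    private
      module A (x : Point (suc n)) (x₀ : x zero ≡ 1ℚ) where
        y : Point n
        y j = x (suc j)
        e : ∀ j → x j ≡ hom y j
        e zero = x₀
        e (suc j) = refl
        to : ∀ {N} → Pos (vertices N) x → RelInt N y
        to = comb-cong (λ j → sym (e j))
        from : ∀ {N} → RelInt N y → Pos (vertices N) x
        from = comb-cong e
        inside : ∀ i → int i ≡ true → RelInt (Ms i) y → RelInt M y
        inside i t = interior⇒relInt S hds i (proj₁ (hint i) t) y
        single : RelInt M y → sumL (λ i → indicator-int i ℤ.* member x (Ms i)) (allFin s) ≡ 1ℤ
        single p = at (in-some-relInt S hds (proj₁ c) y (proj₂ c) (<-wellFounded (dims (proj₁ c))))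
          where
          c : Σ (Fin s) λ i → InP (Ms i) y
          c = proj₁ (IsSubdivision.cover S y) (relInt⇒inP M p)
          at : (Σ (Fin s) λ j → RelInt (Ms j) y) → sumL (λ i → indicator-int i ℤ.* member x (Ms i)) (allFin s) ≡ 1ℤ
          at (j , q) = trans (sumL-single _ j λ k ne → trans (cong (λ a → indicator-int k ℤ.* a) (𝟙-no (pos-dec (vertices (Ms k)) x)
              λ r → ne (relInt-unique S hds k j y (to {Ms k} r) q))) (ℤₚ.*-zeroʳ (indicator-int k)))
            (cong₂ ℤ._*_ (cong (λ b → if b then 1ℤ else 0ℤ) (proj₂ (hint j) (relInt⇒interior S hds j y q p))) (𝟙-yes (pos-dec (vertices (Ms j)) x) (from {Ms j} q)))
        none : ¬ RelInt M y → sumL (λ i → indicator-int i ℤ.* member x (Ms i)) (allFin s) ≡ 0ℤ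
        none np = sumL-zero (allFin s) (All.universal (λ i → term i (int i) refl) (allFin s))
          where
          term : ∀ i b → int i ≡ b → indicator-int i ℤ.* member x (Ms i) ≡ 0ℤ
          term i true t = trans (cong (λ a → indicator-int i ℤ.* a) (𝟙-no (pos-dec (vertices (Ms i)) x) λ q → np (inside i t (to {Ms i} q)))) (ℤₚ.*-zeroʳ (indicator-int i))
          term i false t = cong (λ b → (if b then 1ℤ else 0ℤ) ℤ.* member x (Ms i)) t

    partition : ∀ x → x zero ≡ 1ℚ → member x M ≡ sumL (λ i → indicator-int i ℤ.* member x (Ms i)) (allFin s)
    partition x x₀ = decide (pos-dec (vertices M) x)
      where
      open A x x₀
      decide : Dec (Pos (vertices M) x) → member x M ≡ sumL (λ i → indicator-int i ℤ.* member x (Ms i)) (allFin s)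
      decide (yes p) = trans (𝟙-yes (pos-dec (vertices M) x) p) (sym (single (to {M} p)))
      decide (no np) = trans (𝟙-no (pos-dec (vertices M) x) np) (sym (none λ q → np (from {M} q)))

    cell : Maybe (Fin s) → RawMatroid n
    cell nothing = M
    cell (just i) = Ms i

    -- `nothing` stands for the subdivided polytope, with coefficient -1. Boundary cells are kept
    -- with coefficient 0, so that the cells are indexed by all of `Fin s`.
    cellItem : Maybe (Fin s) → Item n
    cellItem nothing = polytopeItem (ℤ.- 1ℤ) M hd
    cellItem (just i) = polytopeItem (indicator-int i) (Ms i) (hds i)

    cells : List (Maybe (Fin s))
    cells = nothing ∷ map just (allFin s)

    cells-cancel : Cancels (λ _ → ⊤) (map cellItem cells)
    cells-cancel x _ x₀ = trans (sumL-map cellItem (λ i → coef i ℤ.* mem x i) cells)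
      (trans (cong (λ a → (ℤ.- 1ℤ) ℤ.* member x M ℤ.+ a) (trans (sumL-map just (λ c → coef (cellItem c) ℤ.* mem x (cellItem c)) (allFin s)) (sym (partition x x₀))))
        (S′.solve 1 (λ m → (S′.:- S′.con 1ℤ) S′.:* m S′.:+ m S′.:= S′.con 0ℤ) refl (member x M)))
      where module S′ = ℤSolver.+-*-Solver

    height : Point n → Maybe (Fin s) → ℚ
    height w c = hi (support w) (cellItem c)

    cells-jump : ∀ w t → sumL (λ c → (coef (cellItem c) ℤ.* eul (cellItem c)) ℤ.* 𝟙 (height w c ℚₚ.≟ t)) cells ≡ 0ℤ
    cells-jump w t = trans (sym (sumL-map cellItem (λ i → (coef i ℤ.* eul i) ℤ.* 𝟙 (hi (support w) i ℚₚ.≟ t)) cells))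
      -- `support w` comes first because `jump` speaks of the head functional; the coordinates after
      -- it separate all points, so D can be the whole space.
      (jump (support w) (tabulate ev) {D = λ _ → ⊤} (record { at-0 = λ _ → tt ; step = λ _ _ _ _ _ → tt }) (λ { x y _ _ _ (_ ∷ a) j → tabulate⁻ {f = ev} a j })
        (map cellItem cells) (All.universal (λ i → All.universal (λ _ → tt) (gens i)) (map cellItem cells)) cells-cancel t)

    -- Height and key have the same fibres on the cells, so the count over a fibre of the key is the
    -- count at the height of any of its members; `fiber-sums` then admits every function of the
    -- key.
    cells-function : ∀ w {K : Set} (_≟_ : DecidableEquality K) (key : Maybe (Fin s) → K) →
      (∀ c c' → height w c ≡ height w c' → key c ≡ key c') → (∀ c c' → key c ≡ key c' → height w c ≡ height w c') → (g : K → ℤ) →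
      sumL (λ c → (coef (cellItem c) ℤ.* eul (cellItem c)) ℤ.* g (key c)) cells ≡ 0ℤ
    cells-function w _≟_ key to from g = fiber-sums _≟_ C key cells fibre g
      where
      C : Maybe (Fin s) → ℤ
      C c = coef (cellItem c) ℤ.* eul (cellItem c)
      fibre : ∀ κ → sumL (λ c → C c ℤ.* 𝟙 (key c ≟ κ)) cells ≡ 0ℤ
      fibre κ = decide (any? (λ c → key c ≟ κ) cells)
        where
        decide : Dec (Any (λ c → key c ≡ κ) cells) → sumL (λ c → C c ℤ.* 𝟙 (key c ≟ κ)) cells ≡ 0ℤ
        decide (yes a) = let c₀ , _ , e = find a in
          trans (sumL-ext (λ c → cong (λ a → C c ℤ.* a) (𝟙-cong (key c ≟ κ) (height w c ℚₚ.≟ height w c₀)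
            (λ h → from c c₀ (trans h (sym e))) (λ h → trans (to c c₀ h) e))) cells) (cells-jump w (height w c₀))
        decide (no na) = sumL-zero cells (All.map (λ {c} ne → trans (cong (λ a → C c ℤ.* a) (𝟙-no (key c ≟ κ) ne)) (ℤₚ.*-zeroʳ (C c))) (¬Any⇒All¬ cells na))

    -- The relation between the cells carries the sign of each dimension. Multiplying by the sign of
    -- d isolates the term of M, and `dim-mono` ensures that the truncated difference of dimensions
    -- is the true one.
    valuation : ∀ w {K : Set} (_≟_ : DecidableEquality K) (key : Maybe (Fin s) → K) →
      (∀ c c' → height w c ≡ height w c' → key c ≡ key c') → (∀ c c' → key c ≡ key c' → height w c ≡ height w c') → (g : K → ℤ) →
      g (key nothing) ≡ sumL (λ i → signAt d dims int i ℤ.* g (key (just i))) (allFin s)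
    valuation w _≟_ key to from g = begin
      G nothing
        ≡⟨ S′.solve 2 (λ s g → g S′.:= (S′.con 1ℤ S′.:- s S′.:* s) S′.:* g S′.:+ s S′.:* (s S′.:* g)) refl (sign d) (G nothing) ⟩
      (1ℤ ℤ.- sign d ℤ.* sign d) ℤ.* G nothing ℤ.+ sign d ℤ.* (sign d ℤ.* G nothing)
        ≡⟨ cong (λ a → (1ℤ ℤ.- a) ℤ.* G nothing ℤ.+ sign d ℤ.* (sign d ℤ.* G nothing)) (sign-sq d) ⟩
      0ℤ ℤ.+ sign d ℤ.* (sign d ℤ.* G nothing)
        ≡⟨ ℤₚ.+-identityˡ (sign d ℤ.* (sign d ℤ.* G nothing)) ⟩
      sign d ℤ.* (sign d ℤ.* G nothing)
        ≡⟨ cong (λ a → sign d ℤ.* a) main ⟩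
      sign d ℤ.* sumL (λ i → indicator-int i ℤ.* sign (dims i) ℤ.* G (just i)) (allFin s)
        ≡⟨ sym (sumL-*ˡ (sign d) (λ i → indicator-int i ℤ.* sign (dims i) ℤ.* G (just i)) (allFin s)) ⟩
      sumL (λ i → sign d ℤ.* (indicator-int i ℤ.* sign (dims i) ℤ.* G (just i))) (allFin s)
        ≡⟨ sumL-ext (λ i → trans (S′.solve 4 (λ d t s g → d S′.:* (t S′.:* s S′.:* g) S′.:= t S′.:* (d S′.:* s) S′.:* g) refl (sign d) (indicator-int i) (sign (dims i)) (G (just i)))
             (cong (λ a → a ℤ.* G (just i)) (coeff i (int i) refl))) (allFin s) ⟩
      sumL (λ i → signAt d dims int i ℤ.* G (just i)) (allFin s) ∎
      where
      open ≡-Reasoning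
      module S′ = ℤSolver.+-*-Solver
      G : Maybe (Fin s) → ℤ
      G c = g (key c)
      coeff : ∀ i b → int i ≡ b → indicator-int i ℤ.* (sign d ℤ.* sign (dims i)) ≡ signAt d dims int i
      coeff i true t = trans (cong (λ b → (if b then 1ℤ else 0ℤ) ℤ.* (sign d ℤ.* sign (dims i))) t)
        (trans (ℤₚ.*-identityˡ (sign d ℤ.* sign (dims i))) (trans (sym (sign-∸ (dim-mono M (Ms i) hd (hds i) (piece⊆ S hds i)))) (cong (λ b → if b then sign (d ∸ dims i) else 0ℤ) (sym t))))
      coeff i false t = trans (cong (λ b → (if b then 1ℤ else 0ℤ) ℤ.* (sign d ℤ.* sign (dims i))) t) (cong (λ b → if b then sign (d ∸ dims i) else 0ℤ) (sym t))
      R : ℤ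
      R = sumL (λ i → indicator-int i ℤ.* sign (dims i) ℤ.* G (just i)) (allFin s)
      total : sign d ℤ.* G nothing ℤ.+ (ℤ.- R) ≡ 0ℤ
      total = trans (cong₂ ℤ._+_
          (trans (S′.solve 2 (λ s g → s S′.:* g S′.:= ((S′.:- S′.con 1ℤ) S′.:* (S′.:- s)) S′.:* g) refl (sign d) (G nothing))
             (cong (λ a → ((ℤ.- 1ℤ) ℤ.* a) ℤ.* G nothing) (sym (polytopeItem-eul (ℤ.- 1ℤ) M hd))))
          (trans (sym (sumL-neg (λ i → indicator-int i ℤ.* sign (dims i) ℤ.* G (just i)) (allFin s)))
            (trans (sumL-ext (λ i → trans (S′.solve 3 (λ t s g → S′.:- (t S′.:* s S′.:* g) S′.:= (t S′.:* (S′.:- s)) S′.:* g) refl (indicator-int i) (sign (dims i)) (G (just i)))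
                (cong (λ a → (indicator-int i ℤ.* a) ℤ.* G (just i)) (sym (polytopeItem-eul (indicator-int i) (Ms i) (hds i))))) (allFin s))
              (sym (sumL-map just (λ c → (coef (cellItem c) ℤ.* eul (cellItem c)) ℤ.* G c) (allFin s))))))
        (cells-function w _≟_ key to from g)
      main : sign d ℤ.* G nothing ≡ R
      main = trans (S′.solve 2 (λ a r → a S′.:= (a S′.:+ S′.:- r) S′.:+ r) refl (sign d ℤ.* G nothing) R) (trans (cong (λ a → a ℤ.+ R) total) (ℤₚ.+-identityˡ R))

-- Greedy bases along a chain of subsets.

module Matroid where

  open import Defs
  open import Data.Nat
  open import Data.Nat.Properties
  open import Data.Fin using (Fin)
  open import Data.Fin.Subset using (Subset; _∈_; _∉_; _⊆_; _∩_; _∪_; ∁; ⁅_⁆; ⊤; ⊥; ∣_∣)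
  open import Data.Fin.Subset.Properties
  open import Data.Bool using (true; false)
  open import Data.Vec using ([]; _∷_)
  open import Data.List using (List; []; _∷_; allFin)
  open import Data.List.Membership.Propositional using () renaming (_∈_ to _∈ᴸ_)
  open import Data.List.Membership.Propositional.Properties using (∈-allFin; ∈-filter⁺; ∈-filter⁻)
  open import Data.List.Relation.Unary.Any using (here; there)
  open import Data.List.Relation.Unary.All as All using (All; []; _∷_)
  open import Data.Product using (Σ; _×_; _,_; proj₁; proj₂)
  open import Data.Sum using (_⊎_; inj₁; inj₂; [_,_]′)
  open import Data.Unit using (tt) renaming (⊤ to Unit)
  open import Relation.Nullary using (Dec; yes; no)
  open import Relation.Binary.PropositionalEquality

  ∣∩∣+∣∩∁∣ : ∀ {n} (X A : Subset n) → ∣ X ∩ A ∣ + ∣ X ∩ ∁ A ∣ ≡ ∣ X ∣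
  ∣∩∣+∣∩∁∣ [] [] = refl
  ∣∩∣+∣∩∁∣ (true ∷ X) (true ∷ A) = cong suc (∣∩∣+∣∩∁∣ X A)
  ∣∩∣+∣∩∁∣ (true ∷ X) (false ∷ A) = trans (+-suc ∣ X ∩ A ∣ ∣ X ∩ ∁ A ∣) (cong suc (∣∩∣+∣∩∁∣ X A))
  ∣∩∣+∣∩∁∣ (false ∷ X) (_ ∷ A) = ∣∩∣+∣∩∁∣ X A

  ∣∪∣≤ : ∀ {n} (X Y : Subset n) → ∣ X ∪ Y ∣ ≤ ∣ X ∣ + ∣ Y ∣
  ∣∪∣≤ [] [] = z≤n
  ∣∪∣≤ (true ∷ X) (true ∷ Y) = s≤s (≤-trans (∣∪∣≤ X Y) (+-monoʳ-≤ ∣ X ∣ (n≤1+n ∣ Y ∣)))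
  ∣∪∣≤ (true ∷ X) (false ∷ Y) = s≤s (∣∪∣≤ X Y)
  ∣∪∣≤ (false ∷ X) (true ∷ Y) = ≤-trans (s≤s (∣∪∣≤ X Y)) (≤-reflexive (sym (+-suc ∣ X ∣ ∣ Y ∣)))
  ∣∪∣≤ (false ∷ X) (false ∷ Y) = ∣∪∣≤ X Y

  x∈X∩∁Y : ∀ {n} {X Y : Subset n} {x} → x ∈ X → x ∉ Y → x ∈ X ∩ ∁ Y
  x∈X∩∁Y p q = x∈p∩q⁺ (p , x∉p⇒x∈∁p q)

  Ascending : ∀ {n} → Subset n → List (Subset n) → Set
  Ascending I [] = Unit
  Ascending I (C ∷ Cs) = I ⊆ C × Ascending C Cs

  ascending-weaken : ∀ {n} {I J : Subset n} Cs → J ⊆ I → Ascending I Cs → Ascending J Cs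
  ascending-weaken [] _ _ = tt
  ascending-weaken (C ∷ Cs) h (p , q) = (λ x → p (h x)) , q

  module _ {n} {M : RawMatroid n} (IM : IsMatroid M) where

    open IsMatroid IM

    rk-⊥ : rk M ⊥ ≡ 0
    rk-⊥ = n≤0⇒n≡0 (subst (rk M ⊥ ≤_) (∣⊥∣≡0 n) (rk-card ⊥))

    submod : ∀ U X Y I → U ⊆ X ∪ Y → I ⊆ X → I ⊆ Y → rk M U + rk M I ≤ rk M X + rk M Y
    submod U X Y I u i j = ≤-trans (+-mono-≤ (rk-mono U (X ∪ Y) u) (rk-mono I (X ∩ Y) λ p → x∈p∩q⁺ (i p , j p))) (rk-submod X Y)

    subadditive : ∀ U X Y → U ⊆ X ∪ Y → rk M U ≤ rk M X + rk M Y
    subadditive U X Y u = ≤-trans (m≤m+n (rk M U) (rk M ⊥)) (submod U X Y ⊥ u (λ p → ⊆-min X p) (λ p → ⊆-min Y p))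

    Independent : Subset n → Set
    Independent I = ∣ I ∣ ≡ rk M I

    -- Subadditivity gives |B| = rk B ≤ rk (B ∩ A) + |B ∩ ∁ A|, and |B| is the sum of |B ∩ A| and |B
    -- ∩ ∁ A|.
    independent-∩ : ∀ {B} A → Independent B → ∣ B ∩ A ∣ ≤ rk M A
    independent-∩ {B} A e = ≤-trans (+-cancelʳ-≤ ∣ B ∩ ∁ A ∣ ∣ B ∩ A ∣ (rk M (B ∩ A)) bound) (rk-mono (B ∩ A) A (p∩q⊆q B A))
      where
      cover : B ⊆ (B ∩ A) ∪ (B ∩ ∁ A)
      cover {x} p = decide (x ∈? A)
        where
        decide : Dec (x ∈ A) → x ∈ (B ∩ A) ∪ (B ∩ ∁ A)
        decide (yes q) = x∈p∪q⁺ (inj₁ (x∈p∩q⁺ (p , q)))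
        decide (no q) = x∈p∪q⁺ (inj₂ (x∈X∩∁Y p q))
      bound : ∣ B ∩ A ∣ + ∣ B ∩ ∁ A ∣ ≤ rk M (B ∩ A) + ∣ B ∩ ∁ A ∣
      bound = ≤-trans (≤-reflexive (trans (∣∩∣+∣∩∁∣ B A) e))
        (≤-trans (subadditive B (B ∩ A) (B ∩ ∁ A) cover) (+-monoʳ-≤ (rk M (B ∩ A)) (rk-card (B ∩ ∁ A))))

    Spans : Subset n → List (Fin n) → Set
    Spans I zs = ∀ W → (∀ {x} → x ∈ W → x ∈ I ⊎ x ∈ᴸ zs) → rk M W ≤ rk M I

    Extension : Subset n → List (Fin n) → Set
    Extension I zs = Σ (Subset n) λ J → I ⊆ J × (∀ {x} → x ∈ J → x ∈ I ⊎ x ∈ᴸ zs) × Independent J × Spans J zs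

    -- Submodularity for J together with W minus z, and for J together with z: the intersection
    -- contains J, and by hypothesis the former set has no larger rank than J.
    spans-step : ∀ J z zs → Spans J zs → ∀ W → (∀ {x} → x ∈ W → x ∈ (J ∪ ⁅ z ⁆) ⊎ x ∈ᴸ (z ∷ zs)) → rk M W ≤ rk M (J ∪ ⁅ z ⁆)
    spans-step J z zs sp W h = +-cancelʳ-≤ (rk M J) (rk M W) (rk M (J ∪ ⁅ z ⁆))
      (≤-trans (submod W X (J ∪ ⁅ z ⁆) J cover (p⊆p∪q (W ∩ ∁ ⁅ z ⁆)) (p⊆p∪q ⁅ z ⁆))
        (≤-trans (+-monoˡ-≤ (rk M (J ∪ ⁅ z ⁆)) (sp X inX)) (≤-reflexive (+-comm (rk M J) (rk M (J ∪ ⁅ z ⁆))))))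
      where
      X : Subset n
      X = J ∪ (W ∩ ∁ ⁅ z ⁆)
      cover : W ⊆ X ∪ (J ∪ ⁅ z ⁆)
      cover {x} p = decide (x ∈? ⁅ z ⁆)
        where
        decide : Dec (x ∈ ⁅ z ⁆) → x ∈ X ∪ (J ∪ ⁅ z ⁆)
        decide (yes q) = x∈p∪q⁺ (inj₂ (x∈p∪q⁺ (inj₂ q)))
        decide (no q) = x∈p∪q⁺ (inj₁ (x∈p∪q⁺ (inj₂ (x∈X∩∁Y p q))))
      inX : ∀ {x} → x ∈ X → x ∈ J ⊎ x ∈ᴸ zs
      inX {x} p = [ inj₁ , other ]′ (x∈p∪q⁻ J (W ∩ ∁ ⁅ z ⁆) p)
        where
        other : x ∈ W ∩ ∁ ⁅ z ⁆ → x ∈ J ⊎ x ∈ᴸ zs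
        other q = [ (λ r → [ inj₁ , (λ k → absurd k) ]′ (x∈p∪q⁻ J ⁅ z ⁆ r)) , (λ { (here refl) → absurd (x∈⁅x⁆ z) ; (there k) → inj₂ k }) ]′ (h (proj₁ (x∈p∩q⁻ W (∁ ⁅ z ⁆) q)))
          where
          absurd : ∀ {A : Set} → x ∈ ⁅ z ⁆ → A
          absurd k with () ← x∈∁p⇒x∉p (proj₂ (x∈p∩q⁻ W (∁ ⁅ z ⁆) q)) k

    extend : ∀ I zs → Independent I → Extension I zs
    extend I [] ind = I , (λ p → p) , inj₁ , ind , λ W h → rk-mono W I λ p → [ (λ q → q) , (λ ()) ]′ (h p)
    extend I (z ∷ zs) ind = step (extend I zs ind)
      where
      step : Extension I zs → Extension I (z ∷ zs)
      step (J , IJ , JI , indJ , sp) = decide (rk M (J ∪ ⁅ z ⁆) ≤? rk M J)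
        where
        decide : Dec (rk M (J ∪ ⁅ z ⁆) ≤ rk M J) → Extension I (z ∷ zs)
        decide (yes le) = J , IJ , (λ p → [ inj₁ , (λ k → inj₂ (there k)) ]′ (JI p)) , indJ ,
          λ W h → ≤-trans (spans-step J z zs sp W λ p → [ (λ q → inj₁ (p⊆p∪q ⁅ z ⁆ q)) , inj₂ ]′ (h p)) le
        decide (no gt) = J ∪ ⁅ z ⁆ , (λ p → p⊆p∪q ⁅ z ⁆ (IJ p)) ,
          (λ p → [ (λ q → [ inj₁ , (λ k → inj₂ (there k)) ]′ (JI q)) , (λ q → inj₂ (here (x∈⁅y⁆⇒x≡y z q))) ]′ (x∈p∪q⁻ J ⁅ z ⁆ p)) ,
          ≤-antisym size (rk-card (J ∪ ⁅ z ⁆)) ,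
          spans-step J z zs sp
          where
          size : ∣ J ∪ ⁅ z ⁆ ∣ ≤ rk M (J ∪ ⁅ z ⁆)
          size = ≤-trans (∣∪∣≤ J ⁅ z ⁆) (≤-trans (≤-reflexive (trans (cong₂ _+_ indJ (∣⁅x⁆∣≡1 z)) (+-comm (rk M J) 1))) (≰⇒> gt))

    elements : Subset n → List (Fin n)
    elements Z = Data.List.filter (_∈? Z) (allFin n)

    extend-within : ∀ I Z → Independent I → I ⊆ Z → Σ (Subset n) λ J → I ⊆ J × J ⊆ Z × Independent J × ∣ J ∣ ≡ rk M Z
    extend-within I Z ind IZ = finish (extend I (elements Z) ind)
      where
      finish : Extension I (elements Z) → Σ (Subset n) λ J → I ⊆ J × J ⊆ Z × Independent J × ∣ J ∣ ≡ rk M Z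
      finish (J , IJ , JI , indJ , sp) = J , IJ , JZ , indJ , trans indJ (≤-antisym (rk-mono J Z JZ) (sp Z λ {x} p → inj₂ (∈-filter⁺ (_∈? Z) (∈-allFin x) p)))
        where
        JZ : J ⊆ Z
        JZ p = [ IZ , (λ k → proj₂ (∈-filter⁻ (_∈? Z) {xs = allFin n} k)) ]′ (JI p)

    -- Once J has rk C elements inside C, any larger independent set meets C in exactly as many, by
    -- `independent-∩`; so maximality in the smaller members survives all later extensions. The last
    -- extension is within `⊤`, to reach a basis.
    greedy-from : ∀ I Cs → Independent I → Ascending I Cs → Σ (Subset n) λ B → I ⊆ B × Independent B × ∣ B ∣ ≡ rk M ⊤ × All (λ C → ∣ B ∩ C ∣ ≡ rk M C) Cs
    greedy-from I [] ind _ = let B , IB , _ , indB , e = extend-within I ⊤ ind (λ _ → ∈⊤) in B , IB , indB , e , []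
    greedy-from I (C ∷ Cs) ind (IC , asc) =
      let J , IJ , JC , indJ , e = extend-within I C ind IC
          B , JB , indB , e' , al = greedy-from J Cs indJ (ascending-weaken Cs JC asc)
      in B , (λ p → JB (IJ p)) , indB , e' ,
         ≤-antisym (independent-∩ C indB) (≤-trans (≤-reflexive (sym e)) (p⊆q⇒∣p∣≤∣q∣ (λ p → x∈p∩q⁺ (JB p , JC p)))) ∷ al

    greedy-basis : ground M ≡ ⊤ → ∀ Cs → Ascending ⊥ Cs → Σ (Subset n) λ B → IsBasis M B × All (λ C → ∣ B ∩ C ∣ ≡ rk M C) Cs
    greedy-basis g Cs asc = let B , _ , ind , e , al = greedy-from ⊥ Cs (trans (∣⊥∣≡0 n) (sym rk-⊥)) asc in
      B , ((λ {x} _ → subst (x ∈_) (sym g) ∈⊤) , ind , trans (sym ind) (trans e (cong (rk M) (sym g)))) , al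

-- Functions of the ranks along a chain are valuative; loops of cells.

module Chain where

  open import Defs
  open Lin
  open Rank using (sum; sum-0; sum-cong-≗; *-distribˡ-sum; ∑-distrib-+)
  open ListSum
  open Euler
  open EulerMain
  open Polytope
  open Subdivision
  open Matroid
  open import Data.Bool using (Bool; true; false; if_then_else_)
  open import Data.Nat using (ℕ; zero; suc; z≤n; s≤s)
  import Data.Nat as ℕ
  import Data.Nat.Properties as ℕₚ
  import Data.Nat.DivMod as ℕD
  open import Data.Fin using (Fin; zero; suc)
  open import Data.Fin.Subset using (Subset; _∩_; ⁅_⁆; ⊤; ⊥; ∣_∣; _⊆_)
  open import Data.Fin.Subset.Properties using (∣p∣≤n; ⊆-min; x∈p∩q⁺)
  open import Data.Integer using (ℤ)
  import Data.Integer as ℤ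
  open import Data.Rational hiding (_≟_; ∣_∣)
  open import Data.Rational.Properties hiding (_≟_)
  open import Data.Rational.Solver
  open +-*-Solver
  open import Data.Vec using ([]; _∷_; lookup)
  open import Data.Vec.Properties using (lookup⇒[]=; []=⇒lookup)
  open import Data.Empty using (⊥-elim)
  open import Data.List using (List; []; _∷_; map; allFin)
  import Data.List.Properties as Listₚ
  open import Data.List.Membership.Propositional using (_∈_)
  import Data.Fin.Subset.Properties as Subₚ
  open import Data.List.Relation.Unary.All as All using (All; []; _∷_)
  open import Data.Maybe using (Maybe; just; nothing)
  open import Data.Product using (Σ; _×_; _,_; proj₁; proj₂)
  open import Data.Unit using (tt)
  open import Relation.Binary.PropositionalEquality

  ι : ℕ → ℚ
  ι zero = 0ℚ
  ι (suc k) = 1ℚ + ι k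

  ι-+ : ∀ a b → ι (a ℕ.+ b) ≡ ι a + ι b
  ι-+ zero b = sym (+-identityˡ (ι b))
  ι-+ (suc a) b = trans (cong (1ℚ +_) (ι-+ a b)) (sym (+-assoc 1ℚ (ι a) (ι b)))

  ι-* : ∀ a b → ι (a ℕ.* b) ≡ ι a * ι b
  ι-* zero b = sym (*-zeroˡ (ι b))
  ι-* (suc a) b = trans (ι-+ b (a ℕ.* b)) (trans (cong (ι b +_) (ι-* a b)) (solve 2 (λ a b → b :+ a :* b := (con 1ℚ :+ a) :* b) refl (ι a) (ι b)))

  0≤ι : ∀ a → 0ℚ ≤ ι a
  0≤ι zero = ≤-refl
  0≤ι (suc a) = 0≤+ 0≤1 (0≤ι a)

  ι-mono : ∀ {a b} → a ℕ.≤ b → ι a ≤ ι b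
  ι-mono {b = b} z≤n = 0≤ι b
  ι-mono (s≤s l) = +-monoʳ-≤ 1ℚ (ι-mono l)

  ι-injective : ∀ {a b} → ι a ≡ ι b → a ≡ b
  ι-injective {a} {b} e = ℕₚ.≤-antisym (go a b (≤-reflexive e)) (go b a (≤-reflexive (sym e)))
    where
    go : ∀ a b → ι a ≤ ι b → a ℕ.≤ b
    go zero b _ = z≤n
    go (suc a) zero h = ⊥-elim (<-irrefl refl (<-≤-trans (0<+≤ 0<1 (0≤ι a)) h))
    go (suc a) (suc b) h = s≤s (go a b (0≤⇒≤ (subst (0ℚ ≤_) (solve 2 (λ a b → (con 1ℚ :+ b) :- (con 1ℚ :+ a) := b :- a) refl (ι a) (ι b)) (≤⇒0≤ h))))

  code : ℕ → List ℕ → ℕ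
  code b [] = 0
  code b (r ∷ rs) = r ℕ.+ code b rs ℕ.* b

  code-mono : ∀ b {A : Set} (f g : A → ℕ) xs → (∀ x → f x ℕ.≤ g x) → code b (map f xs) ℕ.≤ code b (map g xs)
  code-mono b f g [] h = z≤n
  code-mono b f g (x ∷ xs) h = ℕₚ.+-mono-≤ (h x) (ℕₚ.*-monoˡ-≤ b (code-mono b f g xs h))

  -- Digits are at most b and the base is `suc b`, so the first digit is the remainder and the
  -- others form the quotient.
  code-injective : ∀ b {A : Set} (f g : A → ℕ) xs → (∀ x → f x ℕ.≤ b) → (∀ x → g x ℕ.≤ b) →
    code (suc b) (map f xs) ≡ code (suc b) (map g xs) → map f xs ≡ map g xs
  code-injective b f g [] hf hg e = refl
  code-injective b f g (x ∷ xs) hf hg e = cong₂ _∷_ head (code-injective b f g xs hf hg tail)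
    where
    F G : ℕ
    F = code (suc b) (map f xs)
    G = code (suc b) (map g xs)
    head : f x ≡ g x
    head = trans (sym (ℕD.m<n⇒m%n≡m (s≤s (hf x)))) (trans (sym (ℕD.[m+kn]%n≡m%n (f x) F (suc b)))
      (trans (cong (ℕ._% suc b) e) (trans (ℕD.[m+kn]%n≡m%n (g x) G (suc b)) (ℕD.m<n⇒m%n≡m (s≤s (hg x))))))
    tail : F ≡ G
    tail = ℕₚ.*-cancelʳ-≡ F G (suc b) (ℕₚ.+-cancelˡ-≡ (f x) (F ℕ.* suc b) (G ℕ.* suc b) (trans e (cong (ℕ._+ G ℕ.* suc b) (sym head))))

  indicator-dot : ∀ {n} (X Y : Subset n) → sum (λ j → indicator X j * indicator Y j) ≡ ι ∣ Y ∩ X ∣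
  indicator-dot [] [] = refl
  indicator-dot (true ∷ X) (true ∷ Y) = cong (1ℚ +_) (indicator-dot X Y)
  indicator-dot (true ∷ X) (false ∷ Y) = trans (+-identityˡ _) (indicator-dot X Y)
  indicator-dot (false ∷ X) (true ∷ Y) = trans (+-identityˡ _) (indicator-dot X Y)
  indicator-dot (false ∷ X) (false ∷ Y) = trans (+-identityˡ _) (indicator-dot X Y)

  -- Maximising this functional maximises |B ∩ C| for all members C of a chain at
  -- once, and its maximum encodes the ranks as digits in base n + 1.
  chainWeight : ∀ {n} → List (Subset n) → Point n
  chainWeight [] j = 0ℚ
  chainWeight {n} (C ∷ Cs) j = indicator C j + chainWeight Cs j * ι (suc n)

  chainWeight-dot : ∀ {n} Cs (B : Subset n) → sum (λ j → chainWeight Cs j * indicator B j) ≡ ι (code (suc n) (map (λ C → ∣ B ∩ C ∣) Cs))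
  chainWeight-dot {n} [] B = sum-0 n λ j → *-zeroˡ (indicator B j)
  chainWeight-dot {n} (C ∷ Cs) B = begin
    sum (λ j → (indicator C j + chainWeight Cs j * ι (suc n)) * indicator B j)
      ≡⟨ sum-cong-≗ (λ j → solve 4 (λ c w b i → (c :+ w :* b) :* i := c :* i :+ b :* (w :* i)) refl (indicator C j) (chainWeight Cs j) (ι (suc n)) (indicator B j)) ⟩
    sum (λ j → indicator C j * indicator B j + ι (suc n) * (chainWeight Cs j * indicator B j))
      ≡⟨ ∑-distrib-+ (λ j → indicator C j * indicator B j) (λ j → ι (suc n) * (chainWeight Cs j * indicator B j)) ⟩
    sum (λ j → indicator C j * indicator B j) + sum (λ j → ι (suc n) * (chainWeight Cs j * indicator B j))
      ≡⟨ cong₂ _+_ (indicator-dot C B) (sym (*-distribˡ-sum (ι (suc n)) (λ j → chainWeight Cs j * indicator B j))) ⟩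
    ι ∣ B ∩ C ∣ + ι (suc n) * sum (λ j → chainWeight Cs j * indicator B j)
      ≡⟨ cong (λ a → ι ∣ B ∩ C ∣ + ι (suc n) * a) (chainWeight-dot Cs B) ⟩
    ι ∣ B ∩ C ∣ + ι (suc n) * ι K
      ≡⟨ cong (ι ∣ B ∩ C ∣ +_) (trans (*-comm (ι (suc n)) (ι K)) (sym (ι-* K (suc n)))) ⟩
    ι ∣ B ∩ C ∣ + ι (K ℕ.* suc n)
      ≡⟨ sym (ι-+ ∣ B ∩ C ∣ (K ℕ.* suc n)) ⟩
    ι (∣ B ∩ C ∣ ℕ.+ K ℕ.* suc n) ∎
    where
    open ≡-Reasoning
    K : ℕ
    K = code (suc n) (map (λ C → ∣ B ∩ C ∣) Cs)

  map-cong-All : ∀ {A : Set} {f g : A → ℕ} {xs} → All (λ x → f x ≡ g x) xs → map f xs ≡ map g xs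
  map-cong-All [] = refl
  map-cong-All (e ∷ es) = cong₂ _∷_ e (map-cong-All es)

  module _ {n} {N : RawMatroid n} (IN : IsMatroid N) (gN : ground N ≡ ⊤) (Cs : List (Subset n)) (asc : Ascending ⊥ Cs) where

    -- Every basis B satisfies |B ∩ C| ≤ rk C digit by digit, and the greedy basis of the chain
    -- attains equality in all digits at once.
    chain-max : IsMax (support (chainWeight Cs)) (vertices N) (ι (code (suc n) (map (rk N) Cs)))
    chain-max = All.tabulate upper , attained (greedy-basis IN gN Cs asc)
      where
      upper : ∀ {v} → v ∈ vertices N → app (support (chainWeight Cs)) v ≤ ι (code (suc n) (map (rk N) Cs)) * v zero
      upper {v} k = at (∈-vertices⁻ N k)
        where
        at : (Σ (Subset n) λ B → IsBasis N B × v ≡ hom (indicator B)) → app (support (chainWeight Cs)) v ≤ ι (code (suc n) (map (rk N) Cs)) * v zero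
        at (B , b , refl) = subst₂ _≤_ (sym (chainWeight-dot Cs B)) (sym (*-identityʳ _))
          (ι-mono (code-mono (suc n) (λ C → ∣ B ∩ C ∣) (rk N) Cs λ C → independent-∩ IN C (proj₁ (proj₂ b))))
      attained : (Σ (Subset n) λ B → IsBasis N B × All (λ C → ∣ B ∩ C ∣ ≡ rk N C) Cs) →
        Σ (Point (suc n)) λ m → m ∈ vertices N × app (support (chainWeight Cs)) m ≡ ι (code (suc n) (map (rk N) Cs)) * m zero
      attained (B , b , al) = hom (indicator B) , ∈-vertices N b ,
        trans (chainWeight-dot Cs B) (trans (cong (λ l → ι (code (suc n) l)) (map-cong-All al)) (sym (*-identityʳ (ι (code (suc n) (map (rk N) Cs))))))

    chain-hi : hiG (support (chainWeight Cs)) (vertices N) (vertices-weight N) ≡ ι (code (suc n) (map (rk N) Cs))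
    chain-hi = let m , k , _ = proj₂ chain-max in
      max-unique (support (chainWeight Cs)) (vertices-weight N)
        (All.tabulate (hiG-≥ (support (chainWeight Cs)) (vertices N) (vertices-weight N)) , hiG-attained (support (chainWeight Cs)) (vertices N) (vertices-weight N) k)
        chain-max

  rk≤n : ∀ {n} {N : RawMatroid n} → IsMatroid N → ∀ X → rk N X ℕ.≤ n
  rk≤n IN X = ℕₚ.≤-trans (IsMatroid.rk-card IN X) (∣p∣≤n X)

  module _ {n} {M : RawMatroid n} (IM : IsMatroid M) (gM : ground M ≡ ⊤) {s} {Ms : Fin s → RawMatroid n} (S : IsSubdivision M s Ms)
           {d} (hd : HasDim M d) {dims : Fin s → ℕ} (hds : ∀ i → HasDim (Ms i) (dims i))
           (int : Fin s → Bool) (hint : ∀ i → (int i ≡ true → NotInBoundary M (Ms i)) × (NotInBoundary M (Ms i) → int i ≡ true)) where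

    open IsSubdivision S using (pieces-matroid; pieces-ground)

    private
      cell-matroid : ∀ c → IsMatroid (cell S hd hds int hint c)
      cell-matroid nothing = IM
      cell-matroid (just i) = pieces-matroid i

      cell-ground : ∀ c → ground (cell S hd hds int hint c) ≡ ⊤
      cell-ground nothing = gM
      cell-ground (just i) = pieces-ground i

    -- The height of each cell is the code of its ranks along the chain, and since ranks are at most
    -- n the code can be decoded; so heights and rank lists determine each other.
    chain-valuation : ∀ Cs → Ascending ⊥ Cs → (g : List ℕ → ℤ) →
      g (map (rk M) Cs) ≡ sumL (λ i → signAt d dims int i ℤ.* g (map (rk (Ms i)) Cs)) (allFin s)
    chain-valuation Cs asc g = valuation S hd hds int hint (chainWeight Cs) (Listₚ.≡-dec ℕ._≟_) key to from g
      where
      key : Maybe (Fin s) → List ℕ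
      key c = map (rk (cell S hd hds int hint c)) Cs
      heights : ∀ c → height S hd hds int hint (chainWeight Cs) c ≡ ι (code (suc n) (key c))
      heights nothing = chain-hi IM gM Cs asc
      heights (just i) = chain-hi (pieces-matroid i) (pieces-ground i) Cs asc
      to : ∀ c c' → height S hd hds int hint (chainWeight Cs) c ≡ height S hd hds int hint (chainWeight Cs) c' → key c ≡ key c'
      to c c' e = code-injective n _ _ Cs (rk≤n (cell-matroid c)) (rk≤n (cell-matroid c')) (ι-injective (trans (sym (heights c)) (trans e (heights c'))))
      from : ∀ c c' → key c ≡ key c' → height S hd hds int hint (chainWeight Cs) c ≡ height S hd hds int hint (chainWeight Cs) c'
      from c c' e = trans (heights c) (trans (cong (λ l → ι (code (suc n) l)) e) (sym (heights c')))

    private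
      coordinate : ∀ {N : RawMatroid n} (IN : IsMatroid N) j → rk N ⁅ j ⁆ ≡ 0 → ∀ {B} → IsBasis N B → indicator B j ≡ 0ℚ
      coordinate {N} IN j e {B} b = at (lookup B j) refl
        where
        at : ∀ t → lookup B j ≡ t → indicator B j ≡ 0ℚ
        at false q = cong (λ t → if t then 1ℚ else 0ℚ) q
        at true q = ⊥-elim (ℕₚ.<-irrefl refl (ℕₚ.<-≤-trans (ℕₚ.≤-trans nonempty (independent-∩ IN ⁅ j ⁆ (proj₁ (proj₂ b)))) (ℕₚ.≤-reflexive e)))
          where
          nonempty : 0 ℕ.< ∣ B ∩ ⁅ j ⁆ ∣
          nonempty = subst (ℕ._≤ ∣ B ∩ ⁅ j ⁆ ∣) (Subₚ.∣⁅x⁆∣≡1 j) (Subₚ.p⊆q⇒∣p∣≤∣q∣ sub)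
            where
            sub : ⁅ j ⁆ ⊆ B ∩ ⁅ j ⁆
            sub {x} k with refl ← Subₚ.x∈⁅y⁆⇒x≡y j k = x∈p∩q⁺ (lookup⇒[]= j B q , k)

      coordinate⁻ : ∀ {N : RawMatroid n} (IN : IsMatroid N) (gN : ground N ≡ ⊤) j → (∀ {B} → IsBasis N B → indicator B j ≡ 0ℚ) → rk N ⁅ j ⁆ ≡ 0
      coordinate⁻ {N} IN gN j h = at (greedy-basis IN gN (⁅ j ⁆ ∷ []) ((λ p → ⊆-min ⁅ j ⁆ p) , tt))
        where
        at : (Σ (Subset n) λ B → IsBasis N B × All (λ C → ∣ B ∩ C ∣ ≡ rk N C) (⁅ j ⁆ ∷ [])) → rk N ⁅ j ⁆ ≡ 0
        at (B , b , e ∷ []) = trans (sym e) (ℕₚ.n≤0⇒n≡0 (subst (∣ B ∩ ⁅ j ⁆ ∣ ℕ.≤_) (Subₚ.∣⊥∣≡0 n) (Subₚ.p⊆q⇒∣p∣≤∣q∣ sub)))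
          where
          sub : B ∩ ⁅ j ⁆ ⊆ ⊥
          sub {x} k with refl ← Subₚ.x∈⁅y⁆⇒x≡y j (proj₂ (Subₚ.x∈p∩q⁻ B ⁅ j ⁆ k)) =
            ⊥-elim (1≢0 (trans (cong (λ t → if t then 1ℚ else 0ℚ) (sym ([]=⇒lookup (proj₁ (Subₚ.x∈p∩q⁻ B ⁅ j ⁆ k))))) (h b)))

      zero-coordinate : ∀ {N : RawMatroid n} j → (∀ {B} → IsBasis N B → indicator B j ≡ 0ℚ) → ∀ {x} → InP N x → x j ≡ 0ℚ
      zero-coordinate {N} j h p = comb-closed (ker-closed (ev (suc j))) (All.tabulate λ k → let B , b , e = ∈-vertices⁻ N k in trans (cong (λ v → v (suc j)) e) (h b)) (inP⇒nn N p)

    -- A loop is an element whose coordinate vanishes on the entire polytope, and each cell is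
    -- contained in P(M).
    loop⇒loop-of-cell : ∀ i j → rk M ⁅ j ⁆ ≡ 0 → rk (Ms i) ⁅ j ⁆ ≡ 0
    loop⇒loop-of-cell i j e = coordinate⁻ (pieces-matroid i) (pieces-ground i) j λ {B} b →
      zero-coordinate {M} j (coordinate IM j e) (piece⊆ S hds i (indicator B) (basis-inP (Ms i) b))

    -- A relative interior point of an interior cell lies in the relative interior of
    -- P(M), where the coordinates of non-loops are positive.
    loop-of-interior⇒loop : ∀ i j → int i ≡ true → rk (Ms i) ⁅ j ⁆ ≡ 0 → rk M ⁅ j ⁆ ≡ 0
    loop-of-interior⇒loop i j t e = at (nonempty-center (Ms i) (proj₁ (proj₂ (proj₁ (hds i))) zero))
      where
      at : Σ (Point n) (RelInt (Ms i)) → rk M ⁅ j ⁆ ≡ 0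
      at (x , p) = coordinate⁻ IM gM j λ {B} b → value B b (lookup B j) refl
        where
        q : RelInt M x
        q = interior⇒relInt S hds i (proj₁ (hint i) t) x p
        x≡0 : x j ≡ 0ℚ
        x≡0 = zero-coordinate {Ms i} j (coordinate (pieces-matroid i) j e) (relInt⇒inP (Ms i) p)
        nonneg : ∀ B → 0ℚ ≤ indicator B j
        nonneg B with lookup B j
        ... | true = 0≤1
        ... | false = ≤-refl
        value : ∀ B → IsBasis M B → ∀ t → lookup B j ≡ t → indicator B j ≡ 0ℚ
        value B b false r = cong (λ t → if t then 1ℚ else 0ℚ) r
        value B b true r = ⊥-elim (<-irrefl (sym x≡0) (pos-strict (ev (suc j))
          (All.tabulate λ k → let B' , _ , e' = ∈-vertices⁻ M k in subst (0ℚ ≤_) (cong (λ v → v (suc j)) (sym e')) (nonneg B'))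
          (∈-vertices M b) (subst (0ℚ <_) (cong (λ t → if t then 1ℚ else 0ℚ) (sym r)) 0<1) q))

-- Guarded sums over all subsets.

module SubsetSum where

  open import Defs
  open ListSum
  open import Data.Bool using (Bool; true; false; if_then_else_; not; _∧_; _∨_)
  import Data.Bool.Properties as Bool
  open import Data.Nat using (zero; suc)
  open import Data.Fin using (Fin; zero; suc)
  open import Data.Fin.Subset using (Subset; _⊆_)
  open import Data.Fin.Subset.Properties using (⊆-antisym)
  open import Data.Integer using (ℤ; 0ℤ; _+_; _*_; -_)
  open import Data.Integer.Properties
  open import Data.Vec using ([]; _∷_; lookup; _[_]%=_)
  open import Data.Vec.Properties using (lookup⇒[]=; []=⇒lookup; ≡-dec)
  open import Data.Empty using (⊥-elim)
  open import Data.List using ([]; _∷_; _++_; map; foldr)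
  import Data.List as List
  open import Data.List.Relation.Unary.All as All using (_∷_)
  open import Function using (_∘_; id)
  open import Relation.Nullary using (¬_; Dec)
  open import Relation.Binary.PropositionalEquality

  infixr 4 _▹_

  _▹_ : Bool → ℤ → ℤ
  b ▹ x = if b then x else 0ℤ

  ▹-cong : ∀ b {x y} → (b ≡ true → x ≡ y) → (b ▹ x) ≡ (b ▹ y)
  ▹-cong true h = h refl
  ▹-cong false h = refl

  ▹-0 : ∀ b → (b ▹ 0ℤ) ≡ 0ℤ
  ▹-0 true = refl
  ▹-0 false = refl

  ▹-∧ : ∀ a b x → ((a ∧ b) ▹ x) ≡ (a ▹ b ▹ x)
  ▹-∧ true b x = refl
  ▹-∧ false b x = refl

  ▹-swap : ∀ a b x → (a ▹ b ▹ x) ≡ (b ▹ a ▹ x)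
  ▹-swap true b x = refl
  ▹-swap false b x = sym (▹-0 b)

  *-▹ : ∀ b x y → x * (b ▹ y) ≡ (b ▹ x * y)
  *-▹ true x y = refl
  *-▹ false x y = *-zeroʳ x

  ▹-neg : ∀ b x → (b ▹ (- x)) ≡ - (b ▹ x)
  ▹-neg true x = refl
  ▹-neg false x = refl

  bool-ext : ∀ {a b} → (a ≡ true → b ≡ true) → (b ≡ true → a ≡ true) → a ≡ b
  bool-ext {true} {b} f g = sym (f refl)
  bool-ext {false} {true} f g = g refl
  bool-ext {false} {false} f g = refl

  not-true : ∀ {a} → ¬ a ≡ true → a ≡ false
  not-true {true} h = ⊥-elim (h refl)
  not-true {false} h = refl

  ∧-intro : ∀ {a b} → a ≡ true → b ≡ true → a ∧ b ≡ true
  ∧-intro refl refl = refl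

  ∧-left : ∀ {a b} → a ∧ b ≡ true → a ≡ true
  ∧-left {true} e = refl

  ∧-right : ∀ {a b} → a ∧ b ≡ true → b ≡ true
  ∧-right {true} e = e

  implies-intro : ∀ {a b} → (a ≡ true → b ≡ true) → not a ∨ b ≡ true
  implies-intro {true} h = h refl
  implies-intro {false} h = refl

  implies-elim : ∀ {a b} → not a ∨ b ≡ true → a ≡ true → b ≡ true
  implies-elim {true} e refl = e

  sumL-swap : ∀ {A B : Set} (f : A → B → ℤ) xs ys → sumL (λ x → sumL (f x) ys) xs ≡ sumL (λ y → sumL (λ x → f x y) xs) ys
  sumL-swap f [] ys = sym (sumL-zero ys (All.universal (λ _ → refl) ys))
  sumL-swap f (x ∷ xs) ys = trans (cong (λ a → sumL (f x) ys + a) (sumL-swap f xs ys)) (sym (sumL-+ (f x) (λ y → sumL (λ x → f x y) xs) ys))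

  sumL-▹ : ∀ {A : Set} b (f : A → ℤ) xs → sumL (λ x → b ▹ f x) xs ≡ (b ▹ sumL f xs)
  sumL-▹ true f xs = refl
  sumL-▹ false f xs = sumL-zero xs (All.universal (λ _ → refl) xs)

  sumL-++ : ∀ {A : Set} (f : A → ℤ) xs ys → sumL f (xs ++ ys) ≡ sumL f xs + sumL f ys
  sumL-++ f [] ys = sym (+-identityˡ (sumL f ys))
  sumL-++ f (x ∷ xs) ys = trans (cong (λ a → f x + a) (sumL-++ f xs ys)) (sym (+-assoc (f x) (sumL f xs) (sumL f ys)))

  sumL-filterᵇ : ∀ {A : Set} p (f : A → ℤ) xs → sumL f (filterᵇ p xs) ≡ sumL (λ x → p x ▹ f x) xs
  sumL-filterᵇ p f [] = refl
  sumL-filterᵇ p f (x ∷ xs) with p x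
  ... | true = cong (λ a → f x + a) (sumL-filterᵇ p f xs)
  ... | false = trans (sumL-filterᵇ p f xs) (sym (+-identityˡ (sumL (λ x → p x ▹ f x) xs)))

  sumℤ-map : ∀ {A : Set} (f : A → ℤ) xs → sumℤ (map f xs) ≡ sumL f xs
  sumℤ-map f [] = refl
  sumℤ-map f (x ∷ xs) = cong (λ a → f x + a) (sumℤ-map f xs)

  sumₚ-map : ∀ {A : Set} (f : A → Poly) xs k → sumₚ (map f xs) k ≡ sumL (λ x → f x k) xs
  sumₚ-map f [] k = refl
  sumₚ-map f (x ∷ xs) k = cong (λ a → f x k + a) (sumₚ-map f xs k)

  sumS : ∀ {n} → (Subset n → ℤ) → ℤ
  sumS {n} f = sumL f (allSub n)

  sumS-ext : ∀ {n} {f g : Subset n → ℤ} → (∀ X → f X ≡ g X) → sumS f ≡ sumS g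
  sumS-ext {n} e = sumL-ext e (allSub n)

  sumS-0 : ∀ {n} {f : Subset n → ℤ} → (∀ X → f X ≡ 0ℤ) → sumS f ≡ 0ℤ
  sumS-0 {n} e = sumL-zero (allSub n) (All.universal e (allSub n))

  sumS-suc : ∀ {n} (f : Subset (suc n) → ℤ) → sumS f ≡ sumS (λ X → f (true ∷ X)) + sumS (λ X → f (false ∷ X))
  sumS-suc {n} f = trans (sumL-++ f (map (true ∷_) (allSub n)) (map (false ∷_) (allSub n)))
    (cong₂ _+_ (sumL-map (true ∷_) f (allSub n)) (sumL-map (false ∷_) f (allSub n)))

  sumS-single : ∀ {n} (f : Subset n → ℤ) X₀ → (∀ X → X ≢ X₀ → f X ≡ 0ℤ) → sumS f ≡ f X₀
  sumS-single f [] h = +-identityʳ (f [])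
  sumS-single f (true ∷ X₀) h = trans (sumS-suc f) (trans (cong₂ _+_
    (sumS-single (λ X → f (true ∷ X)) X₀ λ X ne → h (true ∷ X) λ { refl → ne refl }) (sumS-0 λ X → h (false ∷ X) λ ())) (+-identityʳ (f (true ∷ X₀))))
  sumS-single f (false ∷ X₀) h = trans (sumS-suc f) (trans (cong₂ _+_
    (sumS-0 λ X → h (true ∷ X) λ ()) (sumS-single (λ X → f (false ∷ X)) X₀ λ X ne → h (false ∷ X) λ { refl → ne refl })) (+-identityˡ (f (false ∷ X₀))))

  sumS-▹-single : ∀ {n} (p : Subset n → Bool) (f : Subset n → ℤ) X₀ → p X₀ ≡ true → (∀ X → p X ≡ true → X ≡ X₀) → sumS (λ X → p X ▹ f X) ≡ f X₀
  sumS-▹-single p f X₀ e u = trans (sumS-single (λ X → p X ▹ f X) X₀ λ X ne → cong (λ b → b ▹ f X) (not-true λ q → ne (u X q))) (cong (λ b → b ▹ f X₀) e)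

  flip : ∀ {n} → Fin n → Subset n → Subset n
  flip i X = X [ i ]%= not

  -- Toggling i exchanges the subsets with and without i, and these two halves cancel.
  sumS-flip : ∀ {n} (i : Fin n) (f : Subset n → ℤ) → (∀ X → f (flip i X) ≡ - f X) → sumS f ≡ 0ℤ
  sumS-flip {suc n} zero f h = trans (sumS-suc f) (trans (cong (λ a → a + sumS (λ X → f (false ∷ X)))
    (trans (sumS-ext λ X → h (false ∷ X)) (sumL-neg (λ X → f (false ∷ X)) (allSub n)))) (+-inverseˡ (sumS (λ X → f (false ∷ X)))))
  sumS-flip (suc i) f h = trans (sumS-suc f) (cong₂ _+_ (sumS-flip i (λ X → f (true ∷ X)) λ X → h (true ∷ X)) (sumS-flip i (λ X → f (false ∷ X)) λ X → h (false ∷ X)))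

  _≟ˢ_ : ∀ {n} (X Y : Subset n) → Dec (X ≡ Y)
  _≟ˢ_ = ≡-dec Bool._≟_

  -- Both sides equal the double sum over the graph of the bijection, so the list `allSub` itself
  -- never has to be permuted.
  sumS-bijection : ∀ {n} (π τ : Subset n → Subset n) → (∀ X → τ (π X) ≡ X) → (∀ X → π (τ X) ≡ X) → (f : Subset n → ℤ) → sumS (λ X → f (π X)) ≡ sumS f
  sumS-bijection {n} π τ τπ πτ f = begin
    sumS (λ X → f (π X))
      ≡⟨ sumS-ext (λ X → sym (trans (sumS-single (λ Y → term X Y) (π X) λ Y ne → off X Y λ e → ne (trans (sym (πτ Y)) (cong π e))) (on X (π X) (τπ X)))) ⟩
    sumS (λ X → sumS (λ Y → term X Y))
      ≡⟨ sumL-swap term (allSub n) (allSub n) ⟩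
    sumS (λ Y → sumS (λ X → term X Y))
      ≡⟨ sumS-ext (λ Y → trans (sumS-single (λ X → term X Y) (τ Y) λ X ne → off X Y λ e → ne (sym e)) (on (τ Y) Y refl)) ⟩
    sumS f ∎
    where
    open ≡-Reasoning
    term : Subset n → Subset n → ℤ
    term X Y = 𝟙 (τ Y ≟ˢ X) * f Y
    off : ∀ X Y → ¬ τ Y ≡ X → term X Y ≡ 0ℤ
    off X Y ne = trans (cong (λ a → a * f Y) (𝟙-no (τ Y ≟ˢ X) ne)) (*-zeroˡ (f Y))
    on : ∀ X Y → τ Y ≡ X → term X Y ≡ f Y
    on X Y e = trans (cong (λ a → a * f Y) (𝟙-yes (τ Y ≟ˢ X) e)) (*-identityˡ (f Y))

  allᵇ-true : ∀ {n} (f : Fin n → Bool) → allᵇ f ≡ true → ∀ i → f i ≡ true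
  allᵇ-true {n} f e i = go n id e i
    where
    go : ∀ m (g : Fin m → Fin n) → foldr (λ i b → f i ∧ b) true (List.tabulate g) ≡ true → ∀ i → f (g i) ≡ true
    go (suc m) g e zero = ∧-left e
    go (suc m) g e (suc i) = go m (g ∘ suc) (∧-right {f (g zero)} e) i

  allᵇ-intro : ∀ {n} (f : Fin n → Bool) → (∀ i → f i ≡ true) → allᵇ f ≡ true
  allᵇ-intro {n} f h = go n id
    where
    go : ∀ m (g : Fin m → Fin n) → foldr (λ i b → f i ∧ b) true (List.tabulate g) ≡ true
    go zero g = refl
    go (suc m) g = ∧-intro (h (g zero)) (go m (g ∘ suc))

  subᵇ⇒⊆ : ∀ {n} {X Y : Subset n} → subᵇ X Y ≡ true → X ⊆ Y
  subᵇ⇒⊆ {X = X} {Y} e {i} p = lookup⇒[]= i Y (implies-elim (allᵇ-true (λ i → not (lookup X i) ∨ lookup Y i) e i) ([]=⇒lookup p))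

  ⊆⇒subᵇ : ∀ {n} {X Y : Subset n} → X ⊆ Y → subᵇ X Y ≡ true
  ⊆⇒subᵇ {X = X} {Y} h = allᵇ-intro (λ i → not (lookup X i) ∨ lookup Y i) λ i → implies-intro λ p → []=⇒lookup (h (lookup⇒[]= i X p))

  eqᵇ⇒≡ : ∀ {n} {X Y : Subset n} → eqᵇ X Y ≡ true → X ≡ Y
  eqᵇ⇒≡ {X = X} {Y} e = ⊆-antisym (subᵇ⇒⊆ (∧-left e)) (subᵇ⇒⊆ (∧-right {subᵇ X Y} e))

  eqᵇ-refl : ∀ {n} (X : Subset n) → eqᵇ X X ≡ true
  eqᵇ-refl X = ∧-intro (⊆⇒subᵇ {X = X} id) (⊆⇒subᵇ {X = X} id)

-- Closure, and Whitney's formula for the Möbius function.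

module Whitney where

  open import Defs
  open ListSum
  open SubsetSum
  open Matroid
  open import Data.Bool using (Bool; true; false; if_then_else_; not; _∧_; _∨_; T)
  open import Data.Nat using (ℕ; suc; _≤_; _<_; _≡ᵇ_; _≤ᵇ_; s≤s; s≤s⁻¹)
  import Data.Nat as ℕ
  import Data.Nat.Properties as ℕₚ
  open import Data.Fin using (Fin; zero; suc)
  import Data.Fin.Properties
  import Data.Bool.Properties as Bool
  open import Data.Fin.Subset using (Subset; _∩_; _∪_; ∁; ⁅_⁆; _⊆_; ⊥; ∣_∣; _∈_; _∉_)
  open import Data.Fin.Subset.Properties using (⊆-antisym; p⊆p∪q; q⊆p∪q; x∈p∪q⁺; x∈p∪q⁻; x∈p∩q⁺; x∉p⇒x∈∁p; x∈⁅y⁆⇒x≡y; _∈?_; ⊆-min; nonempty?; Empty-unique; ∣⊥∣≡0; p⊂q⇒∣p∣<∣q∣; ∣p∣≤n)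
  open import Data.Integer using (ℤ; 0ℤ; 1ℤ; _+_; _*_; -_; _-_)
  open import Data.Integer.Properties hiding (≤-refl; ≤-trans; _≤?_; ≤-reflexive)
  open import Data.Integer.Solver
  open +-*-Solver
  open import Data.Vec using (_∷_; lookup; tabulate)
  open import Data.Vec.Properties using (lookup⇒[]=; []=⇒lookup; lookup∘tabulate)
  open import Data.Empty using (⊥-elim)
  open import Data.List using ([]; _∷_; map; allFin)
  open import Data.List.Membership.Propositional using () renaming (_∈_ to _∈ᴸ_)
  open import Data.List.Membership.Propositional.Properties using (∈-allFin; ∈-filter⁺; ∈-filter⁻)
  open import Data.List.Relation.Unary.Any using (here; there)
  open import Data.Product using (Σ; ∃; _×_; _,_; proj₁; proj₂)
  open import Data.Sum using (inj₁; inj₂; [_,_]′)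
  open import Function using (_∘_; id)
  open import Relation.Nullary using (Dec; yes; no)
  open import Relation.Binary.PropositionalEquality

  T⇒≡ : ∀ {b} → T b → b ≡ true
  T⇒≡ {true} _ = refl

  ≡⇒T : ∀ {b} → b ≡ true → T b
  ≡⇒T refl = _

  ≡ᵇ-true : ∀ {a b} → a ≡ b → (a ≡ᵇ b) ≡ true
  ≡ᵇ-true {a} {b} e = T⇒≡ (ℕₚ.≡⇒≡ᵇ a b e)

  ≡ᵇ-elim : ∀ {a b} → (a ≡ᵇ b) ≡ true → a ≡ b
  ≡ᵇ-elim {a} {b} e = ℕₚ.≡ᵇ⇒≡ a b (≡⇒T e)

  ≤ᵇ-true : ∀ {a b} → a ≤ b → (a ≤ᵇ b) ≡ true
  ≤ᵇ-true p = T⇒≡ (ℕₚ.≤⇒≤ᵇ p)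

  ≤ᵇ-elim : ∀ {a b} → (a ≤ᵇ b) ≡ true → a ≤ b
  ≤ᵇ-elim {a} {b} e = ℕₚ.≤ᵇ⇒≤ a b (≡⇒T e)

  false≢true : ∀ {A : Set} → false ≡ true → A
  false≢true ()

  ∈⇒lookup : ∀ {n} {X : Subset n} {i} → i ∈ X → lookup X i ≡ true
  ∈⇒lookup = []=⇒lookup

  lookup⇒∈ : ∀ {n} {X : Subset n} {i} → lookup X i ≡ true → i ∈ X
  lookup⇒∈ {X = X} {i} = lookup⇒[]= i X

  ∉⇒lookup : ∀ {n} {X : Subset n} {i} → i ∉ X → lookup X i ≡ false
  ∉⇒lookup h = not-true λ e → h (lookup⇒∈ e)

  lookup⇒∉ : ∀ {n} {X : Subset n} {i} → lookup X i ≡ false → i ∉ X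
  lookup⇒∉ e p = false≢true (trans (sym e) (∈⇒lookup p))

  allᵇ-false : ∀ {n} (f : Fin n → Bool) → allᵇ f ≡ false → Σ (Fin n) λ i → f i ≡ false
  allᵇ-false {n} f e = go (Data.Fin.Properties.all? λ i → f i Bool.≟ true)
    where
    go : Dec (∀ i → f i ≡ true) → Σ (Fin n) λ i → f i ≡ false
    go (yes h) = false≢true (trans (sym e) (allᵇ-intro f h))
    go (no h) = let i , p = Data.Fin.Properties.¬∀⟶∃¬ n (λ i → f i ≡ true) (λ i → f i Bool.≟ true) h in i , not-true p

  sign-flip : ∀ {n} (i : Fin n) X → sign ∣ flip i X ∣ ≡ - sign ∣ X ∣
  sign-flip zero (true ∷ X) = sym (neg-involutive (sign ∣ X ∣))
  sign-flip zero (false ∷ X) = refl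
  sign-flip (suc i) (true ∷ X) = cong -_ (sign-flip i X)
  sign-flip (suc i) (false ∷ X) = sign-flip i X

  flip-∪ : ∀ {n} (i : Fin n) X → flip i X ∪ ⁅ i ⁆ ≡ X ∪ ⁅ i ⁆
  flip-∪ zero (true ∷ X) = refl
  flip-∪ zero (false ∷ X) = refl
  flip-∪ (suc i) (x ∷ X) = cong ((x ∨ false) ∷_) (flip-∪ i X)

  subᵇ-flip : ∀ {n} {i : Fin n} {Z} X → i ∈ Z → subᵇ (flip i X) Z ≡ subᵇ X Z
  subᵇ-flip {i = i} {Z} X k = bool-ext {subᵇ (flip i X) Z} {subᵇ X Z}
    (λ e → ⊆⇒subᵇ {X = X} {Z} (within (λ p → subst (_ ∈_) (sym (flip-∪ i X)) (p⊆p∪q ⁅ i ⁆ p)) (subᵇ⇒⊆ {X = flip i X} {Z} e)))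
    (λ e → ⊆⇒subᵇ {X = flip i X} {Z} (within (λ p → subst (_ ∈_) (flip-∪ i X) (p⊆p∪q ⁅ i ⁆ p)) (subᵇ⇒⊆ {X = X} {Z} e)))
    where
    within : ∀ {A B} → A ⊆ B ∪ ⁅ i ⁆ → B ⊆ Z → A ⊆ Z
    within {A} {B} h b p = [ b , (λ q → subst (_∈ Z) (sym (x∈⁅y⁆⇒x≡y i q)) k) ]′ (x∈p∪q⁻ B ⁅ i ⁆ (h p))

  flat⇒⊆ : ∀ {n} (N : RawMatroid n) {F} → isFlatᵇ N F ≡ true → F ⊆ ground N
  flat⇒⊆ N {F} e = subᵇ⇒⊆ {X = F} {ground N} (∧-left e)

  not-elim : ∀ {b} → not b ≡ true → b ≡ false
  not-elim {false} _ = refl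

  not-intro : ∀ {b} → b ≡ false → not b ≡ true
  not-intro refl = refl

  flat⇒gap : ∀ {n} (N : RawMatroid n) {F} → isFlatᵇ N F ≡ true → ∀ {i} → i ∈ ground N → i ∉ F → rk N (F ∪ ⁅ i ⁆) ≢ rk N F
  flat⇒gap N {F} e {i} p q r = false≢true (trans (sym (not-elim (implies-elim {lookup (ground N) i ∧ not (lookup F i)}
    (allᵇ-true _ (∧-right {subᵇ F (ground N)} e) i) (∧-intro (∈⇒lookup p) (not-intro (∉⇒lookup q)))))) (≡ᵇ-true r))

  flat-intro : ∀ {n} (N : RawMatroid n) {F} → F ⊆ ground N → (∀ {i} → i ∈ ground N → i ∉ F → rk N (F ∪ ⁅ i ⁆) ≢ rk N F) → isFlatᵇ N F ≡ true
  flat-intro N {F} h g = ∧-intro (⊆⇒subᵇ {X = F} {ground N} h) (allᵇ-intro _ λ i → implies-intro {lookup (ground N) i ∧ not (lookup F i)} λ e →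
    not-intro (not-true λ r → g (lookup⇒∈ (∧-left e)) (lookup⇒∉ (not-elim (∧-right {lookup (ground N) i} e))) (≡ᵇ-elim r)))

  nonflat : ∀ {n} (N : RawMatroid n) {F} → F ⊆ ground N → isFlatᵇ N F ≡ false → Σ (Fin n) λ i → i ∈ ground N × i ∉ F × rk N (F ∪ ⁅ i ⁆) ≡ rk N F
  nonflat {n} N {F} h e = go (allᵇ-false f (trans (sym (cong (_∧ allᵇ f) (⊆⇒subᵇ {X = F} {ground N} h))) e))
    where
    f : Fin n → Bool
    f i = not (lookup (ground N) i ∧ not (lookup F i)) ∨ not (rk N (F ∪ ⁅ i ⁆) ≡ᵇ rk N F)
    decode : ∀ a b c → not (a ∧ not b) ∨ not c ≡ false → a ≡ true × b ≡ false × c ≡ true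
    decode true false true _ = refl , refl , refl
    go : (Σ (Fin n) λ i → f i ≡ false) → Σ (Fin n) λ i → i ∈ ground N × i ∉ F × rk N (F ∪ ⁅ i ⁆) ≡ rk N F
    go (i , e) = let a , b , c = decode (lookup (ground N) i) (lookup F i) (rk N (F ∪ ⁅ i ⁆) ≡ᵇ rk N F) e in i , lookup⇒∈ a , lookup⇒∉ b , ≡ᵇ-elim c

  -- In terms of K = A ∪ F this is a signed sum over all K between F and E. Toggling
  -- an element of the closure of F shows that it vanishes unless F is a flat, so that
  -- sums over flats extend to sums over all subsets.
  W : ∀ {n} → (Subset n → ℕ) → Subset n → Subset n → (ℕ → ℤ) → ℤ
  W ρ E F g = sumS λ A → subᵇ A (E ∩ ∁ F) ▹ sign ∣ A ∣ * g (ρ (A ∪ F))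

  -- The alternating sum over the spanning subsets of X, which for a flat X is the Möbius value from
  -- the empty set to X by `möb-whitney`.
  whitney : ∀ {n} → (Subset n → ℕ) → Subset n → ℤ
  whitney ρ X = sumS λ A → subᵇ A X ▹ (ρ A ≡ᵇ ρ X) ▹ sign ∣ A ∣

  module _ {n} {N : RawMatroid n} (IN : IsMatroid N) where

    open IsMatroid IN

    private
      ρ : Subset n → ℕ
      ρ = rk N
      E : Subset n
      E = ground N

    -- Submodularity for B ∪ F and `F ∪ ⁅ i ⁆`: an element in the closure of F stays in the closure
    -- of every larger set.
    absorb : ∀ {i F} B → ρ (F ∪ ⁅ i ⁆) ≡ ρ F → ρ (B ∪ F) ≡ ρ ((B ∪ ⁅ i ⁆) ∪ F)
    absorb {i} {F} B e = ℕₚ.≤-antisym (rk-mono (B ∪ F) ((B ∪ ⁅ i ⁆) ∪ F) λ p → [ (λ q → x∈p∪q⁺ (inj₁ (x∈p∪q⁺ (inj₁ q)))) , (λ q → x∈p∪q⁺ (inj₂ q)) ]′ (x∈p∪q⁻ B F p))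
      (ℕₚ.+-cancelʳ-≤ (ρ F) (ρ ((B ∪ ⁅ i ⁆) ∪ F)) (ρ (B ∪ F)) (ℕₚ.≤-trans (submod IN ((B ∪ ⁅ i ⁆) ∪ F) (B ∪ F) (F ∪ ⁅ i ⁆) F cover (q⊆p∪q B F) (p⊆p∪q ⁅ i ⁆))
        (ℕₚ.≤-reflexive (cong (ρ (B ∪ F) ℕ.+_) e))))
      where
      cover : (B ∪ ⁅ i ⁆) ∪ F ⊆ (B ∪ F) ∪ (F ∪ ⁅ i ⁆)
      cover p = [ (λ q → [ (λ r → x∈p∪q⁺ (inj₁ (x∈p∪q⁺ (inj₁ r)))) , (λ r → x∈p∪q⁺ (inj₂ (x∈p∪q⁺ (inj₂ r)))) ]′ (x∈p∪q⁻ B ⁅ i ⁆ q))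
        , (λ q → x∈p∪q⁺ (inj₁ (x∈p∪q⁺ (inj₂ q)))) ]′ (x∈p∪q⁻ (B ∪ ⁅ i ⁆) F p)

    W-nonflat : ∀ {F} → F ⊆ E → isFlatᵇ N F ≡ false → ∀ g → W ρ E F g ≡ 0ℤ
    W-nonflat {F} h e g = go (nonflat N h e)
      where
      go : (Σ (Fin n) λ i → i ∈ E × i ∉ F × ρ (F ∪ ⁅ i ⁆) ≡ ρ F) → W ρ E F g ≡ 0ℤ
      go (i , p , q , r) = sumS-flip i _ λ A → trans (cong₂ (λ b x → b ▹ x) (subᵇ-flip A (x∈p∩q⁺ (p , x∉p⇒x∈∁p q)))
          (trans (cong₂ (λ s x → s * g x) (sign-flip i A) (same A)) (sym (neg-distribˡ-* (sign ∣ A ∣) (g (ρ (A ∪ F)))))))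
        (▹-neg (subᵇ A (E ∩ ∁ F)) (sign ∣ A ∣ * g (ρ (A ∪ F))))
        where
        same : ∀ A → ρ (flip i A ∪ F) ≡ ρ (A ∪ F)
        same A = trans (absorb (flip i A) r) (trans (cong (λ B → ρ (B ∪ F)) (flip-∪ i A)) (sym (absorb A r)))

    cl : Subset n → Subset n
    cl A = tabulate λ i → lookup E i ∧ (ρ (A ∪ ⁅ i ⁆) ≡ᵇ ρ A)

    cl-intro : ∀ {A i} → i ∈ E → ρ (A ∪ ⁅ i ⁆) ≡ ρ A → i ∈ cl A
    cl-intro {A} {i} p e = lookup⇒∈ (trans (lookup∘tabulate _ i) (∧-intro (∈⇒lookup p) (≡ᵇ-true e)))

    cl-elim : ∀ {A i} → i ∈ cl A → i ∈ E × ρ (A ∪ ⁅ i ⁆) ≡ ρ A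
    cl-elim {A} {i} p = lookup⇒∈ (∧-left e) , ≡ᵇ-elim (∧-right {lookup E i} e)
      where
      e : lookup E i ∧ (ρ (A ∪ ⁅ i ⁆) ≡ᵇ ρ A) ≡ true
      e = trans (sym (lookup∘tabulate _ i)) (∈⇒lookup p)

    ∪-absorb : ∀ {A B : Subset n} → B ⊆ A → A ∪ B ≡ A
    ∪-absorb {A} {B} h = ⊆-antisym (λ p → [ id , h ]′ (x∈p∪q⁻ A B p)) (p⊆p∪q B)

    ⊆cl : ∀ {A} → A ⊆ E → A ⊆ cl A
    ⊆cl {A} h {i} p = cl-intro (h p) (cong ρ (∪-absorb λ q → subst (_∈ A) (sym (x∈⁅y⁆⇒x≡y i q)) p))

    spans-closure : ∀ A zs → (∀ {z} → z ∈ᴸ zs → ρ (A ∪ ⁅ z ⁆) ≡ ρ A) → Spans IN A zs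
    spans-closure A [] h W' k = rk-mono W' A λ p → [ id , (λ ()) ]′ (k p)
    spans-closure A (z ∷ zs) h W' k = ℕₚ.≤-trans (spans-step IN A z zs (spans-closure A zs (h ∘ there)) W' λ p → [ (λ q → inj₁ (p⊆p∪q ⁅ z ⁆ q)) , inj₂ ]′ (k p))
      (ℕₚ.≤-reflexive (h (here refl)))

    rk-cl : ∀ {A} → A ⊆ E → ρ A ≡ ρ (cl A)
    rk-cl {A} h = ℕₚ.≤-antisym (rk-mono A (cl A) (⊆cl h)) (spans-closure A (elements IN (cl A))
      (λ k → proj₂ (cl-elim (proj₂ (∈-filter⁻ (_∈? cl A) {xs = allFin n} k)))) (cl A) λ {x} p → inj₂ (∈-filter⁺ (_∈? cl A) (∈-allFin x) p))

    cl-flat : ∀ {A} → A ⊆ E → isFlatᵇ N (cl A) ≡ true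
    cl-flat {A} h = flat-intro N (λ p → proj₁ (cl-elim p)) λ {i} p q e → q (cl-intro p (ℕₚ.≤-antisym
      (ℕₚ.≤-trans (rk-mono (A ∪ ⁅ i ⁆) (cl A ∪ ⁅ i ⁆) λ r → [ (λ s → p⊆p∪q ⁅ i ⁆ (⊆cl h s)) , (λ s → q⊆p∪q (cl A) ⁅ i ⁆ s) ]′ (x∈p∪q⁻ A ⁅ i ⁆ r))
        (ℕₚ.≤-reflexive (trans e (sym (rk-cl h)))))
      (rk-mono A (A ∪ ⁅ i ⁆) (p⊆p∪q ⁅ i ⁆))))

    cl-least : ∀ {A Z} → isFlatᵇ N Z ≡ true → A ⊆ Z → cl A ⊆ Z
    cl-least {A} {Z} f h {i} p = decide (i ∈? Z)
      where
      decide : Dec (i ∈ Z) → i ∈ Z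
      decide (yes q) = q
      decide (no q) = ⊥-elim (flat⇒gap N f (proj₁ (cl-elim p)) q (ℕₚ.≤-antisym
        (ℕₚ.+-cancelʳ-≤ (ρ A) (ρ (Z ∪ ⁅ i ⁆)) (ρ Z) (ℕₚ.≤-trans (submod IN (Z ∪ ⁅ i ⁆) Z (A ∪ ⁅ i ⁆) A
          (λ r → [ (λ s → x∈p∪q⁺ (inj₁ s)) , (λ s → x∈p∪q⁺ (inj₂ (x∈p∪q⁺ (inj₂ s)))) ]′ (x∈p∪q⁻ Z ⁅ i ⁆ r)) h (p⊆p∪q ⁅ i ⁆))
          (ℕₚ.≤-reflexive (cong (ρ Z ℕ.+_) (proj₂ (cl-elim p))))))
        (rk-mono Z (Z ∪ ⁅ i ⁆) (p⊆p∪q ⁅ i ⁆))))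

    cl-unique : ∀ {A Z} → isFlatᵇ N Z ≡ true → A ⊆ Z → ρ A ≡ ρ Z → Z ≡ cl A
    cl-unique {A} {Z} f h e = ⊆-antisym (λ {i} p → cl-intro (flat⇒⊆ N f p) (ℕₚ.≤-antisym
        (ℕₚ.≤-trans (rk-mono (A ∪ ⁅ i ⁆) Z λ q → [ h , (λ r → subst (_∈ Z) (sym (x∈⁅y⁆⇒x≡y i r)) p) ]′ (x∈p∪q⁻ A ⁅ i ⁆ q)) (ℕₚ.≤-reflexive (sym e)))
        (rk-mono A (A ∪ ⁅ i ⁆) (p⊆p∪q ⁅ i ⁆))))
      (cl-least f h)

    -- The closure of A is the only flat that contains A and has the same rank.
    sum-flats-over : ∀ {A} → A ⊆ E → (h : Subset n → ℤ) → sumS (λ Z → isFlatᵇ N Z ▹ subᵇ A Z ▹ (ρ A ≡ᵇ ρ Z) ▹ h Z) ≡ h (cl A)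
    sum-flats-over {A} a h = trans (sumS-ext λ Z → trans (cong (isFlatᵇ N Z ▹_) (sym (▹-∧ (subᵇ A Z) (ρ A ≡ᵇ ρ Z) (h Z)))) (sym (▹-∧ (isFlatᵇ N Z) (subᵇ A Z ∧ (ρ A ≡ᵇ ρ Z)) (h Z))))
      (sumS-▹-single (λ Z → isFlatᵇ N Z ∧ (subᵇ A Z ∧ (ρ A ≡ᵇ ρ Z))) h (cl A)
        (∧-intro (cl-flat a) (∧-intro (⊆⇒subᵇ {X = A} {cl A} (⊆cl a)) (≡ᵇ-true (rk-cl a))))
        λ Z e → cl-unique (∧-left e) (subᵇ⇒⊆ {X = A} {Z} (∧-left (∧-right {isFlatᵇ N Z} e))) (≡ᵇ-elim (∧-right {subᵇ A Z} (∧-right {isFlatᵇ N Z} e))))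

    -- Whitney: every subset of a flat X has its closure among the flats below X.
    sum-whitney-below : ∀ {X} → isFlatᵇ N X ≡ true → sumS (λ Z → isFlatᵇ N Z ▹ subᵇ Z X ▹ whitney ρ Z) ≡ sumS (λ A → subᵇ A X ▹ sign ∣ A ∣)
    sum-whitney-below {X} f = begin
      sumS (λ Z → isFlatᵇ N Z ▹ subᵇ Z X ▹ whitney ρ Z)
        ≡⟨ sumS-ext (λ Z → sym (trans (sumL-▹ (isFlatᵇ N Z) (λ A → subᵇ Z X ▹ term A Z) (allSub n)) (cong (isFlatᵇ N Z ▹_) (sumL-▹ (subᵇ Z X) (λ A → term A Z) (allSub n))))) ⟩
      sumS (λ Z → sumS (λ A → isFlatᵇ N Z ▹ subᵇ Z X ▹ term A Z))
        ≡⟨ sumL-swap (λ Z A → isFlatᵇ N Z ▹ subᵇ Z X ▹ term A Z) (allSub n) (allSub n) ⟩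
      sumS (λ A → sumS (λ Z → isFlatᵇ N Z ▹ subᵇ Z X ▹ term A Z))
        ≡⟨ sumS-ext (λ A → at A (subᵇ A X) refl) ⟩
      sumS (λ A → subᵇ A X ▹ sign ∣ A ∣) ∎
      where
      open ≡-Reasoning
      term : Subset n → Subset n → ℤ
      term A Z = subᵇ A Z ▹ (ρ A ≡ᵇ ρ Z) ▹ sign ∣ A ∣
      at : ∀ A b → subᵇ A X ≡ b → sumS (λ Z → isFlatᵇ N Z ▹ subᵇ Z X ▹ term A Z) ≡ (b ▹ sign ∣ A ∣)
      at A true e = trans (sumS-ext λ Z → cong (isFlatᵇ N Z ▹_) (trans (▹-swap (subᵇ Z X) (subᵇ A Z) ((ρ A ≡ᵇ ρ Z) ▹ sign ∣ A ∣))
          (cong (subᵇ A Z ▹_) (▹-swap (subᵇ Z X) (ρ A ≡ᵇ ρ Z) (sign ∣ A ∣)))))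
        (trans (sum-flats-over (λ p → flat⇒⊆ N f (subᵇ⇒⊆ {X = A} {X} e p)) (λ Z → subᵇ Z X ▹ sign ∣ A ∣)) (cong (_▹ sign ∣ A ∣) (⊆⇒subᵇ {X = cl A} {X} (cl-least f (subᵇ⇒⊆ {X = A} {X} e)))))
      at A false e = sumS-0 λ Z → trans (▹-cong (isFlatᵇ N Z) λ _ → trans (▹-cong (subᵇ Z X) λ zx → trans (▹-cong (subᵇ A Z) λ az →
          false≢true (trans (sym e) (⊆⇒subᵇ {X = A} {X} λ p → subᵇ⇒⊆ {X = Z} {X} zx (subᵇ⇒⊆ {X = A} {Z} az p)))) (▹-0 (subᵇ A Z))) (▹-0 (subᵇ Z X))) (▹-0 (isFlatᵇ N Z))

    -- Both sides obey one recursion: summed over the flats below X they give the alternating sum of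
    -- all subsets of X, which is 0 unless X is empty. The fuel suffices because each step passes to
    -- a smaller set.
    möb-whitney : ∀ k X → isFlatᵇ N X ≡ true → ∣ X ∣ < k → möb N k ⊥ X ≡ whitney ρ X
    möb-whitney (suc k) X f l = decide (eqᵇ ⊥ X) refl
      where
      open ≡-Reasoning
      P : Subset n → Bool
      P Z = subᵇ ⊥ Z ∧ subᵇ Z X ∧ not (eqᵇ Z X)
      S : ℤ
      S = sumℤ (map (möb N k ⊥) (filterᵇ P (flats N)))
      smaller : ∀ {Z} → P Z ≡ true → ∣ Z ∣ < k
      smaller {Z} e = ℕₚ.<-≤-trans (p⊂q⇒∣p∣<∣q∣ (sub , strict)) (s≤s⁻¹ l)
        where
        sub : Z ⊆ X
        sub = subᵇ⇒⊆ {X = Z} {X} (∧-left (∧-right {subᵇ ⊥ Z} e))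
        strict : ∃ λ x → x ∈ X × x ∉ Z
        strict = let i , q = allᵇ-false _ (not-true {subᵇ X Z} λ r → false≢true (trans (sym (not-elim {eqᵇ Z X} (∧-right {subᵇ Z X} (∧-right {subᵇ ⊥ Z} e)))) (∧-intro (⊆⇒subᵇ {X = Z} {X} sub) r)))
                 in i , decode (lookup X i) (lookup Z i) refl refl q
          where
          decode : ∀ {i} a b → lookup X i ≡ a → lookup Z i ≡ b → not a ∨ b ≡ false → i ∈ X × i ∉ Z
          decode true false p q _ = lookup⇒∈ p , lookup⇒∉ q
      S≡ : S ≡ sumS (λ Z → isFlatᵇ N Z ▹ P Z ▹ whitney ρ Z)
      S≡ = begin
        sumℤ (map (möb N k ⊥) (filterᵇ P (flats N)))
          ≡⟨ sumℤ-map (möb N k ⊥) (filterᵇ P (flats N)) ⟩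
        sumL (möb N k ⊥) (filterᵇ P (flats N))
          ≡⟨ sumL-filterᵇ P (möb N k ⊥) (flats N) ⟩
        sumL (λ Z → P Z ▹ möb N k ⊥ Z) (flats N)
          ≡⟨ sumL-filterᵇ (isFlatᵇ N) (λ Z → P Z ▹ möb N k ⊥ Z) (allSub n) ⟩
        sumS (λ Z → isFlatᵇ N Z ▹ P Z ▹ möb N k ⊥ Z)
          ≡⟨ sumS-ext (λ Z → ▹-cong (isFlatᵇ N Z) λ z → ▹-cong (P Z) λ p → möb-whitney k Z z (smaller {Z} p)) ⟩
        sumS (λ Z → isFlatᵇ N Z ▹ P Z ▹ whitney ρ Z) ∎
      split : sumS (λ Z → isFlatᵇ N Z ▹ subᵇ Z X ▹ whitney ρ Z) ≡ sumS (λ Z → isFlatᵇ N Z ▹ P Z ▹ whitney ρ Z) + whitney ρ X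
      split = begin
        sumS (λ Z → isFlatᵇ N Z ▹ subᵇ Z X ▹ whitney ρ Z)
          ≡⟨ sumS-ext (λ Z → at Z (eqᵇ Z X) refl) ⟩
        sumS (λ Z → (isFlatᵇ N Z ▹ P Z ▹ whitney ρ Z) + (eqᵇ Z X ▹ whitney ρ Z))
          ≡⟨ sumL-+ (λ Z → isFlatᵇ N Z ▹ P Z ▹ whitney ρ Z) (λ Z → eqᵇ Z X ▹ whitney ρ Z) (allSub n) ⟩
        sumS (λ Z → isFlatᵇ N Z ▹ P Z ▹ whitney ρ Z) + sumS (λ Z → eqᵇ Z X ▹ whitney ρ Z)
          ≡⟨ cong (λ a → sumS (λ Z → isFlatᵇ N Z ▹ P Z ▹ whitney ρ Z) + a) (sumS-▹-single (λ Z → eqᵇ Z X) (whitney ρ) X (eqᵇ-refl X) (λ Z e → eqᵇ⇒≡ {X = Z} e)) ⟩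
        sumS (λ Z → isFlatᵇ N Z ▹ P Z ▹ whitney ρ Z) + whitney ρ X ∎
        where
        at : ∀ Z b → eqᵇ Z X ≡ b → (isFlatᵇ N Z ▹ subᵇ Z X ▹ whitney ρ Z) ≡ (isFlatᵇ N Z ▹ P Z ▹ whitney ρ Z) + (b ▹ whitney ρ Z)
        at Z true e with refl ← eqᵇ⇒≡ {X = Z} {X} e = trans (cong₂ (λ a b → a ▹ b ▹ whitney ρ X) f (⊆⇒subᵇ {X = X} {X} id))
          (sym (trans (cong (λ b → (isFlatᵇ N X ▹ b ▹ whitney ρ X) + whitney ρ X) none) (trans (cong (_+ whitney ρ X) (▹-0 (isFlatᵇ N X))) (+-identityˡ (whitney ρ X)))))
          where
          none : P X ≡ false
          none = not-true λ p → false≢true (trans (sym (not-elim {eqᵇ X X} (∧-right {subᵇ X X} (∧-right {subᵇ ⊥ X} p)))) (eqᵇ-refl X))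
        at Z false e = trans (cong (λ b → isFlatᵇ N Z ▹ b ▹ whitney ρ Z) (bool-ext (λ p → ∧-intro (⊆⇒subᵇ {X = ⊥} {Z} (⊆-min Z)) (∧-intro p (not-intro e))) (λ p → ∧-left (∧-right {subᵇ ⊥ Z} p))))
          (sym (+-identityʳ (isFlatᵇ N Z ▹ P Z ▹ whitney ρ Z)))
      decide : ∀ b → eqᵇ ⊥ X ≡ b → (if b then 1ℤ else - S) ≡ whitney ρ X
      decide true e with refl ← eqᵇ⇒≡ {X = ⊥} {X} e = sym (trans (sumS-▹-single (λ A → subᵇ A ⊥) (λ A → (ρ A ≡ᵇ ρ ⊥) ▹ sign ∣ A ∣) ⊥ (⊆⇒subᵇ {n} {X = ⊥} {⊥} id) (λ A h → ⊆-antisym (subᵇ⇒⊆ {X = A} {⊥} h) (⊆-min A)))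
        (trans (cong (_▹ sign ∣ ⊥ {n} ∣) (≡ᵇ-true {ρ ⊥} {ρ ⊥} refl)) (cong sign (∣⊥∣≡0 n))))
      decide false e = begin
        - S ≡⟨ cong -_ S≡ ⟩
        - R ≡⟨ solve 2 (λ r w → :- r := w :- (r :+ w)) refl R (whitney ρ X) ⟩
        whitney ρ X - (R + whitney ρ X) ≡⟨ cong (λ a → whitney ρ X - a) (trans (sym split) (trans (sum-whitney-below f) zero-sum)) ⟩
        whitney ρ X - 0ℤ ≡⟨ +-identityʳ (whitney ρ X) ⟩
        whitney ρ X ∎
        where
        R : ℤ
        R = sumS (λ Z → isFlatᵇ N Z ▹ P Z ▹ whitney ρ Z)
        zero-sum : sumS (λ A → subᵇ A X ▹ sign ∣ A ∣) ≡ 0ℤ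
        zero-sum = go (nonempty? X)
          where
          go : Dec (Data.Fin.Subset.Nonempty X) → sumS (λ A → subᵇ A X ▹ sign ∣ A ∣) ≡ 0ℤ
          go (yes (i , p)) = sumS-flip i _ λ A → trans (cong₂ (λ b x → b ▹ x) (subᵇ-flip A p) (sign-flip i A)) (▹-neg (subᵇ A X) (sign ∣ A ∣))
          go (no h) with refl ← Empty-unique h = false≢true (trans (sym e) (eqᵇ-refl {n} ⊥))

    ground-flat : isFlatᵇ N E ≡ true
    ground-flat = flat-intro N id λ p q → ⊥-elim (q p)

    μ-whitney : μ N ≡ whitney ρ E
    μ-whitney = möb-whitney (suc n) E ground-flat (s≤s (∣p∣≤n E))

-- Restriction, contraction and characteristic polynomials in terms of ranks.

module KL where

  open import Defs
  open ListSum
  open SubsetSum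
  open Matroid
  open Whitney
  open import Data.Bool using (Bool; true; false; _∧_)
  open import Data.Nat using (ℕ; zero; suc; _≤_; _≡ᵇ_; _≤ᵇ_; _∸_; z≤n; s≤s⁻¹)
  import Data.Nat as ℕ
  import Data.Nat.Properties as ℕₚ
  open import Data.Fin.Subset using (Subset; _∩_; _∪_; ∁; ⁅_⁆; _⊆_; ∣_∣; _∈_)
  open import Data.Fin.Subset.Properties using (⊆-antisym; q⊆p∪q; x∈p∪q⁺; x∈p∪q⁻; x∈p∩q⁺; x∈p∩q⁻; x∉p⇒x∈∁p; x∈⁅y⁆⇒x≡y; _∈?_; p∩q⊆p; p∩q⊆q; p⊆q⇒∣p∣≤∣q∣; ∩-assoc; ∩-idem)
  open import Data.Integer using (ℤ; 0ℤ; 1ℤ; _+_; _*_)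
  open import Data.Integer.Properties hiding (≤-refl; ≤-trans; _≤?_; ≤-reflexive)
  open import Data.Integer.Solver
  open +-*-Solver
  open import Data.Product using (_,_)
  open import Data.Sum using (inj₁; inj₂; [_,_]′)
  open import Function using (id)
  open import Relation.Nullary using (Dec; yes; no)
  open import Relation.Binary.PropositionalEquality

  ∩-absorb : ∀ {n} {A B : Subset n} → A ⊆ B → A ∩ B ≡ A
  ∩-absorb {A = A} {B} h = ⊆-antisym (p∩q⊆p A B) λ p → x∈p∩q⁺ (p , h p)

  ∪-absorbˡ : ∀ {n} {A B : Subset n} → A ⊆ B → A ∪ B ≡ B
  ∪-absorbˡ {A = A} {B} h = ⊆-antisym (λ p → [ h , id ]′ (x∈p∪q⁻ A B p)) (q⊆p∪q A B)

  ∪-∁ : ∀ {n} {E F : Subset n} → F ⊆ E → (E ∩ ∁ F) ∪ F ≡ E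
  ∪-∁ {E = E} {F} h = ⊆-antisym (λ p → [ p∩q⊆p E (∁ F) , h ]′ (x∈p∪q⁻ (E ∩ ∁ F) F p)) λ {x} p → decide (x ∈? F) p
    where
    decide : ∀ {x} → Dec (x ∈ F) → x ∈ E → x ∈ (E ∩ ∁ F) ∪ F
    decide (yes q) p = x∈p∪q⁺ (inj₂ q)
    decide (no q) p = x∈p∪q⁺ (inj₁ (x∈p∩q⁺ (p , x∉p⇒x∈∁p q)))

  ∪-lub : ∀ {n} {A B C : Subset n} → A ⊆ C → B ⊆ C → A ∪ B ⊆ C
  ∪-lub {A = A} {B} f g p = [ f , g ]′ (x∈p∪q⁻ A B p)

  W-cong : ∀ {n} {ρ ρ' : Subset n → ℕ} {E F} {g g' : ℕ → ℤ} → (∀ A → A ⊆ E ∩ ∁ F → g (ρ (A ∪ F)) ≡ g' (ρ' (A ∪ F))) → W ρ E F g ≡ W ρ' E F g'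
  W-cong {E = E} {F} h = sumS-ext λ A → ▹-cong (subᵇ A (E ∩ ∁ F)) λ e → cong (sign ∣ A ∣ *_) (h A (subᵇ⇒⊆ {X = A} {E ∩ ∁ F} e))

  restrict-matroid : ∀ {n} {N : RawMatroid n} → IsMatroid N → ∀ F → IsMatroid (restrict N F)
  restrict-matroid {N = N} IN F = record
    { rk-ground = λ X → cong (rk N) (sym (trans (∩-assoc X F F) (cong (X ∩_) (∩-idem F))))
    ; rk-card = λ X → ℕₚ.≤-trans (rk-card (X ∩ F)) (p⊆q⇒∣p∣≤∣q∣ (p∩q⊆p X F))
    ; rk-mono = λ X Y h → rk-mono (X ∩ F) (Y ∩ F) λ p → let a , b = x∈p∩q⁻ X F p in x∈p∩q⁺ (h a , b)
    ; rk-submod = λ X Y → submod IN ((X ∪ Y) ∩ F) (X ∩ F) (Y ∩ F) ((X ∩ Y) ∩ F)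
        (λ p → let a , b = x∈p∩q⁻ (X ∪ Y) F p in x∈p∪q⁺ ([ (λ q → inj₁ (x∈p∩q⁺ (q , b))) , (λ q → inj₂ (x∈p∩q⁺ (q , b))) ]′ (x∈p∪q⁻ X Y a)))
        (λ p → let a , b = x∈p∩q⁻ (X ∩ Y) F p in x∈p∩q⁺ (p∩q⊆p X Y a , b))
        (λ p → let a , b = x∈p∩q⁻ (X ∩ Y) F p in x∈p∩q⁺ (p∩q⊆q X Y a , b)) }
    where open IsMatroid IN

  ∸-submod : ∀ {a b c d f} → f ≤ a → f ≤ b → f ≤ c → f ≤ d → a ℕ.+ b ≤ c ℕ.+ d → (a ∸ f) ℕ.+ (b ∸ f) ≤ (c ∸ f) ℕ.+ (d ∸ f)
  ∸-submod {a} {b} {c} {d} {f} ha hb hc hd h = ℕₚ.+-cancelʳ-≤ (f ℕ.+ f) ((a ∸ f) ℕ.+ (b ∸ f)) ((c ∸ f) ℕ.+ (d ∸ f))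
    (subst₂ _≤_ (eq ha hb) (eq hc hd) h)
    where
    open import Data.Nat.Solver using () renaming (module +-*-Solver to S)
    eq : ∀ {x y} → f ≤ x → f ≤ y → x ℕ.+ y ≡ (x ∸ f) ℕ.+ (y ∸ f) ℕ.+ (f ℕ.+ f)
    eq {x} {y} p q = trans (cong₂ ℕ._+_ (sym (ℕₚ.m∸n+n≡m p)) (sym (ℕₚ.m∸n+n≡m q)))
      (S.solve 3 (λ a b f → (a S.:+ f) S.:+ (b S.:+ f) S.:= a S.:+ b S.:+ (f S.:+ f)) refl (x ∸ f) (y ∸ f) f)

  contract-matroid : ∀ {n} {N : RawMatroid n} → IsMatroid N → ∀ F → IsMatroid (contract N F)
  contract-matroid {n} {N} IN F = record
    { rk-ground = λ X → cong (λ Z → rk N (Z ∪ F) ∸ rk N F) (sym (trans (∩-assoc X E' E') (cong (X ∩_) (∩-idem E'))))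
    ; rk-card = λ X → ℕₚ.≤-trans (ℕₚ.m≤n+o⇒m∸n≤o (rk N (up X)) (rk N F) (ℕₚ.≤-trans (subadditive IN (up X) F (X ∩ E') (λ p → [ (λ q → x∈p∪q⁺ (inj₂ q)) , (λ q → x∈p∪q⁺ (inj₁ q)) ]′ (x∈p∪q⁻ (X ∩ E') F p)))
          (ℕₚ.+-monoʳ-≤ (rk N F) (rk-card (X ∩ E'))))) (p⊆q⇒∣p∣≤∣q∣ (p∩q⊆p X E'))
    ; rk-mono = λ X Y h → ℕₚ.∸-monoˡ-≤ (rk N F) (rk-mono (up X) (up Y) (up-mono h))
    ; rk-submod = λ X Y → ∸-submod (above (X ∪ Y)) (above (X ∩ Y)) (above X) (above Y)
        (submod IN (up (X ∪ Y)) (up X) (up Y) (up (X ∩ Y)) (up-∪ X Y) (up-mono (p∩q⊆p X Y)) (up-mono (p∩q⊆q X Y))) }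
    where
    open IsMatroid IN
    E' : Subset n
    E' = ground N ∩ ∁ F
    up : Subset n → Subset n
    up X = (X ∩ E') ∪ F
    above : ∀ X → rk N F ≤ rk N (up X)
    above X = rk-mono F (up X) (q⊆p∪q (X ∩ E') F)
    up-mono : ∀ {X Y} → X ⊆ Y → up X ⊆ up Y
    up-mono {X} {Y} h p = [ (λ q → let a , b = x∈p∩q⁻ X E' q in x∈p∪q⁺ (inj₁ (x∈p∩q⁺ (h a , b)))) , (λ q → x∈p∪q⁺ (inj₂ q)) ]′ (x∈p∪q⁻ (X ∩ E') F p)
    up-∪ : ∀ X Y → up (X ∪ Y) ⊆ up X ∪ up Y
    up-∪ X Y p = [ (λ q → let a , b = x∈p∩q⁻ (X ∪ Y) E' q in
        [ (λ r → x∈p∪q⁺ (inj₁ (x∈p∪q⁺ (inj₁ (x∈p∩q⁺ (r , b)))))) , (λ r → x∈p∪q⁺ (inj₂ (x∈p∪q⁺ (inj₁ (x∈p∩q⁺ (r , b)))))) ]′ (x∈p∪q⁻ X Y a))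
      , (λ q → x∈p∪q⁺ (inj₁ (x∈p∪q⁺ (inj₂ q)))) ]′ (x∈p∪q⁻ ((X ∪ Y) ∩ E') F p)

  restrict-loopless : ∀ {n} {N : RawMatroid n} → Loopless N → ∀ {F} → F ⊆ ground N → Loopless (restrict N F)
  restrict-loopless {N = N} L {F} h i e r = L i (∈⇒lookup (h (lookup⇒∈ e)))
    (trans (cong (rk N) (sym (∩-absorb {A = ⁅ i ⁆} {F} λ q → subst (_∈ F) (sym (x∈⁅y⁆⇒x≡y i q)) (lookup⇒∈ e)))) r)

  mono-at : ∀ d k → mono d k ≡ ((k ≡ᵇ d) ▹ 1ℤ)
  mono-at zero zero = refl
  mono-at zero (suc k) = refl
  mono-at (suc d) zero = refl
  mono-at (suc d) (suc k) = mono-at d k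

  1ₚ-at : ∀ k → 1ₚ k ≡ ((k ≡ᵇ 0) ▹ 1ℤ)
  1ₚ-at zero = refl
  1ₚ-at (suc k) = refl

  module _ {n} {N : RawMatroid n} (IN : IsMatroid N) where

    open IsMatroid IN

    private
      ρ : Subset n → ℕ
      ρ = rk N
      E : Subset n
      E = ground N

    restrict-whitney : ∀ F → whitney (rk (restrict N F)) F ≡ whitney ρ F
    restrict-whitney F = sumS-ext λ A → ▹-cong (subᵇ A F) λ e →
      cong₂ (λ a b → (a ≡ᵇ b) ▹ sign ∣ A ∣) (cong ρ (∩-absorb (subᵇ⇒⊆ {X = A} {F} e))) (cong ρ (∩-idem F))

    contract-rank : ∀ {F} → F ⊆ E → rank (contract N F) ≡ ρ E ∸ ρ F
    contract-rank {F} h = cong (λ X → ρ X ∸ ρ F) (trans (cong (_∪ F) (∩-idem (E ∩ ∁ F))) (∪-∁ h))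

    -- After exchanging the sums, each A occurs at its closure alone, which has the same rank.
    sum-flats-whitney : ∀ (h : ℕ → ℤ) → sumS (λ Z → isFlatᵇ N Z ▹ whitney ρ Z * h (ρ Z)) ≡ sumS (λ A → subᵇ A E ▹ sign ∣ A ∣ * h (ρ A))
    sum-flats-whitney h = begin
      sumS (λ Z → isFlatᵇ N Z ▹ whitney ρ Z * h (ρ Z))
        ≡⟨ sumS-ext (λ Z → trans (cong (isFlatᵇ N Z ▹_) (expand Z)) (sym (sumL-▹ (isFlatᵇ N Z) (λ A → term A Z) (allSub n)))) ⟩
      sumS (λ Z → sumS (λ A → isFlatᵇ N Z ▹ term A Z))
        ≡⟨ sumL-swap (λ Z A → isFlatᵇ N Z ▹ term A Z) (allSub n) (allSub n) ⟩
      sumS (λ A → sumS (λ Z → isFlatᵇ N Z ▹ term A Z))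
        ≡⟨ sumS-ext (λ A → at A (subᵇ A E) refl) ⟩
      sumS (λ A → subᵇ A E ▹ sign ∣ A ∣ * h (ρ A)) ∎
      where
      open ≡-Reasoning
      term : Subset n → Subset n → ℤ
      term A Z = subᵇ A Z ▹ (ρ A ≡ᵇ ρ Z) ▹ sign ∣ A ∣ * h (ρ Z)
      expand : ∀ Z → whitney ρ Z * h (ρ Z) ≡ sumS (λ A → term A Z)
      expand Z = trans (*-comm (whitney ρ Z) (h (ρ Z))) (trans (sym (sumL-*ˡ (h (ρ Z)) (λ A → subᵇ A Z ▹ (ρ A ≡ᵇ ρ Z) ▹ sign ∣ A ∣) (allSub n)))
        (sumS-ext λ A → trans (*-▹ (subᵇ A Z) (h (ρ Z)) ((ρ A ≡ᵇ ρ Z) ▹ sign ∣ A ∣)) (cong (subᵇ A Z ▹_) (trans (*-▹ (ρ A ≡ᵇ ρ Z) (h (ρ Z)) (sign ∣ A ∣)) (cong ((ρ A ≡ᵇ ρ Z) ▹_) (*-comm (h (ρ Z)) (sign ∣ A ∣)))))))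
      at : ∀ A b → subᵇ A E ≡ b → sumS (λ Z → isFlatᵇ N Z ▹ term A Z) ≡ (b ▹ sign ∣ A ∣ * h (ρ A))
      at A true e = trans (sum-flats-over IN (subᵇ⇒⊆ {X = A} {E} e) (λ Z → sign ∣ A ∣ * h (ρ Z))) (cong (λ r → sign ∣ A ∣ * h r) (sym (rk-cl IN (subᵇ⇒⊆ {X = A} {E} e))))
      at A false e = sumS-0 λ Z → trans (▹-cong (isFlatᵇ N Z) λ z → trans (▹-cong (subᵇ A Z) λ az →
        false≢true (trans (sym e) (⊆⇒subᵇ {X = A} {E} λ p → flat⇒⊆ N z (subᵇ⇒⊆ {X = A} {Z} az p)))) (▹-0 (subᵇ A Z))) (▹-0 (isFlatᵇ N Z))

    χ-whitney : ∀ k → χ N k ≡ sumS (λ A → subᵇ A E ▹ (k ≡ᵇ (ρ E ∸ ρ A)) ▹ sign ∣ A ∣)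
    χ-whitney k = begin
      χ N k
        ≡⟨ sumₚ-map (λ F → scale (μ (restrict N F)) (mono (rank (contract N F)))) (flats N) k ⟩
      sumL (λ F → μ (restrict N F) * mono (rank (contract N F)) k) (flats N)
        ≡⟨ sumL-filterᵇ (isFlatᵇ N) (λ F → μ (restrict N F) * mono (rank (contract N F)) k) (allSub n) ⟩
      sumS (λ F → isFlatᵇ N F ▹ μ (restrict N F) * mono (rank (contract N F)) k)
        ≡⟨ sumS-ext (λ F → ▹-cong (isFlatᵇ N F) λ f → cong₂ _*_ (trans (μ-whitney (restrict-matroid IN F)) (restrict-whitney F))
             (trans (cong (λ d → mono d k) (contract-rank (flat⇒⊆ N f))) (mono-at (ρ E ∸ ρ F) k))) ⟩
      sumS (λ F → isFlatᵇ N F ▹ whitney ρ F * ((k ≡ᵇ (ρ E ∸ ρ F)) ▹ 1ℤ))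
        ≡⟨ sum-flats-whitney (λ r → (k ≡ᵇ (ρ E ∸ r)) ▹ 1ℤ) ⟩
      sumS (λ A → subᵇ A E ▹ sign ∣ A ∣ * ((k ≡ᵇ (ρ E ∸ ρ A)) ▹ 1ℤ))
        ≡⟨ sumS-ext (λ A → cong (subᵇ A E ▹_) (trans (*-▹ (k ≡ᵇ (ρ E ∸ ρ A)) (sign ∣ A ∣) 1ℤ) (cong ((k ≡ᵇ (ρ E ∸ ρ A)) ▹_) (*-identityʳ (sign ∣ A ∣))))) ⟩
      sumS (λ A → subᵇ A E ▹ (k ≡ᵇ (ρ E ∸ ρ A)) ▹ sign ∣ A ∣) ∎
      where open ≡-Reasoning

    contract-rk : ∀ {F A} → A ⊆ E ∩ ∁ F → rk (contract N F) A ≡ ρ (A ∪ F) ∸ ρ F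
    contract-rk {F} h = cong (λ X → ρ (X ∪ F) ∸ ρ F) (∩-absorb h)

    -- For A disjoint from F, A spans the contraction exactly when A ∪ F has full rank.
    μ-contract : ∀ {F} → F ⊆ E → μ (contract N F) ≡ W ρ E F (λ r → (r ≡ᵇ ρ E) ▹ 1ℤ)
    μ-contract {F} h = trans (μ-whitney (contract-matroid IN F)) (sumS-ext λ A → ▹-cong (subᵇ A (E ∩ ∁ F)) λ e →
      trans (cong (_▹ sign ∣ A ∣) (same A (subᵇ⇒⊆ {X = A} {E ∩ ∁ F} e)))
        (sym (trans (*-▹ (ρ (A ∪ F) ≡ᵇ ρ E) (sign ∣ A ∣) 1ℤ) (cong ((ρ (A ∪ F) ≡ᵇ ρ E) ▹_) (*-identityʳ (sign ∣ A ∣))))))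
      where
      same : ∀ A → A ⊆ E ∩ ∁ F → (rk (contract N F) A ≡ᵇ rank (contract N F)) ≡ (ρ (A ∪ F) ≡ᵇ ρ E)
      same A a = bool-ext (λ e → ≡ᵇ-true (ℕₚ.∸-cancelʳ-≡ (rk-mono F (A ∪ F) (q⊆p∪q A F)) (rk-mono F E h)
          (trans (sym (contract-rk a)) (trans (≡ᵇ-elim {rk (contract N F) A} e) (contract-rank h)))))
        (λ e → ≡ᵇ-true (trans (contract-rk a) (trans (cong (_∸ ρ F) (≡ᵇ-elim {ρ (A ∪ F)} e)) (sym (contract-rank h)))))

  module _ {n} {N : RawMatroid n} (IN : IsMatroid N) where

    open IsMatroid IN

    private
      ρ : Subset n → ℕ
      ρ = rk N
      E : Subset n
      E = ground N

    -- Reversal turns the exponent d - r A of the characteristic polynomial into r A, which is ρ (A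
    -- ∪ F) - ρ F. The test j ≤ d guards the truncated difference.
    rev-χ-contract : ∀ F j → rev (rank (contract N F)) (χ (contract N F)) j ≡ W ρ E F (λ r → (j ≡ᵇ (r ∸ ρ F)) ▹ 1ℤ)
    rev-χ-contract F j = begin
      (j ≤ᵇ d) ▹ χ (contract N F) (d ∸ j)
        ≡⟨ cong ((j ≤ᵇ d) ▹_) (χ-whitney (contract-matroid IN F) (d ∸ j)) ⟩
      (j ≤ᵇ d) ▹ sumS (λ A → subᵇ A E' ▹ ((d ∸ j) ≡ᵇ (d ∸ r A)) ▹ sign ∣ A ∣)
        ≡⟨ sym (sumL-▹ (j ≤ᵇ d) (λ A → subᵇ A E' ▹ ((d ∸ j) ≡ᵇ (d ∸ r A)) ▹ sign ∣ A ∣) (allSub n)) ⟩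
      sumS (λ A → (j ≤ᵇ d) ▹ subᵇ A E' ▹ ((d ∸ j) ≡ᵇ (d ∸ r A)) ▹ sign ∣ A ∣)
        ≡⟨ sumS-ext (λ A → trans (▹-swap (j ≤ᵇ d) (subᵇ A E') (((d ∸ j) ≡ᵇ (d ∸ r A)) ▹ sign ∣ A ∣)) (▹-cong (subᵇ A E') λ e → value A (subᵇ⇒⊆ {X = A} {E'} e))) ⟩
      sumS (λ A → subᵇ A E' ▹ sign ∣ A ∣ * ((j ≡ᵇ (ρ (A ∪ F) ∸ ρ F)) ▹ 1ℤ)) ∎
      where
      open ≡-Reasoning
      E' : Subset n
      E' = E ∩ ∁ F
      d : ℕ
      d = rank (contract N F)
      r : Subset n → ℕ
      r = rk (contract N F)
      value : ∀ A → A ⊆ E' → ((j ≤ᵇ d) ▹ ((d ∸ j) ≡ᵇ (d ∸ r A)) ▹ sign ∣ A ∣) ≡ sign ∣ A ∣ * ((j ≡ᵇ (ρ (A ∪ F) ∸ ρ F)) ▹ 1ℤ)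
      value A a = trans (sym (▹-∧ (j ≤ᵇ d) ((d ∸ j) ≡ᵇ (d ∸ r A)) (sign ∣ A ∣)))
        (trans (cong (_▹ sign ∣ A ∣) (trans same (cong (j ≡ᵇ_) (contract-rk IN a))))
          (sym (trans (*-▹ (j ≡ᵇ (ρ (A ∪ F) ∸ ρ F)) (sign ∣ A ∣) 1ℤ) (cong ((j ≡ᵇ (ρ (A ∪ F) ∸ ρ F)) ▹_) (*-identityʳ (sign ∣ A ∣))))))
        where
        rA≤d : r A ≤ d
        rA≤d = IsMatroid.rk-mono (contract-matroid IN F) A E' a
        same : ((j ≤ᵇ d) ∧ ((d ∸ j) ≡ᵇ (d ∸ r A))) ≡ (j ≡ᵇ r A)
        same = bool-ext (λ e → ≡ᵇ-true (ℕₚ.∸-cancelˡ-≡ (≤ᵇ-elim {j} (∧-left e)) rA≤d (≡ᵇ-elim {d ∸ j} (∧-right {j ≤ᵇ d} e))))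
          (λ e → let q = ≡ᵇ-elim {j} e in ∧-intro (≤ᵇ-true (subst (_≤ d) (sym q) rA≤d)) (≡ᵇ-true (cong (d ∸_) q)))

    flats-to-subsets : ∀ (h : Subset n → ℤ) → (∀ F → F ⊆ E → isFlatᵇ N F ≡ false → h F ≡ 0ℤ) → sumS (λ F → isFlatᵇ N F ▹ h F) ≡ sumS (λ F → subᵇ F E ▹ h F)
    flats-to-subsets h z = sumS-ext λ F → at F (isFlatᵇ N F) refl (subᵇ F E) refl
      where
      at : ∀ F a → isFlatᵇ N F ≡ a → ∀ b → subᵇ F E ≡ b → (a ▹ h F) ≡ (b ▹ h F)
      at F true p true q = refl
      at F true p false q = false≢true (trans (sym q) (∧-left p))
      at F false p true q = sym (z F (subᵇ⇒⊆ {X = F} {E} q) p)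
      at F false p false q = refl

  sumUpTo-ext : ∀ k {f g : ℕ → ℤ} → (∀ i → f i ≡ g i) → sumUpTo k f ≡ sumUpTo k g
  sumUpTo-ext zero e = e 0
  sumUpTo-ext (suc k) e = cong₂ _+_ (sumUpTo-ext k e) (e (suc k))

  sumUpTo-*ˡ : ∀ k c (f : ℕ → ℤ) → sumUpTo k (λ i → c * f i) ≡ c * sumUpTo k f
  sumUpTo-*ˡ zero c f = refl
  sumUpTo-*ˡ (suc k) c f = trans (cong (_+ c * f (suc k)) (sumUpTo-*ˡ k c f)) (sym (*-distribˡ-+ c (sumUpTo k f) (f (suc k))))

  sumUpTo-▹ : ∀ k b (f : ℕ → ℤ) → sumUpTo k (λ i → b ▹ f i) ≡ (b ▹ sumUpTo k f)
  sumUpTo-▹ k true f = refl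
  sumUpTo-▹ zero false f = refl
  sumUpTo-▹ (suc k) false f = trans (+-identityʳ (sumUpTo k (λ _ → 0ℤ))) (sumUpTo-▹ k false f)

  sumUpTo-sumL : ∀ {A : Set} k (f : ℕ → A → ℤ) xs → sumUpTo k (λ i → sumL (f i) xs) ≡ sumL (λ x → sumUpTo k (λ i → f i x)) xs
  sumUpTo-sumL zero f xs = refl
  sumUpTo-sumL (suc k) f xs = trans (cong (_+ sumL (f (suc k)) xs) (sumUpTo-sumL k f xs)) (sym (sumL-+ (λ x → sumUpTo k (λ i → f i x)) (f (suc k)) xs))

  sumUpTo-0 : ∀ k {f : ℕ → ℤ} → (∀ i → i ≤ k → f i ≡ 0ℤ) → sumUpTo k f ≡ 0ℤ
  sumUpTo-0 zero h = h 0 z≤n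
  sumUpTo-0 (suc k) h = cong₂ _+_ (sumUpTo-0 k λ i l → h i (ℕₚ.m≤n⇒m≤1+n l)) (h (suc k) ℕₚ.≤-refl)

  sumUpTo-single : ∀ k {f : ℕ → ℤ} i₀ → i₀ ≤ k → (∀ i → i ≤ k → i ≢ i₀ → f i ≡ 0ℤ) → sumUpTo k f ≡ f i₀
  sumUpTo-single zero zero _ h = refl
  sumUpTo-single (suc k) {f} i₀ l h = decide (i₀ ℕ.≟ suc k)
    where
    decide : Dec (i₀ ≡ suc k) → sumUpTo k f + f (suc k) ≡ f i₀
    decide (yes refl) = trans (cong (_+ f (suc k)) (sumUpTo-0 k λ i l → h i (ℕₚ.m≤n⇒m≤1+n l) λ { refl → ℕₚ.<-irrefl refl l })) (+-identityˡ (f (suc k)))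
    decide (no ne) = trans (cong₂ _+_ (sumUpTo-single k i₀ (s≤s⁻¹ (ℕₚ.≤∧≢⇒< l ne)) λ i l → h i (ℕₚ.m≤n⇒m≤1+n l)) (h (suc k) ℕₚ.≤-refl λ e → ne (sym e))) (+-identityʳ (f i₀))

  sumUpTo-delta : ∀ k (p : ℕ → ℤ) e → sumUpTo k (λ i → p i * (((k ∸ i) ≡ᵇ e) ▹ 1ℤ)) ≡ ((e ≤ᵇ k) ▹ p (k ∸ e))
  sumUpTo-delta k p e = at (e ≤ᵇ k) refl
    where
    off : ∀ i → (k ∸ i) ≢ e → p i * (((k ∸ i) ≡ᵇ e) ▹ 1ℤ) ≡ 0ℤ
    off i ne = trans (cong (λ b → p i * (b ▹ 1ℤ)) (not-true λ q → ne (≡ᵇ-elim q))) (*-zeroʳ (p i))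
    at : ∀ b → (e ≤ᵇ k) ≡ b → sumUpTo k (λ i → p i * (((k ∸ i) ≡ᵇ e) ▹ 1ℤ)) ≡ (b ▹ p (k ∸ e))
    at true h = trans (sumUpTo-single k (k ∸ e) (ℕₚ.m∸n≤m k e) λ i l ne → off i λ q → ne (trans (sym (ℕₚ.m∸[m∸n]≡n l)) (cong (k ∸_) q)))
      (trans (cong (λ b → p (k ∸ e) * (b ▹ 1ℤ)) (≡ᵇ-true (ℕₚ.m∸[m∸n]≡n (≤ᵇ-elim {e} h)))) (*-identityʳ (p (k ∸ e))))
    at false h = sumUpTo-0 k λ i _ → off i λ q → false≢true (trans (sym h) (≤ᵇ-true (subst (_≤ k) q (ℕₚ.m∸n≤m k i))))

  -- q is a signed sum of monomials with exponents r ∸ f, so the product is the corresponding signed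
  -- sum of shifts of p.
  convolve-W : ∀ {n} (ρ : Subset n → ℕ) E F (p q : Poly) f → (∀ j → q j ≡ W ρ E F (λ r → (j ≡ᵇ (r ∸ f)) ▹ 1ℤ)) →
    ∀ k → (p ⊛ q) k ≡ W ρ E F (λ r → ((r ∸ f) ≤ᵇ k) ▹ p (k ∸ (r ∸ f)))
  convolve-W {n} ρ E F p q f h k = begin
    sumUpTo k (λ i → p i * q (k ∸ i))
      ≡⟨ sumUpTo-ext k (λ i → trans (cong (p i *_) (h (k ∸ i))) (sym (sumL-*ˡ (p i) (λ A → b A ▹ s A * δ A i) (allSub n)))) ⟩
    sumUpTo k (λ i → sumS (λ A → p i * (b A ▹ s A * δ A i)))
      ≡⟨ sumUpTo-sumL k (λ i A → p i * (b A ▹ s A * δ A i)) (allSub n) ⟩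
    sumS (λ A → sumUpTo k (λ i → p i * (b A ▹ s A * δ A i)))
      ≡⟨ sumS-ext (λ A → trans (sumUpTo-ext k λ i → trans (*-▹ (b A) (p i) (s A * δ A i)) (cong (b A ▹_) (solve 3 (λ p s d → p :* (s :* d) := s :* (p :* d)) refl (p i) (s A) (δ A i))))
           (trans (sumUpTo-▹ k (b A) (λ i → s A * (p i * δ A i))) (cong (b A ▹_) (trans (sumUpTo-*ˡ k (s A) (λ i → p i * δ A i)) (cong (s A *_) (sumUpTo-delta k p (ρ (A ∪ F) ∸ f))))))) ⟩
    W ρ E F (λ r → ((r ∸ f) ≤ᵇ k) ▹ p (k ∸ (r ∸ f))) ∎
    where
    open ≡-Reasoning
    b : Subset n → Bool
    b A = subᵇ A (E ∩ ∁ F)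
    s : Subset n → ℤ
    s A = sign ∣ A ∣
    δ : Subset n → ℕ → ℤ
    δ A i = ((k ∸ i) ≡ᵇ (ρ (A ∪ F) ∸ f)) ▹ 1ℤ

-- Inverse Kazhdan-Lusztig polynomials and Y as functions of ranks.

module InverseKL where

  open import Defs
  open ListSum
  open SubsetSum
  open Whitney
  open KL
  open Subdivision using (sign-sq)
  open import Data.Bool using (Bool; true; false; if_then_else_; not; _∧_; _∨_)
  open import Data.Nat using (ℕ; zero; suc; _≤_; _<_; _≡ᵇ_; _≤ᵇ_; _<ᵇ_; _∸_; s≤s; s≤s⁻¹)
  import Data.Nat as ℕ
  import Data.Nat.Properties as ℕₚ
  open import Data.Fin using (Fin)
  open import Data.Fin.Subset using (Subset; _∩_; _∪_; ∁; ⁅_⁆; _⊆_; ∣_∣; _∈_; _∉_)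
  open import Data.Fin.Subset.Properties using (⊆-antisym; x∈⁅y⁆⇒x≡y; ∣p∣≤n; p∩q⊆p; p⊂q⇒∣p∣<∣q∣; ∩-idem)
  open import Data.Integer using (ℤ; 0ℤ; 1ℤ; _*_)
  open import Data.Integer.Properties hiding (≤-refl; ≤-trans; _≤?_; ≤-reflexive)
  open import Data.Integer.Solver
  open +-*-Solver
  open import Data.Vec using (lookup)
  open import Data.Vec.Properties using (lookup∘tabulate)
  open import Data.List using (map)
  open import Data.Product using (Σ; ∃; _×_; _,_; proj₁; proj₂)
  open import Function using (id)
  open import Relation.Binary.PropositionalEquality

  <ᵇ-true : ∀ {a b} → a < b → (a <ᵇ b) ≡ true
  <ᵇ-true p = T⇒≡ (ℕₚ.<⇒<ᵇ p)

  <ᵇ-elim : ∀ {a b} → (a <ᵇ b) ≡ true → a < b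
  <ᵇ-elim {a} {b} e = ℕₚ.<ᵇ⇒< a b (≡⇒T e)

  proper : ∀ {n} → Subset n → Subset n → Bool
  proper H G = subᵇ H G ∧ not (subᵇ G H)

  -- The contribution of H to the coefficient of t^k in the defining identity for the restriction to
  -- G, with f in place of the polynomial of the restriction to H. It makes sense for every H below
  -- G, and `W` vanishes when H is not a flat.
  summand : ∀ {n} → (Subset n → ℕ) → Subset n → ℕ → Subset n → Poly → ℤ
  summand ρ G k H f = sign (ρ H) * W ρ G H (λ r → ((r ∸ ρ H) ≤ᵇ k) ▹ f (k ∸ (r ∸ ρ H)))

  -- Read off from the coefficient of t^(ρ G ∸ k) in the defining identity of the
  -- inverse Kazhdan–Lusztig polynomial of the restriction to G; the first argument is
  -- fuel and must exceed ∣ G ∣.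
  invKL : ∀ {n} → ℕ → (Subset n → ℕ) → Subset n → Poly
  invKL zero ρ G k = 0ℤ
  invKL (suc m) ρ G k =
    if ρ G ≡ᵇ 0 then ((k ≡ᵇ 0) ▹ 1ℤ)
    else ((2 ℕ.* k <ᵇ ρ G) ▹ sign (ρ G) * sumS (λ H → proper H G ▹ summand ρ G (ρ G ∸ k) H (invKL m ρ H)))

  proper-elim : ∀ {n} {H G : Subset n} → proper H G ≡ true → H ⊆ G × ∣ H ∣ < ∣ G ∣
  proper-elim {H = H} {G} e = sub , p⊂q⇒∣p∣<∣q∣ (sub , go (allᵇ-false _ (not-elim {subᵇ G H} (∧-right {subᵇ H G} e))))
    where
    sub : H ⊆ G
    sub = subᵇ⇒⊆ {X = H} {G} (∧-left e)
    decode : ∀ {i} a b → lookup G i ≡ a → lookup H i ≡ b → not a ∨ b ≡ false → i ∈ G × i ∉ H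
    decode true false p q _ = lookup⇒∈ p , lookup⇒∉ q
    go : (Σ (Fin _) λ i → not (lookup G i) ∨ lookup H i ≡ false) → ∃ λ x → x ∈ G × x ∉ H
    go (i , p) = i , decode (lookup G i) (lookup H i) refl refl p

  summand-cong : ∀ {n} {ρ ρ' : Subset n → ℕ} {G H} k {f f' : Poly} → H ⊆ G → (∀ X → X ⊆ G → ρ X ≡ ρ' X) → (∀ j → f j ≡ f' j) →
    summand ρ G k H f ≡ summand ρ' G k H f'
  summand-cong {ρ = ρ} {ρ'} {G} {H} k {f} {f'} h e ef = cong₂ _*_ (cong sign (e H h)) (W-cong {ρ = ρ} {ρ'} {G} {H} {λ r → ((r ∸ ρ H) ≤ᵇ k) ▹ f (k ∸ (r ∸ ρ H))} {λ r → ((r ∸ ρ' H) ≤ᵇ k) ▹ f' (k ∸ (r ∸ ρ' H))} λ A a →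
    trans (cong₂ (λ x y → ((x ∸ y) ≤ᵇ k) ▹ f (k ∸ (x ∸ y))) (e (A ∪ H) (∪-lub (λ p → p∩q⊆p G (∁ H) (a p)) h)) (e H h))
      (cong (((ρ' (A ∪ H) ∸ ρ' H) ≤ᵇ k) ▹_) (ef (k ∸ (ρ' (A ∪ H) ∸ ρ' H)))))

  invKL-cong : ∀ {n} m {ρ ρ' : Subset n → ℕ} {G} → (∀ X → X ⊆ G → ρ X ≡ ρ' X) → ∀ k → invKL m ρ G k ≡ invKL m ρ' G k
  invKL-cong zero e k = refl
  invKL-cong (suc m) {ρ} {ρ'} {G} e k = trans (cong (λ r → body r ρ) (e G id)) (cong (λ x → if ρ' G ≡ᵇ 0 then ((k ≡ᵇ 0) ▹ 1ℤ) else ((2 ℕ.* k <ᵇ ρ' G) ▹ sign (ρ' G) * x))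
      (sumS-ext λ H → ▹-cong (proper H G) λ p → summand-cong (ρ' G ∸ k) (proj₁ (proper-elim {H = H} {G} p)) e (invKL-cong m λ X x → e X (λ z → proj₁ (proper-elim {H = H} {G} p) (x z)))))
    where
    body : ℕ → (Subset _ → ℕ) → ℤ
    body r ρ = if r ≡ᵇ 0 then ((k ≡ᵇ 0) ▹ 1ℤ) else ((2 ℕ.* k <ᵇ r) ▹ sign r * sumS (λ H → proper H G ▹ summand ρ G (r ∸ k) H (invKL m ρ H)))

  -- The definition of Y with the Möbius value of the contraction replaced by `W` and flats by all
  -- subsets; m is the fuel of `invKL`.
  Ysum : ∀ {n} → ℕ → (Subset n → ℕ) → Subset n → Poly
  Ysum m ρ E k = sign (ρ E) * sumS (λ F → subᵇ F E ▹ (sign (ρ F) * W ρ E F (λ r → (r ≡ᵇ ρ E) ▹ 1ℤ)) * shift (ρ E ∸ ρ F) (invKL m ρ F) k)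

  Ysum-cong : ∀ {n} m {ρ ρ' : Subset n → ℕ} {E} → (∀ X → X ⊆ E → ρ X ≡ ρ' X) → ∀ k → Ysum m ρ E k ≡ Ysum m ρ' E k
  Ysum-cong m {ρ} {ρ'} {E} e k = cong₂ _*_ (cong sign (e E id)) (sumS-ext λ F → ▹-cong (subᵇ F E) λ p → at F (subᵇ⇒⊆ {X = F} {E} p))
    where
    at : ∀ F → F ⊆ E → (sign (ρ F) * W ρ E F (λ r → (r ≡ᵇ ρ E) ▹ 1ℤ)) * shift (ρ E ∸ ρ F) (invKL m ρ F) k
      ≡ (sign (ρ' F) * W ρ' E F (λ r → (r ≡ᵇ ρ' E) ▹ 1ℤ)) * shift (ρ' E ∸ ρ' F) (invKL m ρ' F) k
    at F f = cong₂ _*_ (cong₂ _*_ (cong sign (e F f)) (W-cong {ρ = ρ} {ρ'} {E} {F} {λ r → (r ≡ᵇ ρ E) ▹ 1ℤ} {λ r → (r ≡ᵇ ρ' E) ▹ 1ℤ} λ A a → cong₂ (λ x y → (x ≡ᵇ y) ▹ 1ℤ) (e (A ∪ F) (∪-lub (λ p → p∩q⊆p E (∁ F) (a p)) f)) (e E id)))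
      (trans (cong₂ (λ a b → shift (a ∸ b) (invKL m ρ F) k) (e E id) (e F f))
        (cong (λ x → if k <ᵇ (ρ' E ∸ ρ' F) then 0ℤ else x) (invKL-cong m (λ X x → e X (λ z → f (x z))) (k ∸ (ρ' E ∸ ρ' F)))))

  module _ {n} {N : RawMatroid n} (IN : IsMatroid N) where

    private
      ρ : Subset n → ℕ
      ρ = rk N
      E : Subset n
      E = ground N

    kl-subsets : (Q : QAssign) → IsInvKL Q → Loopless N → ∀ k →
      sign (ρ E) * rev (ρ E) (Q N) k ≡ sumS (λ F → subᵇ F E ▹ summand ρ E k F (Q (restrict N F)))
    kl-subsets Q iq ll k = begin
      sign (ρ E) * rev (ρ E) (Q N) k
        ≡⟨ proj₂ (proj₂ (iq N IN ll)) k ⟩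
      sumₚ (map (λ F → scale (sign (ρ F)) (conv F)) (flats N)) k
        ≡⟨ sumₚ-map (λ F → scale (sign (ρ F)) (conv F)) (flats N) k ⟩
      sumL (λ F → sign (ρ F) * conv F k) (flats N)
        ≡⟨ sumL-filterᵇ (isFlatᵇ N) (λ F → sign (ρ F) * conv F k) (allSub n) ⟩
      sumS (λ F → isFlatᵇ N F ▹ sign (ρ F) * conv F k)
        ≡⟨ sumS-ext (λ F → cong (λ x → isFlatᵇ N F ▹ sign (ρ F) * x)
             (convolve-W ρ E F (Q (restrict N F)) (rev (rank (contract N F)) (χ (contract N F))) (ρ F) (rev-χ-contract IN F) k)) ⟩
      sumS (λ F → isFlatᵇ N F ▹ summand ρ E k F (Q (restrict N F)))
        ≡⟨ flats-to-subsets IN (λ F → summand ρ E k F (Q (restrict N F))) (λ F f nf →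
             trans (cong (sign (ρ F) *_) (W-nonflat IN f nf (λ r → ((r ∸ ρ F) ≤ᵇ k) ▹ Q (restrict N F) (k ∸ (r ∸ ρ F))))) (*-zeroʳ (sign (ρ F)))) ⟩
      sumS (λ F → subᵇ F E ▹ summand ρ E k F (Q (restrict N F))) ∎
      where
      open ≡-Reasoning
      conv : Subset n → Poly
      conv F = Q (restrict N F) ⊛ rev (rank (contract N F)) (χ (contract N F))

    Yₗ-subsets : (Q : QAssign) → ∀ k → Yₗ Q N k ≡
      sign (ρ E) * sumS (λ F → subᵇ F E ▹ (sign (ρ F) * W ρ E F (λ r → (r ≡ᵇ ρ E) ▹ 1ℤ)) * shift (ρ E ∸ ρ F) (Q (restrict N F)) k)
    Yₗ-subsets Q k = cong (sign (ρ E) *_) (begin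
      sumₚ (map (λ F → scale (sign (ρ F) * μ (contract N F)) (shift (rank (contract N F)) (Q (restrict N F)))) (flats N)) k
        ≡⟨ sumₚ-map (λ F → scale (sign (ρ F) * μ (contract N F)) (shift (rank (contract N F)) (Q (restrict N F)))) (flats N) k ⟩
      sumL (λ F → sign (ρ F) * μ (contract N F) * shift (rank (contract N F)) (Q (restrict N F)) k) (flats N)
        ≡⟨ sumL-filterᵇ (isFlatᵇ N) (λ F → sign (ρ F) * μ (contract N F) * shift (rank (contract N F)) (Q (restrict N F)) k) (allSub n) ⟩
      sumS (λ F → isFlatᵇ N F ▹ sign (ρ F) * μ (contract N F) * shift (rank (contract N F)) (Q (restrict N F)) k)
        ≡⟨ sumS-ext (λ F → ▹-cong (isFlatᵇ N F) λ f → cong₂ (λ m d → sign (ρ F) * m * shift d (Q (restrict N F)) k)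
             (μ-contract IN (flat⇒⊆ N f)) (contract-rank IN (flat⇒⊆ N f))) ⟩
      sumS (λ F → isFlatᵇ N F ▹ h F)
        ≡⟨ flats-to-subsets IN h (λ F f nf → trans (cong (λ x → sign (ρ F) * x * shift (ρ E ∸ ρ F) (Q (restrict N F)) k) (W-nonflat IN f nf (λ r → (r ≡ᵇ ρ E) ▹ 1ℤ)))
             (solve 2 (λ s t → s :* con 0ℤ :* t := con 0ℤ) refl (sign (ρ F)) (shift (ρ E ∸ ρ F) (Q (restrict N F)) k))) ⟩
      sumS (λ F → subᵇ F E ▹ h F) ∎)
      where
      open ≡-Reasoning
      h : Subset n → ℤ
      h F = (sign (ρ F) * W ρ E F (λ r → (r ≡ᵇ ρ E) ▹ 1ℤ)) * shift (ρ E ∸ ρ F) (Q (restrict N F)) k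

  restrict-invKL : ∀ {n} m {N : RawMatroid n} {F} k → invKL m (rk (restrict N F)) F k ≡ invKL m (rk N) F k
  restrict-invKL m {N} k = invKL-cong m (λ X x → cong (rk N) (∩-absorb x)) k

  -- The degree bound decides. For 2 k < r the index r - k exceeds half the rank, so the term of F =
  -- E vanishes there, while the reversed left side gives the coefficient of t^k in Q. What remains
  -- are proper subsets, whose restrictions have smaller ground sets.
  Q≡invKL : (Q : QAssign) → IsInvKL Q → ∀ {n} m (N : RawMatroid n) → IsMatroid N → Loopless N → ∣ ground N ∣ < m → ∀ k → Q N k ≡ invKL m (rk N) (ground N) k
  Q≡invKL Q iq {n} (suc m) N IN ll l k = at (ρ E ≡ᵇ 0) refl
    where
    open ≡-Reasoning
    ρ : Subset n → ℕ
    ρ = rk N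
    E : Subset n
    E = ground N
    r : ℕ
    r = ρ E
    Rec : ℤ
    Rec = sumS (λ H → proper H E ▹ summand ρ E (r ∸ k) H (invKL m ρ H))
    top-zero : 0 < r → 2 ℕ.* k < r → ∀ F → E ⊆ F → F ⊆ E → summand ρ E (r ∸ k) F (Q (restrict N F)) ≡ 0ℤ
    top-zero r>0 lt F ef fe with refl ← ⊆-antisym {i = E} {F} ef fe = trans (cong (sign r *_) (sumS-0 λ A → trans (▹-cong (subᵇ A (E ∩ ∁ E)) λ a →
        trans (cong (sign ∣ A ∣ *_) (value A (subᵇ⇒⊆ {X = A} {E ∩ ∁ E} a))) (*-zeroʳ (sign ∣ A ∣))) (▹-0 (subᵇ A (E ∩ ∁ E))))) (*-zeroʳ (sign r))
      where
      value : ∀ A → A ⊆ E ∩ ∁ E → (((ρ (A ∪ E) ∸ r) ≤ᵇ (r ∸ k)) ▹ Q (restrict N E) (r ∸ k ∸ (ρ (A ∪ E) ∸ r))) ≡ 0ℤ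
      value A a = trans (cong (λ d → (d ≤ᵇ (r ∸ k)) ▹ Q (restrict N E) (r ∸ k ∸ d)) (trans (cong (λ X → ρ X ∸ r) (∪-absorbˡ λ p → p∩q⊆p E (∁ E) (a p))) (ℕₚ.n∸n≡0 r)))
        (trans (cong ((0 ≤ᵇ (r ∸ k)) ▹_) (proj₁ (proj₂ (iq (restrict N E) (restrict-matroid IN E) (restrict-loopless {N = N} ll id))) (subst (0 <_) (sym same) r>0) (r ∸ k)
          (ℕₚ.≤-trans (ℕₚ.≤-reflexive same) high))) (▹-0 (0 ≤ᵇ (r ∸ k))))
        where
        same : rank (restrict N E) ≡ r
        same = cong ρ (∩-idem E)
        high : r ≤ 2 ℕ.* (r ∸ k)
        high = ℕₚ.≤-trans (ℕₚ.≤-trans (ℕₚ.≤-reflexive (sym (ℕₚ.m+n∸n≡m r r))) (ℕₚ.∸-monoʳ-≤ (r ℕ.+ r) (ℕₚ.<⇒≤ lt)))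
          (ℕₚ.≤-reflexive (trans (cong (_∸ 2 ℕ.* k) (cong (r ℕ.+_) (sym (ℕₚ.+-identityʳ r)))) (sym (ℕₚ.*-distribˡ-∸ 2 r k))))
    sum≡ : 0 < r → 2 ℕ.* k < r → sumS (λ F → subᵇ F E ▹ summand ρ E (r ∸ k) F (Q (restrict N F))) ≡ Rec
    sum≡ r>0 lt = sumS-ext λ F → term F (subᵇ F E) refl (subᵇ E F) refl
      where
      term : ∀ F a → subᵇ F E ≡ a → ∀ b → subᵇ E F ≡ b → (a ▹ summand ρ E (r ∸ k) F (Q (restrict N F))) ≡ (a ∧ not b ▹ summand ρ E (r ∸ k) F (invKL m ρ F))
      term F false _ b _ = refl
      term F true p true p' = top-zero r>0 lt F (subᵇ⇒⊆ {X = E} {F} p') (subᵇ⇒⊆ {X = F} {E} p)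
      term F true p false p' = let s , c = proper-elim {H = F} {E} (∧-intro p (not-intro p')) in
        summand-cong {ρ = ρ} {ρ} {E} {F} (r ∸ k) s (λ _ _ → refl) λ j →
          trans (Q≡invKL Q iq m (restrict N F) (restrict-matroid IN F) (restrict-loopless {N = N} ll s) (ℕₚ.<-≤-trans c (s≤s⁻¹ l)) j) (restrict-invKL m {N} {F} j)
    low : 0 < r → 2 ℕ.* k < r → Q N k ≡ sign r * Rec
    low r>0 lt = begin
      Q N k ≡⟨ sym (*-identityˡ (Q N k)) ⟩
      1ℤ * Q N k ≡⟨ cong (_* Q N k) (sym (sign-sq r)) ⟩
      sign r * sign r * Q N k ≡⟨ *-assoc (sign r) (sign r) (Q N k) ⟩
      sign r * (sign r * Q N k) ≡⟨ cong (λ x → sign r * (sign r * x)) (sym reversed) ⟩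
      sign r * (sign r * rev r (Q N) (r ∸ k)) ≡⟨ cong (sign r *_) (trans (kl-subsets IN Q iq ll (r ∸ k)) (sum≡ r>0 lt)) ⟩
      sign r * Rec ∎
      where
      reversed : rev r (Q N) (r ∸ k) ≡ Q N k
      reversed = trans (cong (λ b → b ▹ Q N (r ∸ (r ∸ k))) (≤ᵇ-true (ℕₚ.m∸n≤m r k)))
        (cong (Q N) (ℕₚ.m∸[m∸n]≡n (ℕₚ.<⇒≤ (ℕₚ.≤-<-trans (ℕₚ.m≤m+n k (k ℕ.+ 0)) lt))))
    half : 0 < r → ∀ b → (2 ℕ.* k <ᵇ r) ≡ b → Q N k ≡ (b ▹ sign r * Rec)
    half r>0 true e = low r>0 (<ᵇ-elim {2 ℕ.* k} e)
    half r>0 false e = proj₁ (proj₂ (iq N IN ll)) r>0 k (ℕₚ.≮⇒≥ λ lt → false≢true (trans (sym e) (<ᵇ-true lt)))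
    at : ∀ b → (ρ E ≡ᵇ 0) ≡ b → Q N k ≡ (if b then ((k ≡ᵇ 0) ▹ 1ℤ) else ((2 ℕ.* k <ᵇ r) ▹ sign r * Rec))
    at true e = trans (proj₁ (iq N IN ll) (≡ᵇ-elim e) k) (1ₚ-at k)
    at false e = half (ℕₚ.n≢0⇒n>0 λ z → false≢true (trans (sym e) (≡ᵇ-true z))) (2 ℕ.* k <ᵇ r) refl

  loopFree : ∀ {n} → RawMatroid n → Subset n
  loopFree M = ground (deleteLoops M)

  loopFree-lookup : ∀ {n} (M : RawMatroid n) i → lookup (loopFree M) i ≡ lookup (ground M) i ∧ not (rk M ⁅ i ⁆ ≡ᵇ 0)
  loopFree-lookup M i = lookup∘tabulate _ i

  deleteLoops-loopless : ∀ {n} (M : RawMatroid n) → Loopless (deleteLoops M)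
  deleteLoops-loopless M i e r = false≢true (trans (sym (not-elim (∧-right {lookup (ground M) i} (trans (sym (loopFree-lookup M i)) e))))
    (≡ᵇ-true (trans (cong (rk M) (sym (∩-absorb {A = ⁅ i ⁆} {loopFree M} λ p → subst (_∈ loopFree M) (sym (x∈⁅y⁆⇒x≡y i p)) (lookup⇒∈ e)))) r)))

  -- The fuel `suc n` exceeds the size of every subset. Ranks of M replace those of the deletion
  -- because all sets involved lie in the loop-free part; so M enters through its ranks and the set
  -- of its non-loops.
  Y≡Ysum : (Q : QAssign) → IsInvKL Q → ∀ {n} (M : RawMatroid n) → IsMatroid M → ∀ k → Y Q M k ≡ Ysum (suc n) (rk M) (loopFree M) k
  Y≡Ysum Q iq {n} M IM k = trans (Yₗ-subsets IN Q k) (trans (cong (sign (rk N E) *_) (sumS-ext λ F → ▹-cong (subᵇ F E) λ f →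
      cong (λ x → (sign (rk N F) * W (rk N) E F (λ r → (r ≡ᵇ rk N E) ▹ 1ℤ)) * x) (shift-cong F (subᵇ⇒⊆ {X = F} {E} f))))
    (Ysum-cong (suc n) {rk N} {rk M} {E} (λ X x → cong (rk M) (∩-absorb x)) k))
    where
    N : RawMatroid n
    N = deleteLoops M
    E : Subset n
    E = loopFree M
    IN : IsMatroid N
    IN = restrict-matroid IM E
    shift-cong : ∀ F → F ⊆ E → shift (rk N E ∸ rk N F) (Q (restrict N F)) k ≡ shift (rk N E ∸ rk N F) (invKL (suc n) (rk N) F) k
    shift-cong F f = cong (λ x → if k <ᵇ (rk N E ∸ rk N F) then 0ℤ else x)
      (trans (Q≡invKL Q iq (suc n) (restrict N F) (restrict-matroid IN F) (restrict-loopless {N = N} (deleteLoops-loopless M) f) (s≤s (∣p∣≤n F)) (k ∸ (rk N E ∸ rk N F)))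
        (restrict-invKL (suc n) {N} {F} (k ∸ (rk N E ∸ rk N F))))

-- Invariance under relabelling, and valuativity by unfolding along chains.

module Final where

  open import Defs
  open ListSum
  open SubsetSum
  open Matroid
  open Whitney
  open KL
  open InverseKL
  open Subdivision using (signAt)
  open Chain
  open import Data.Bool using (Bool; true; false; if_then_else_; not; _∧_; _∨_)
  open import Data.Nat using (ℕ; zero; suc; _≡ᵇ_; _≤ᵇ_; _<ᵇ_; _∸_)
  import Data.Nat as ℕ
  import Data.Nat.Properties as ℕₚ
  open import Data.Fin using (Fin)
  open import Data.Fin.Permutation using (Permutation; permutation)
  open import Data.Fin.Subset using (Subset; _∩_; _∪_; ∁; ⁅_⁆; _⊆_; ⊤; ⊥; ∣_∣; _∈_)
  open import Data.Fin.Subset.Properties using (⊆-antisym; ⊆-min; q⊆p∪q; x∈⁅x⁆; x∈⁅y⁆⇒x≡y; p∩q⊆p; ∈⊤)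
  open import Data.Integer using (ℤ; 0ℤ; 1ℤ; _+_; _*_)
  open import Data.Integer.Properties hiding (≤-refl; ≤-trans; _≤?_; ≤-reflexive)
  open import Data.Integer.Solver
  open +-*-Solver
  open import Algebra.Properties.CommutativeMonoid.Sum ℕₚ.+-0-commutativeMonoid using () renaming (sum to sumℕ; sum-permute to sumℕ-permute)
  open import Data.Vec using ([]; _∷_; lookup)
  open import Data.Vec.Properties using (lookup∘tabulate; tabulate∘lookup; tabulate-cong; lookup-zipWith; lookup-map)
  open import Data.List using (List; []; _∷_; map; allFin)
  open import Data.Product using (_×_; _,_; proj₁)
  open import Data.Unit using (tt)
  open import Relation.Binary.PropositionalEquality

  lookup-ext : ∀ {n} {X Y : Subset n} → (∀ i → lookup X i ≡ lookup Y i) → X ≡ Y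
  lookup-ext {X = X} {Y} h = trans (sym (tabulate∘lookup X)) (trans (tabulate-cong h) (tabulate∘lookup Y))

  ∣∣-sum : ∀ {n} (X : Subset n) → ∣ X ∣ ≡ sumℕ (λ i → if lookup X i then 1 else 0)
  ∣∣-sum [] = refl
  ∣∣-sum (true ∷ X) = cong suc (∣∣-sum X)
  ∣∣-sum (false ∷ X) = ∣∣-sum X

  module Relabel {n} (σ τ : Fin n → Fin n) (στ : ∀ i → σ (τ i) ≡ i) (τσ : ∀ i → τ (σ i) ≡ i) where

    π : Subset n → Subset n
    π = preimage σ

    lookup-π : ∀ X i → lookup (π X) i ≡ lookup X (σ i)
    lookup-π X i = lookup∘tabulate (λ i → lookup X (σ i)) i

    π-∩ : ∀ X Y → π (X ∩ Y) ≡ π X ∩ π Y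
    π-∩ X Y = lookup-ext λ i → trans (lookup-π (X ∩ Y) i) (trans (lookup-zipWith _∧_ (σ i) X Y)
      (sym (trans (lookup-zipWith _∧_ i (π X) (π Y)) (cong₂ _∧_ (lookup-π X i) (lookup-π Y i)))))

    π-∪ : ∀ X Y → π (X ∪ Y) ≡ π X ∪ π Y
    π-∪ X Y = lookup-ext λ i → trans (lookup-π (X ∪ Y) i) (trans (lookup-zipWith _∨_ (σ i) X Y)
      (sym (trans (lookup-zipWith _∨_ i (π X) (π Y)) (cong₂ _∨_ (lookup-π X i) (lookup-π Y i)))))

    π-∁ : ∀ X → π (∁ X) ≡ ∁ (π X)
    π-∁ X = lookup-ext λ i → trans (lookup-π (∁ X) i) (trans (lookup-map (σ i) not X) (sym (trans (lookup-map i not (π X)) (cong not (lookup-π X i)))))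

    π-τ : ∀ X → π (preimage τ X) ≡ X
    π-τ X = lookup-ext λ i → trans (lookup-π (preimage τ X) i) (trans (lookup∘tabulate _ (σ i)) (cong (lookup X) (τσ i)))

    τ-π : ∀ X → preimage τ (π X) ≡ X
    τ-π X = lookup-ext λ i → trans (lookup∘tabulate _ i) (trans (lookup-π X (τ i)) (cong (lookup X) (στ i)))

    π-⊆ : ∀ {X Y} → X ⊆ Y → π X ⊆ π Y
    π-⊆ {X} {Y} h {i} p = lookup⇒∈ (trans (lookup-π Y i) (∈⇒lookup (h (lookup⇒∈ (trans (sym (lookup-π X i)) (∈⇒lookup p))))))

    π-⊆⁻ : ∀ {X Y} → π X ⊆ π Y → X ⊆ Y
    π-⊆⁻ {X} {Y} h {i} p = lookup⇒∈ (trans (sym (trans (lookup-π Y (τ i)) (cong (lookup Y) (στ i))))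
      (∈⇒lookup (h (lookup⇒∈ (trans (lookup-π X (τ i)) (trans (cong (lookup X) (στ i)) (∈⇒lookup p)))))))

    subᵇ-π : ∀ X Y → subᵇ (π X) (π Y) ≡ subᵇ X Y
    subᵇ-π X Y = bool-ext (λ e → ⊆⇒subᵇ {X = X} {Y} (π-⊆⁻ (subᵇ⇒⊆ {X = π X} {π Y} e))) (λ e → ⊆⇒subᵇ {X = π X} {π Y} (π-⊆ (subᵇ⇒⊆ {X = X} {Y} e)))

    ∣π∣ : ∀ X → ∣ π X ∣ ≡ ∣ X ∣
    ∣π∣ X = trans (∣∣-sum (π X)) (trans (sum-lookup) (trans (sym (sumℕ-permute (λ i → if lookup X i then 1 else 0) perm)) (sym (∣∣-sum X))))
      where
      perm : Permutation n n
      perm = permutation σ τ στ τσ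
      open import Algebra.Properties.CommutativeMonoid.Sum ℕₚ.+-0-commutativeMonoid using (sum-cong-≗)
      sum-lookup : sumℕ (λ i → if lookup (π X) i then 1 else 0) ≡ sumℕ (λ i → if lookup X (σ i) then 1 else 0)
      sum-lookup = sum-cong-≗ λ i → cong (λ b → if b then 1 else 0) (lookup-π X i)

    sumS-π : ∀ (f g : Subset n → ℤ) → (∀ X → f X ≡ g (π X)) → sumS f ≡ sumS g
    sumS-π f g h = trans (sumS-ext h) (sumS-bijection π (preimage τ) τ-π π-τ g)

    W-π : ∀ (ρ : Subset n → ℕ) G F g → W (λ X → ρ (π X)) G F g ≡ W ρ (π G) (π F) g
    W-π ρ G F g = sumS-π _ _ λ A → cong₂ _▹_
      (trans (sym (subᵇ-π A (G ∩ ∁ F))) (cong (subᵇ (π A)) (trans (π-∩ G (∁ F)) (cong (π G ∩_) (π-∁ F)))))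
      (cong₂ (λ s X → s * g (ρ X)) (cong sign (sym (∣π∣ A))) (π-∪ A F))

    proper-π : ∀ H G → proper (π H) (π G) ≡ proper H G
    proper-π H G = cong₂ (λ a b → a ∧ not b) (subᵇ-π H G) (subᵇ-π G H)

    invKL-π : ∀ m (ρ : Subset n → ℕ) G k → invKL m (λ X → ρ (π X)) G k ≡ invKL m ρ (π G) k
    invKL-π zero ρ G k = refl
    invKL-π (suc m) ρ G k = cong (λ x → if ρ (π G) ≡ᵇ 0 then ((k ≡ᵇ 0) ▹ 1ℤ) else ((2 ℕ.* k <ᵇ ρ (π G)) ▹ sign (ρ (π G)) * x))
      (sumS-π _ _ λ H → cong₂ _▹_ (sym (proper-π H G)) (cong (sign (ρ (π H)) *_)
        (trans (W-cong {ρ = λ X → ρ (π X)} {λ X → ρ (π X)} {G} {H} {step H (invKL m (λ X → ρ (π X)) H)} {step H (invKL m ρ (π H))}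
             λ A _ → cong (((ρ (π (A ∪ H)) ∸ ρ (π H)) ≤ᵇ (ρ (π G) ∸ k)) ▹_) (invKL-π m ρ H (ρ (π G) ∸ k ∸ (ρ (π (A ∪ H)) ∸ ρ (π H)))))
          (W-π ρ G H (step H (invKL m ρ (π H)))))))
      where
      step : Subset n → Poly → ℕ → ℤ
      step H f r = ((r ∸ ρ (π H)) ≤ᵇ (ρ (π G) ∸ k)) ▹ f (ρ (π G) ∸ k ∸ (r ∸ ρ (π H)))

    Ysum-π : ∀ m (ρ : Subset n → ℕ) E k → Ysum m (λ X → ρ (π X)) E k ≡ Ysum m ρ (π E) k
    Ysum-π m ρ E k = cong (sign (ρ (π E)) *_) (sumS-π _ _ λ F → cong₂ _▹_ (sym (subᵇ-π F E))
      (cong₂ _*_ (cong (sign (ρ (π F)) *_) (W-π ρ E F (λ r → (r ≡ᵇ ρ (π E)) ▹ 1ℤ)))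
        (cong (λ x → if k <ᵇ (ρ (π E) ∸ ρ (π F)) then 0ℤ else x) (invKL-π m ρ F (k ∸ (ρ (π E) ∸ ρ (π F)))))))

    π-singleton : ∀ i → π ⁅ σ i ⁆ ≡ ⁅ i ⁆
    π-singleton i = ⊆-antisym
      (λ {j} p → subst (_∈ ⁅ i ⁆) (sym (trans (sym (τσ j)) (trans (cong τ (x∈⁅y⁆⇒x≡y (σ i) (lookup⇒∈ (trans (sym (lookup-π ⁅ σ i ⁆ j)) (∈⇒lookup p))))) (τσ i)))) (x∈⁅x⁆ i))
      (λ {j} p → subst (_∈ π ⁅ σ i ⁆) (sym (x∈⁅y⁆⇒x≡y i p)) (lookup⇒∈ (trans (lookup-π ⁅ σ i ⁆ i) (∈⇒lookup (x∈⁅x⁆ (σ i))))))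

  loopFree-full : ∀ {n} (M : RawMatroid n) → ground M ≡ ⊤ → ∀ i → lookup (loopFree M) i ≡ not (rk M ⁅ i ⁆ ≡ᵇ 0)
  loopFree-full M g i = trans (loopFree-lookup M i) (cong (_∧ not (rk M ⁅ i ⁆ ≡ᵇ 0)) (trans (cong (λ X → lookup X i) g) (∈⇒lookup {i = i} ∈⊤)))

  Y-invariant : (Q : QAssign) → IsInvKL Q → ∀ {n} (M N : RawMatroid n) → IsMatroid M → IsMatroid N → ground M ≡ ⊤ → ground N ≡ ⊤ →
    (σ : Fin n → Fin n) → IsIso M N σ → Y Q M ≈ₚ Y Q N
  Y-invariant Q iq {n} M N IM IN gM gN σ ((τ , στ , τσ) , iso) k = begin
    Y Q M k ≡⟨ Y≡Ysum Q iq M IM k ⟩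
    Ysum (suc n) (rk M) (loopFree M) k ≡⟨ cong (λ E → Ysum (suc n) (rk M) E k) (sym loops) ⟩
    Ysum (suc n) (rk M) (R.π (loopFree N)) k ≡⟨ sym (R.Ysum-π (suc n) (rk M) (loopFree N) k) ⟩
    Ysum (suc n) (λ X → rk M (R.π X)) (loopFree N) k ≡⟨ Ysum-cong (suc n) {λ X → rk M (R.π X)} {rk N} (λ X _ → sym (iso X)) k ⟩
    Ysum (suc n) (rk N) (loopFree N) k ≡⟨ sym (Y≡Ysum Q iq N IN k) ⟩
    Y Q N k ∎
    where
    open ≡-Reasoning
    module R = Relabel σ τ στ τσ
    -- Besides the ranks, the set of non-loops is an argument of `Ysum`, so the relabelling has to
    -- match it as well.
    loops : R.π (loopFree N) ≡ loopFree M
    loops = lookup-ext λ i → trans (R.lookup-π (loopFree N) i) (trans (loopFree-full N gN (σ i))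
      (trans (cong (λ r → not (r ≡ᵇ 0)) (trans (iso ⁅ σ i ⁆) (cong (rk M) (R.π-singleton i)))) (sym (loopFree-full M gM i))))

  module ChainValuations {n s} (ρ₀ : Subset n → ℕ) (ρs : Fin s → Subset n → ℕ) (c : Fin s → ℤ) where

    -- The cells are remembered only through their rank functions and signed coefficients, and φ is
    -- a function of arbitrary rank functions; the geometry enters through the parameter `chains`
    -- below.
    Valuative : ((Subset n → ℕ) → ℤ) → Set
    Valuative φ = φ ρ₀ ≡ sumL (λ i → c i * φ (ρs i)) (allFin s)

    val-ext : ∀ {φ ψ : (Subset n → ℕ) → ℤ} → (∀ ρ → φ ρ ≡ ψ ρ) → Valuative ψ → Valuative φ
    val-ext e v = trans (e ρ₀) (trans v (sumL-ext (λ i → cong (c i *_) (sym (e (ρs i)))) (allFin s)))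

    val-0 : Valuative (λ _ → 0ℤ)
    val-0 = sym (trans (sumL-ext (λ i → *-zeroʳ (c i)) (allFin s)) (sumL-▹ false c (allFin s)))

    val-▹ : ∀ b {φ : (Subset n → ℕ) → ℤ} → (b ≡ true → Valuative φ) → Valuative (λ ρ → b ▹ φ ρ)
    val-▹ true v = v refl
    val-▹ false v = val-0

    val-* : ∀ a {φ : (Subset n → ℕ) → ℤ} → Valuative φ → Valuative (λ ρ → a * φ ρ)
    val-* a {φ} v = trans (cong (a *_) v) (trans (sym (sumL-*ˡ a (λ i → c i * φ (ρs i)) (allFin s)))
      (sumL-ext (λ i → solve 3 (λ a c f → a :* (c :* f) := c :* (a :* f)) refl a (c i) (φ (ρs i))) (allFin s)))

    val-+ : ∀ {φ ψ : (Subset n → ℕ) → ℤ} → Valuative φ → Valuative ψ → Valuative (λ ρ → φ ρ + ψ ρ)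
    val-+ {φ} {ψ} v w = trans (cong₂ _+_ v w) (trans (sym (sumL-+ (λ i → c i * φ (ρs i)) (λ i → c i * ψ (ρs i)) (allFin s)))
      (sumL-ext (λ i → sym (*-distribˡ-+ (c i) (φ (ρs i)) (ψ (ρs i)))) (allFin s)))

    val-sumS : ∀ {m} (φ : Subset m → (Subset n → ℕ) → ℤ) → (∀ X → Valuative (φ X)) → Valuative (λ ρ → sumS (λ X → φ X ρ))
    val-sumS {m} φ v = trans (sumS-ext v) (trans (sumL-swap (λ X i → c i * φ X (ρs i)) (allSub m) (allFin s))
      (sumL-ext (λ i → sumL-*ˡ (c i) (λ X → φ X (ρs i)) (allSub m)) (allFin s)))

    val-pairs : (b : Subset n → Bool) (b' : Subset n → Subset n → Bool) (φ : Subset n → Subset n → (Subset n → ℕ) → ℤ) →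
      (∀ F A → b F ≡ true → b' F A ≡ true → Valuative (φ F A)) → Valuative (λ ρ → sumS (λ F → sumS (λ A → b F ▹ b' F A ▹ sign ∣ A ∣ * φ F A ρ)))
    val-pairs b b' φ h = val-sumS (λ F ρ → sumS (λ A → b F ▹ b' F A ▹ sign ∣ A ∣ * φ F A ρ)) λ F →
      val-sumS (λ A ρ → b F ▹ b' F A ▹ sign ∣ A ∣ * φ F A ρ) λ A →
        val-▹ (b F) {λ ρ → b' F A ▹ sign ∣ A ∣ * φ F A ρ} λ p → val-▹ (b' F A) {λ ρ → sign ∣ A ∣ * φ F A ρ} λ p' → val-* (sign ∣ A ∣) {φ F A} (h F A p p')

    head₀ : List ℕ → ℕ
    head₀ [] = 0
    head₀ (r ∷ _) = r

    -- The two branches of `invKL` as a sum, with its tests turned into factors: the rank of G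
    -- differs between cells, so a case distinction on it would have to be made cell by cell.
    constantPart leadingPart : ℕ → ℕ → ℤ
    constantPart r k = (r ≡ᵇ 0) ▹ (k ≡ᵇ 0) ▹ 1ℤ
    leadingPart r k = not (r ≡ᵇ 0) ▹ (2 ℕ.* k <ᵇ r) ▹ sign r

    -- The list starts with the ranks h of H and u of A ∪ H, followed by those of G and the members
    -- above it. All scalar factors of one unfolding step are multiplied onto g. The index κ of the
    -- wanted coefficient is likewise a function of the ranks, since it too differs between cells.
    -- The value on shorter lists is a default.
    nextWeight : (List ℕ → ℤ) → (List ℕ → ℕ) → List ℕ → ℤ
    nextWeight g κ (h ∷ u ∷ l) = g l * (leadingPart (head₀ l) (κ l) * sign h) * (((u ∸ h) ≤ᵇ (head₀ l ∸ κ l)) ▹ 1ℤ)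
    nextWeight g κ _ = 0ℤ

    nextIndex : (List ℕ → ℕ) → List ℕ → ℕ
    nextIndex κ (h ∷ u ∷ l) = head₀ l ∸ κ l ∸ (u ∸ h)
    nextIndex κ _ = 0

    invKL-split : ∀ m (ρ : Subset n → ℕ) G k → invKL (suc m) ρ G k ≡ constantPart (ρ G) k +
      leadingPart (ρ G) k * sumS (λ H → proper H G ▹ summand ρ G (ρ G ∸ k) H (invKL m ρ H))
    invKL-split m ρ G k = at (ρ G ≡ᵇ 0) (2 ℕ.* k <ᵇ ρ G)
      where
      S : ℤ
      S = sumS (λ H → proper H G ▹ summand ρ G (ρ G ∸ k) H (invKL m ρ H))
      at : ∀ a b → (if a then ((k ≡ᵇ 0) ▹ 1ℤ) else (b ▹ sign (ρ G) * S)) ≡ (a ▹ (k ≡ᵇ 0) ▹ 1ℤ) + (not a ▹ b ▹ sign (ρ G)) * S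
      at true b = sym (trans (cong (((k ≡ᵇ 0) ▹ 1ℤ) +_) (*-zeroˡ S)) (+-identityʳ ((k ≡ᵇ 0) ▹ 1ℤ)))
      at false true = sym (+-identityˡ (sign (ρ G) * S))
      at false false = sym (trans (+-identityˡ (0ℤ * S)) (*-zeroˡ S))

    invKL-expand : ∀ m (g : List ℕ → ℤ) (κ : List ℕ → ℕ) ρ G Cs → g (map ρ (G ∷ Cs)) * invKL (suc m) ρ G (κ (map ρ (G ∷ Cs))) ≡
      g (map ρ (G ∷ Cs)) * constantPart (ρ G) (κ (map ρ (G ∷ Cs))) +
      sumS (λ H → sumS (λ A → proper H G ▹ subᵇ A (G ∩ ∁ H) ▹ sign ∣ A ∣ *
        (nextWeight g κ (map ρ (H ∷ A ∪ H ∷ G ∷ Cs)) * invKL m ρ H (nextIndex κ (map ρ (H ∷ A ∪ H ∷ G ∷ Cs))))))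
    invKL-expand m g κ ρ G Cs = begin
      γ * invKL (suc m) ρ G k
        ≡⟨ cong (γ *_) (invKL-split m ρ G k) ⟩
      γ * (constantPart (ρ G) k + leadingPart (ρ G) k * sumS (λ H → proper H G ▹ summand ρ G (ρ G ∸ k) H (invKL m ρ H)))
        ≡⟨ solve 4 (λ g a l s → g :* (a :+ l :* s) := g :* a :+ g :* l :* s) refl γ (constantPart (ρ G) k) (leadingPart (ρ G) k) _ ⟩
      γ * constantPart (ρ G) k + γ * leadingPart (ρ G) k * sumS (λ H → proper H G ▹ summand ρ G (ρ G ∸ k) H (invKL m ρ H))
        ≡⟨ cong (γ * constantPart (ρ G) k +_) (trans (sym (sumL-*ˡ (γ * leadingPart (ρ G) k) (λ H → proper H G ▹ summand ρ G (ρ G ∸ k) H (invKL m ρ H)) (allSub n))) (sumS-ext inner)) ⟩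
      γ * constantPart (ρ G) k + sumS (λ H → sumS (λ A → proper H G ▹ subᵇ A (G ∩ ∁ H) ▹ sign ∣ A ∣ * (nextWeight g κ (l H A) * invKL m ρ H (nextIndex κ (l H A))))) ∎
      where
      open ≡-Reasoning
      γ : ℤ
      γ = g (map ρ (G ∷ Cs))
      k : ℕ
      k = κ (map ρ (G ∷ Cs))
      l : Subset n → Subset n → List ℕ
      l H A = map ρ (H ∷ A ∪ H ∷ G ∷ Cs)
      L : ℤ
      L = γ * leadingPart (ρ G) k
      f : Subset n → Subset n → ℤ
      f H A = ((ρ (A ∪ H) ∸ ρ H) ≤ᵇ (ρ G ∸ k)) ▹ invKL m ρ H (ρ G ∸ k ∸ (ρ (A ∪ H) ∸ ρ H))
      term : ∀ H A → L * sign (ρ H) * (sign ∣ A ∣ * f H A) ≡ sign ∣ A ∣ * (nextWeight g κ (l H A) * invKL m ρ H (nextIndex κ (l H A)))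
      term H A = at ((ρ (A ∪ H) ∸ ρ H) ≤ᵇ (ρ G ∸ k)) (invKL m ρ H (ρ G ∸ k ∸ (ρ (A ∪ H) ∸ ρ H)))
        where
        at : ∀ b x → L * sign (ρ H) * (sign ∣ A ∣ * (b ▹ x)) ≡ sign ∣ A ∣ * (γ * (leadingPart (ρ G) k * sign (ρ H)) * (b ▹ 1ℤ) * x)
        at true x = solve 5 (λ g l h a x → g :* l :* h :* (a :* x) := a :* (g :* (l :* h) :* con 1ℤ :* x)) refl γ (leadingPart (ρ G) k) (sign (ρ H)) (sign ∣ A ∣) x
        at false x = solve 5 (λ g l h a x → g :* l :* h :* (a :* con 0ℤ) := a :* (g :* (l :* h) :* con 0ℤ :* x)) refl γ (leadingPart (ρ G) k) (sign (ρ H)) (sign ∣ A ∣) x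
      inner : ∀ H → L * (proper H G ▹ summand ρ G (ρ G ∸ k) H (invKL m ρ H)) ≡ sumS (λ A → proper H G ▹ subᵇ A (G ∩ ∁ H) ▹ sign ∣ A ∣ * (nextWeight g κ (l H A) * invKL m ρ H (nextIndex κ (l H A))))
      inner H = trans (*-▹ (proper H G) L (summand ρ G (ρ G ∸ k) H (invKL m ρ H))) (trans (cong (proper H G ▹_) (trans (sym (*-assoc L (sign (ρ H)) (W ρ G H (λ r → ((r ∸ ρ H) ≤ᵇ (ρ G ∸ k)) ▹ invKL m ρ H (ρ G ∸ k ∸ (r ∸ ρ H))))))
          (trans (sym (sumL-*ˡ (L * sign (ρ H)) (λ A → subᵇ A (G ∩ ∁ H) ▹ sign ∣ A ∣ * f H A) (allSub n)))
            (sumS-ext λ A → trans (*-▹ (subᵇ A (G ∩ ∁ H)) (L * sign (ρ H)) (sign ∣ A ∣ * f H A)) (cong (subᵇ A (G ∩ ∁ H) ▹_) (term H A))))))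
        (sym (sumL-▹ (proper H G) (λ A → subᵇ A (G ∩ ∁ H) ▹ sign ∣ A ∣ * (nextWeight g κ (l H A) * invKL m ρ H (nextIndex κ (l H A)))) (allSub n))))

    between : ∀ {A G H : Subset n} → H ⊆ G → subᵇ A (G ∩ ∁ H) ≡ true → ∀ Cs → Ascending ⊥ (G ∷ Cs) → Ascending ⊥ (H ∷ A ∪ H ∷ G ∷ Cs)
    between {A} {G} {H} h a Cs (_ , asc) = (λ p → ⊆-min H p) , (λ p → q⊆p∪q A H p) , ∪-lub (λ p → p∩q⊆p G (∁ H) (subᵇ⇒⊆ {X = A} {G ∩ ∁ H} a p)) h , asc

    module _ (chains : ∀ Cs → Ascending ⊥ Cs → (g : List ℕ → ℤ) → Valuative (λ ρ → g (map ρ Cs))) where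

      -- Unfolding the recursion extends the chain at its lower end, so only ranks of
      -- members of a single chain are ever involved.
      invKL-valuative : ∀ m G Cs → Ascending ⊥ (G ∷ Cs) → ∀ (g : List ℕ → ℤ) (κ : List ℕ → ℕ) → Valuative (λ ρ → g (map ρ (G ∷ Cs)) * invKL m ρ G (κ (map ρ (G ∷ Cs))))
      invKL-valuative zero G Cs asc g κ = val-ext {λ ρ → g (map ρ (G ∷ Cs)) * 0ℤ} {λ _ → 0ℤ} (λ ρ → *-zeroʳ (g (map ρ (G ∷ Cs)))) val-0
      invKL-valuative (suc m) G Cs asc g κ = val-ext {λ ρ → g (map ρ (G ∷ Cs)) * invKL (suc m) ρ G (κ (map ρ (G ∷ Cs)))} {λ ρ → head ρ + rest ρ} (λ ρ → invKL-expand m g κ ρ G Cs)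
        (val-+ {head} {rest} (chains (G ∷ Cs) asc (λ l → g l * constantPart (head₀ l) (κ l)))
          (val-pairs (λ H → proper H G) (λ H A → subᵇ A (G ∩ ∁ H)) φ λ H A p a →
            invKL-valuative m H (A ∪ H ∷ G ∷ Cs) (between (proj₁ (proper-elim {H = H} {G} p)) a Cs asc) (nextWeight g κ) (nextIndex κ)))
        where
        φ : Subset n → Subset n → (Subset n → ℕ) → ℤ
        φ H A ρ = nextWeight g κ (map ρ (H ∷ A ∪ H ∷ G ∷ Cs)) * invKL m ρ H (nextIndex κ (map ρ (H ∷ A ∪ H ∷ G ∷ Cs)))
        head rest : (Subset n → ℕ) → ℤ
        head ρ = g (map ρ (G ∷ Cs)) * constantPart (ρ G) (κ (map ρ (G ∷ Cs)))
        rest ρ = sumS (λ H → sumS (λ A → proper H G ▹ subᵇ A (G ∩ ∁ H) ▹ sign ∣ A ∣ * φ H A ρ))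

      -- In each term the chain is F ⊆ A ∪ F ⊆ E, and all factors besides the polynomial of F depend
      -- on its three ranks; they form the initial weight for `invKL-valuative`.
      Ysum-valuative : ∀ m E k → Valuative (λ ρ → Ysum m ρ E k)
      Ysum-valuative m E k = val-ext {λ ρ → Ysum m ρ E k} {λ ρ → sumS (λ F → sumS (λ A → subᵇ F E ▹ subᵇ A (E ∩ ∁ F) ▹ sign ∣ A ∣ * φ F A ρ))} expand
          (val-pairs (λ F → subᵇ F E) (λ F A → subᵇ A (E ∩ ∁ F)) φ λ F A f a →
            invKL-valuative m F (A ∪ F ∷ E ∷ []) (between (subᵇ⇒⊆ {X = F} {E} f) a [] ((λ p → ⊆-min E p) , tt)) weight index)
        where
        open ≡-Reasoning
        weight : List ℕ → ℤ
        weight (f ∷ u ∷ e ∷ _) = sign e * sign f * ((u ≡ᵇ e) ▹ 1ℤ) * (not (k <ᵇ (e ∸ f)) ▹ 1ℤ)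
        weight _ = 0ℤ
        index : List ℕ → ℕ
        index (f ∷ u ∷ e ∷ _) = k ∸ (e ∸ f)
        index _ = 0
        l : (Subset n → ℕ) → Subset n → Subset n → List ℕ
        l ρ F A = map ρ (F ∷ A ∪ F ∷ E ∷ [])
        φ : Subset n → Subset n → (Subset n → ℕ) → ℤ
        φ F A ρ = weight (l ρ F A) * invKL m ρ F (index (l ρ F A))
        expand : ∀ ρ → Ysum m ρ E k ≡ sumS (λ F → sumS (λ A → subᵇ F E ▹ subᵇ A (E ∩ ∁ F) ▹ sign ∣ A ∣ * (weight (l ρ F A) * invKL m ρ F (index (l ρ F A)))))
        expand ρ = trans (sym (sumL-*ˡ (sign (ρ E)) (λ F → subᵇ F E ▹ (sign (ρ F) * W ρ E F δ) * Z F) (allSub n))) (sumS-ext λ F → begin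
            sign (ρ E) * (subᵇ F E ▹ (sign (ρ F) * W ρ E F δ) * Z F)
              ≡⟨ *-▹ (subᵇ F E) (sign (ρ E)) ((sign (ρ F) * W ρ E F δ) * Z F) ⟩
            (subᵇ F E ▹ sign (ρ E) * (sign (ρ F) * W ρ E F δ * Z F))
              ≡⟨ cong (subᵇ F E ▹_) (trans (solve 4 (λ e f w z → e :* (f :* w :* z) := e :* f :* z :* w) refl (sign (ρ E)) (sign (ρ F)) (W ρ E F δ) (Z F))
                   (trans (sym (sumL-*ˡ (sign (ρ E) * sign (ρ F) * Z F) (λ A → subᵇ A (E ∩ ∁ F) ▹ sign ∣ A ∣ * δ (ρ (A ∪ F))) (allSub n)))
                     (sumS-ext λ A → trans (*-▹ (subᵇ A (E ∩ ∁ F)) (sign (ρ E) * sign (ρ F) * Z F) (sign ∣ A ∣ * δ (ρ (A ∪ F)))) (cong (subᵇ A (E ∩ ∁ F) ▹_) (term F A))))) ⟩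
            (subᵇ F E ▹ sumS (λ A → subᵇ A (E ∩ ∁ F) ▹ sign ∣ A ∣ * (weight (l ρ F A) * invKL m ρ F (index (l ρ F A)))))
              ≡⟨ sym (sumL-▹ (subᵇ F E) (λ A → subᵇ A (E ∩ ∁ F) ▹ sign ∣ A ∣ * (weight (l ρ F A) * invKL m ρ F (index (l ρ F A)))) (allSub n)) ⟩
            sumS (λ A → subᵇ F E ▹ subᵇ A (E ∩ ∁ F) ▹ sign ∣ A ∣ * (weight (l ρ F A) * invKL m ρ F (index (l ρ F A)))) ∎)
          where
          δ : ℕ → ℤ
          δ r = (r ≡ᵇ ρ E) ▹ 1ℤ
          Z : Subset n → ℤ
          Z F = shift (ρ E ∸ ρ F) (invKL m ρ F) k
          term : ∀ F A → sign (ρ E) * sign (ρ F) * Z F * (sign ∣ A ∣ * δ (ρ (A ∪ F))) ≡ sign ∣ A ∣ * (weight (l ρ F A) * invKL m ρ F (index (l ρ F A)))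
          term F A = at (k <ᵇ (ρ E ∸ ρ F)) (invKL m ρ F (k ∸ (ρ E ∸ ρ F)))
            where
            at : ∀ b x → sign (ρ E) * sign (ρ F) * (if b then 0ℤ else x) * (sign ∣ A ∣ * δ (ρ (A ∪ F))) ≡
              sign ∣ A ∣ * (sign (ρ E) * sign (ρ F) * δ (ρ (A ∪ F)) * (not b ▹ 1ℤ) * x)
            at true x = solve 5 (λ e f a d x → e :* f :* con 0ℤ :* (a :* d) := a :* (e :* f :* d :* con 0ℤ :* x)) refl (sign (ρ E)) (sign (ρ F)) (sign ∣ A ∣) (δ (ρ (A ∪ F))) x
            at false x = solve 5 (λ e f a d x → e :* f :* x :* (a :* d) := a :* (e :* f :* d :* con 1ℤ :* x)) refl (sign (ρ E)) (sign (ρ F)) (sign ∣ A ∣) (δ (ρ (A ∪ F))) x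

  Y-valuative : (Q : QAssign) → IsInvKL Q → ∀ {n} (M : RawMatroid n) → IsMatroid M → ground M ≡ ⊤ →
    (s : ℕ) (Ms : Fin s → RawMatroid n) → IsSubdivision M s Ms → (d : ℕ) → HasDim M d → (dims : Fin s → ℕ) → (∀ i → HasDim (Ms i) (dims i)) →
    (int : Fin s → Bool) → (∀ i → (int i ≡ true → NotInBoundary M (Ms i)) × (NotInBoundary M (Ms i) → int i ≡ true)) →
    Y Q M ≈ₚ sumₚ (map (λ i → if int i then scale (sign (d ∸ dims i)) (Y Q (Ms i)) else 0ₚ) (allFin s))
  Y-valuative Q iq {n} M IM gM s Ms S d hd dims hds int hint k = begin
    Y Q M k
      ≡⟨ Y≡Ysum Q iq M IM k ⟩
    Ysum (suc n) (rk M) E k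
      ≡⟨ Ysum-valuative (chain-valuation IM gM S hd hds int hint) (suc n) E k ⟩
    sumL (λ i → signAt d dims int i * Ysum (suc n) (rk (Ms i)) E k) (allFin s)
      ≡⟨ sumL-ext (λ i → cell i (int i) refl) (allFin s) ⟩
    sumL (λ i → (if int i then scale (sign (d ∸ dims i)) (Y Q (Ms i)) else 0ₚ) k) (allFin s)
      ≡⟨ sym (sumₚ-map (λ i → if int i then scale (sign (d ∸ dims i)) (Y Q (Ms i)) else 0ₚ) (allFin s) k) ⟩
    sumₚ (map (λ i → if int i then scale (sign (d ∸ dims i)) (Y Q (Ms i)) else 0ₚ) (allFin s)) k ∎
    where
    open ≡-Reasoning
    open IsSubdivision S using (pieces-matroid; pieces-ground)
    open ChainValuations (rk M) (λ i → rk (Ms i)) (signAt d dims int)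
    E : Subset n
    E = loopFree M
    same-loops : ∀ i → int i ≡ true → E ≡ loopFree (Ms i)
    same-loops i t = lookup-ext λ j → trans (loopFree-full M gM j) (trans (cong not (bool-ext
        (λ e → ≡ᵇ-true (loop⇒loop-of-cell IM gM S hd hds int hint i j (≡ᵇ-elim {rk M ⁅ j ⁆} e)))
        (λ e → ≡ᵇ-true (loop-of-interior⇒loop IM gM S hd hds int hint i j t (≡ᵇ-elim {rk (Ms i) ⁅ j ⁆} e)))))
      (sym (loopFree-full (Ms i) (pieces-ground i) j)))
    cell : ∀ i b → int i ≡ b → signAt d dims int i * Ysum (suc n) (rk (Ms i)) E k ≡ (if int i then scale (sign (d ∸ dims i)) (Y Q (Ms i)) else 0ₚ) k
    cell i true t = trans (cong₂ _*_ (cong (λ b → if b then sign (d ∸ dims i) else 0ℤ) t)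
        (trans (cong (λ E → Ysum (suc n) (rk (Ms i)) E k) (same-loops i t)) (sym (Y≡Ysum Q iq (Ms i) (pieces-matroid i) k))))
      (cong (λ b → (if b then scale (sign (d ∸ dims i)) (Y Q (Ms i)) else 0ₚ) k) (sym t))
    -- A boundary cell may have more loops than M, so its Y need not be the sum over the non-loops
    -- of M; its coefficient is 0.
    cell i false t = trans (cong (λ b → (if b then sign (d ∸ dims i) else 0ℤ) * Ysum (suc n) (rk (Ms i)) E k) t)
      (trans (*-zeroˡ (Ysum (suc n) (rk (Ms i)) E k)) (cong (λ b → (if b then scale (sign (d ∸ dims i)) (Y Q (Ms i)) else 0ₚ) k) (sym t)))

open import Defs
open import Data.Bool using (Bool; true; false; if_then_else_)
open import Data.Nat using (ℕ; _∸_)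
open import Data.Fin using (Fin)
open import Data.Fin.Subset using (⊤)
import Data.List
open import Data.Product using (Σ; _×_; _,_)
open import Relation.Binary.PropositionalEquality using (_≡_)

theorem1p2 : (Q : QAssign) → IsInvKL Q →
    (∀ {n} (M N : RawMatroid n) → IsMatroid M → IsMatroid N →
    ground M ≡ ⊤ → ground N ≡ ⊤ →
    (σ : Fin n → Fin n) → IsIso M N σ → Y Q M ≈ₚ Y Q N)
    ×
    (∀ {n} (M : RawMatroid n) → IsMatroid M → ground M ≡ ⊤ →
    (s : ℕ) (Ms : Fin s → RawMatroid n) → IsSubdivision M s Ms →
    (d : ℕ) → HasDim M d →
    (dims : Fin s → ℕ) → (∀ i → HasDim (Ms i) (dims i)) →
    (int : Fin s → Bool) →
    (∀ i → (int i ≡ true → NotInBoundary M (Ms i))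
    × (NotInBoundary M (Ms i) → int i ≡ true)) →
    Y Q M ≈ₚ sumₚ (Data.List.map
    (λ i → if int i then scale (sign (d ∸ dims i)) (Y Q (Ms i)) else 0ₚ)
    (Data.List.allFin s)))
theorem1p2 Q iq = Final.Y-invariant Q iq , Final.Y-valuative Q iq
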